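{- Let $G$ be a 3-connected cubic graph on $n$ vertices with a distinguished root $r\in V(G)$. If every peripheral cycle of $G$ has length at most $q$, then the graph $G-r$ has at least $2^{n/(2q)}$ decompositions into a spanning tree and a 2-base, i.e. there are at least $2^{n/(2q)}$ partitions of $E(G-r)$ into $\{T,B\}$ where $T$ is the edge-set of a spanning tree of $G-r$ and $B$ is a 2-base of $G-r$.
   Context: Graphs are finite. A graph is 3-connected if it has more than three vertices and remains connected after deleting any set of fewer than three vertices. A graph is cubic if all degrees equal 3, and subcubic if all degrees are at most 3. $G-r$ is obtained by deleting the vertex $r$ and its incident edges; $G-S$ for $S\subseteq E(G)$ is obtained by deleting the edges of $S$ while keeping all vertices. In a subcubic graph $G=(V,E)$, an edge-set $S\subseteq E$ is peripheral if $G-S$ is connected; a subgraph (in particular a cycle) $H\subseteq G$ is peripheral if $E(H)$ is peripheral. For a positive integer $k$ and $S\subseteq E$, the $k$-closure $\langle S\rangle_k$ is the minimal edge-set $R$ with $S\subseteq R\subseteq E$ such that every cycle $C\subseteq G$ with $E(C)\setminus R\neq\emptyset$ has at least $k+1$ edges not in $R$. A set $S\subseteq E$ is a $k$-base of $G$ if $\langle S\rangle_k=E$. -}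

module Defs where

open import Data.Bool using (true; _∧_)
open import Data.Fin using (Fin; _≟_)
open import Data.Fin.Subset
  using (Subset; ⊤; ⊥; ∁; ⁅_⁆; ⋃; _∪_; _∩_; _─_; _∈_; _⊆_; ∣_∣; Nonempty)
open import Data.Fin.Subset.Properties using (∈⊤)
open import Data.List using (List; []; _∷_; length; map)
open import Data.List.Relation.Unary.All using (All)
open import Data.List.Relation.Unary.Unique.Propositional using (Unique)
open import Data.Nat using (ℕ; _+_; _^_; _<_; _≤_)
open import Data.Product using (_×_; _,_; proj₁; proj₂; ∃-syntax)
open import Data.Sum using (_⊎_)
open import Data.Vec using (lookup; tabulate)
open import Data.Vec.Properties using (lookup∘tabulate; lookup⇒[]=; []=⇒lookup)
open import Relation.Binary.PropositionalEquality using (_≡_; refl; sym; trans)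
open import Relation.Nullary using (¬_; does)

-- Finite graphs, with loops and parallel edges allowed.  The order in the
-- pair `ends e` carries no meaning: see `Joins`.
record Graph : Set where
  field
    order : ℕ
    size  : ℕ
    ends  : Fin size → Fin order × Fin order

  Vertex : Set
  Vertex = Fin order

  Edge : Set
  Edge = Fin size

  Joins : Edge → Vertex → Vertex → Set
  Joins e x y = ends e ≡ (x , y) ⊎ ends e ≡ (y , x)

  -- A loop counts twice.
  degree : Vertex → ℕ
  degree v = ∣ tabulate (λ e → does (proj₁ (ends e) ≟ v)) ∣
           + ∣ tabulate (λ e → does (proj₂ (ends e) ≟ v)) ∣

open Graph public using (order; size; Vertex; Edge)

record Subgraph (G : Graph) : Set where
  open Graph G using (ends)
  field
    verts  : Subset (order G)
    edges  : Subset (size G)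
    closed : ∀ {e} → e ∈ edges → proj₁ (ends e) ∈ verts × proj₂ (ends e) ∈ verts

open Subgraph public using (verts; edges)

module _ (G : Graph) where
  open Graph G using (ends)

  whole : Subgraph G
  whole = record { verts = ⊤ ; edges = ⊤ ; closed = λ _ → ∈⊤ , ∈⊤ }

  induced : Subset (order G) → Subgraph G
  induced W = record
    { verts  = W
    ; edges  = tabulate inside?
    ; closed = λ {e} e∈ →
        let p , q = split (trans (sym (lookup∘tabulate inside? e)) ([]=⇒lookup e∈))
        in lookup⇒[]= _ W p , lookup⇒[]= _ W q
    }
    where
    inside? = λ e → lookup W (proj₁ (ends e)) ∧ lookup W (proj₂ (ends e))

    split : ∀ {a b} → a ∧ b ≡ true → a ≡ true × b ≡ true
    split {true} {true} _ = refl , refl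

  deleteVertices : Subset (order G) → Subgraph G
  deleteVertices X = induced (∁ X)

  deleteVertex : Vertex G → Subgraph G
  deleteVertex r = deleteVertices ⁅ r ⁆

  deleteEdges : Subset (size G) → Subgraph G
  deleteEdges S = record { verts = ⊤ ; edges = ∁ S ; closed = λ _ → ∈⊤ , ∈⊤ }

module _ {G : Graph} where
  open Graph G using (Joins)

  data Walk (H : Subgraph G) : Vertex G → Vertex G → Set where
    []   : ∀ {x} → Walk H x x
    step : ∀ {x y z} (e : Edge G) → e ∈ edges H → Joins e x y →
           Walk H y z → Walk H x z

  module _ {H : Subgraph G} where

    edgeList : ∀ {x y} → Walk H x y → List (Edge G)
    edgeList []             = []
    edgeList (step e _ _ w) = e ∷ edgeList w

    -- All vertices in order of visit, except the final one.
    departures : ∀ {x y} → Walk H x y → List (Vertex G)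
    departures []                 = []
    departures (step {x} _ _ _ w) = x ∷ departures w

  Connected : Subgraph G → Set
  Connected H = Nonempty (verts H) ×
                (∀ {x y} → x ∈ verts H → y ∈ verts H → Walk H x y)

  -- A cycle is given by a closed walk without repetitions; distinctness of the
  -- edges only matters for length 2.
  record Cycle (H : Subgraph G) : Set where
    field
      {base}            : Vertex G
      walk              : Walk H base base
      nontrivial        : 0 < length (edgeList walk)
      distinct-vertices : Unique (departures walk)
      distinct-edges    : Unique (edgeList walk)

  cycleLength : {H : Subgraph G} → Cycle H → ℕ
  cycleLength C = length (edgeList (Cycle.walk C))

  cycleEdges : {H : Subgraph G} → Cycle H → Subset (size G)
  cycleEdges C = ⋃ (map ⁅_⁆ (edgeList (Cycle.walk C)))

  record IsSpanningTree (H : Subgraph G) (T : Subset (size G)) : Set where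
    field
      T⊆E : T ⊆ edges H

    tree : Subgraph G
    tree = record
      { verts = verts H ; edges = T ; closed = λ e∈T → Subgraph.closed H (T⊆E e∈T) }

    field
      connected : Connected tree
      acyclic   : ¬ Cycle tree

  record Admissible (k : ℕ) (H : Subgraph G) (S R : Subset (size G)) : Set where
    field
      S⊆R    : S ⊆ R
      R⊆E    : R ⊆ edges H
      cycles : (C : Cycle H) → Nonempty (cycleEdges C ─ R) →
               k + 1 ≤ ∣ cycleEdges C ─ R ∣

  -- R = ⟨S⟩ₖ in H.  Admissible sets are stable under intersection, so the
  -- minimal one is the least one.
  record IsClosure (k : ℕ) (H : Subgraph G) (S R : Subset (size G)) : Set where
    field
      admissible : Admissible k H S R
      least      : ∀ R′ → Admissible k H S R′ → R ⊆ R′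

  IsBase : ℕ → (H : Subgraph G) → Subset (size G) → Set
  IsBase k H S = IsClosure k H S (edges H)

  record IsDecomposition (H : Subgraph G) (T B : Subset (size G)) : Set where
    field
      cover    : T ∪ B ≡ edges H
      disjoint : T ∩ B ≡ ⊥
      tree     : IsSpanningTree H T
      2-base   : IsBase 2 H B

IsCubic : Graph → Set
IsCubic G = ∀ v → Graph.degree G v ≡ 3

IsKConnected : ℕ → Graph → Set
IsKConnected k G =
  k < order G × (∀ X → ∣ X ∣ < k → Connected (deleteVertices G X))

IsPeripheral : (G : Graph) → Subset (size G) → Set
IsPeripheral G S = Connected (deleteEdges G S)

-- At least 2^(a/b) elements satisfy P, for b ≠ 0: if N distinct ones are listed,
-- the real inequality 2^(a/b) ≤ N is written 2^a ≤ N^b.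
AtLeast2^ : (a b : ℕ) {A : Set} → (A → Set) → Set
AtLeast2^ a b {A} P =
  ∃[ xs ] Unique {A = A} xs × All P xs × 2 ^ a ≤ length xs ^ b

-- With T and B labelled, each decomposition is one ordered pair.  For G cubic
-- with more than two vertices this agrees with counting unordered {T, B}: B has
-- fewer edges than a spanning tree of G - r, so the roles cannot be exchanged.
DecompositionPair : {G : Graph} → Subgraph G → Subset (size G) × Subset (size G) → Set
DecompositionPair H (T , B) = IsDecomposition H T B

{-# OPTIONS --safe #-}
module Submission where

open import Defs
import Algebra.Properties.CommutativeMonoid.Sum
open import Data.Bool using (Bool; true; false; _∧_; if_then_else_)
open import Data.Empty using (⊥-elim)
import Data.Empty as Empty
open import Data.Fin using (Fin; zero; suc; _≟_)
open import Data.Fin.Properties using (any?; all?)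
open import Data.Fin.Subset
  using (Subset; inside; outside; ⊤; ⊥; ∁; ⁅_⁆; ⋃; _∪_; _∩_; _─_; _∈_; _∉_; _⊆_; ∣_∣; Nonempty)
open import Data.Fin.Subset.Properties
open import Data.List using (List; []; _∷_; length; map; _++_)
open import Data.List.Relation.Unary.All using (All; []; _∷_)
import Data.List.Relation.Unary.All as All
import Data.List.Relation.Unary.All.Properties as All
import Data.List.Relation.Unary.Unique.Propositional.Properties as Unique
open import Data.List.Properties using (length-++; length-map)
open import Data.List.Membership.Propositional.Properties using (∈-map⁻)
open import Data.List.Relation.Unary.AllPairs using ([]; _∷_)
open import Data.List.Relation.Unary.Unique.Propositional using (Unique)
open import Data.Nat using (ℕ; zero; suc; NonZero; _+_; _*_; _∸_; _^_; _≤_; _<_; z≤n; s≤s; s≤s⁻¹)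
open import Data.Nat.Properties hiding (_≟_)
open import Data.Nat.Solver using (module +-*-Solver)
open import Data.Product using (_×_; _,_; proj₁; proj₂; ∃-syntax)
open import Data.Sum using (_⊎_; inj₁; inj₂; [_,_]′)
import Data.Sum as Sum
open import Data.Vec using (Vec; []; _∷_; tabulate; lookup; here; there; padRight; take; drop)
import Data.Vec as Vec
open import Data.Vec.Properties using (lookup∘tabulate; lookup⇒[]=; []=⇒lookup; take++drop≡id; ∷-injective)
open import Function using (_∘_; id)
open import Relation.Binary.PropositionalEquality
  using (_≡_; _≢_; refl; sym; trans; cong; cong₂; subst; ≢-sym)
open import Relation.Nullary using (¬_; Dec; yes; no; does)
open import Relation.Nullary.Decidable using (_×-dec_; _⊎-dec_; _→-dec_; ¬?; dec-true)
import Relation.Nullary.Decidable as Dec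
open import Relation.Unary using (Pred; Decidable)
open import Level using (0ℓ)

-- The decompositions of G - r are built by treating the vertices in stages.  Let
-- F be the treated part, U the rest, both connected.  A handle is a path Q in U
-- whose two ends have neighbours in F, with U - Q connected and attached to all
-- of Q.  Put the inner edges of Q into B and all edges between Q and U - Q into
-- T: two edges join Q to F, so a cycle through F and Q generates them, and Q
-- consists of leaves hanging on the tree of U - Q.  A minimal part L of U having
-- at most one edge that does not end in F either has only three leaving edges,
-- and is then solved independently of the rest, or it has two handles Q, Q' that
-- meet without Q being contained in Q'.  An edge of Q leaving Q' is in B for the
-- first choice and in T for the second, so every such step doubles the number of
-- decompositions.
--
-- Handles and peripheral cycles both come from one extremal argument: a maximal
-- connected set M that leaves p joined to D has a path from p to D as its
-- complement.  Applied outside Q, this closes Q to a peripheral cycle, so Q has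
-- at most q - 1 vertices and a step spends at most q - 2 edges of B.  Since
-- |B| = n / 2 - 1, at least (n - 2) / (2 (q - 2)) steps double the count.

-- Finite subsets

-- Closures are taken in `G - r`, so no generating cycle may pass through the root, and this shapes
-- the invariant. Three edges join `r` to the rest; the first handle runs between the ends of two of
-- them, and the third remains as the one edge leaving U that does not end in F. A piece with three
-- leaving edges at distinct vertices is the same situation with F empty, so the root gives the
-- first instance of such a cut. There the conflicting handles come for free: both start at one of
-- the three vertices, and each ends at one of the other two and misses the third. Solving such a
-- piece alone is enough because two of its edges end in F: a cycle through F and the piece has only
-- these two left to generate, as a 2-closure permits. The third edge, if it leads into U, joins the
-- two trees. With more than two vertices of L next to F, 3-connectivity does not suffice for the
-- extremal argument, since the edges it provides may run into F. For sets containing such a vertex,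
-- minimality of L takes its place.

private variable
  n : ℕ
  P Q : Subset n

∪⁻ : ∀ {x : Fin n} → x ∈ P ∪ Q → x ∈ P ⊎ x ∈ Q
∪⁻ = x∈p∪q⁻ _ _

∪ˡ : ∀ {x : Fin n} → x ∈ P → x ∈ P ∪ Q
∪ˡ x∈ = x∈p∪q⁺ (inj₁ x∈)

∪ʳ : ∀ {x : Fin n} → x ∈ Q → x ∈ P ∪ Q
∪ʳ x∈ = x∈p∪q⁺ (inj₂ x∈)

─⁺ : ∀ {x : Fin n} → x ∈ P → x ∉ Q → x ∈ P ─ Q
─⁺ = x∈p∧x∉q⇒x∈p─q

─⁻ˡ : ∀ {x : Fin n} → x ∈ P ─ Q → x ∈ P
─⁻ˡ = p─q⊆p _ _

─⁻ʳ : ∀ {x : Fin n} → x ∈ P ─ Q → x ∉ Q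
─⁻ʳ {P = _ ∷ _} {Q = inside ∷ _}  {zero} () _
─⁻ʳ {P = _ ∷ _} {Q = outside ∷ _} {zero} _ ()
─⁻ʳ {P = _ ∷ _} {Q = _ ∷ _} {suc x} (there x∈) (there x∈Q) = ─⁻ʳ x∈ x∈Q

∈⁅⁆⁻ : ∀ {x y : Fin n} → x ∈ ⁅ y ⁆ → x ≡ y
∈⁅⁆⁻ = x∈⁅y⁆⇒x≡y _

≡⇒∈⁅⁆ : ∀ {x y : Fin n} → x ≡ y → x ∈ ⁅ y ⁆
≡⇒∈⁅⁆ refl = x∈⁅x⁆ _

≢⇒∉⁅⁆ : ∀ {x y : Fin n} → x ≢ y → x ∉ ⁅ y ⁆
≢⇒∉⁅⁆ x≢y = x≢y ∘ ∈⁅⁆⁻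

∈∧∉⇒≢ : ∀ {x y : Fin n} → x ∈ P → y ∉ P → x ≢ y
∈∧∉⇒≢ x∈ y∉ refl = y∉ x∈

⁅⁆⊆ : ∀ {x : Fin n} → x ∈ P → ⁅ x ⁆ ⊆ P
⁅⁆⊆ {P = P} x∈ y∈ = subst (_∈ P) (sym (∈⁅⁆⁻ y∈)) x∈

∪-least : {P Q R : Subset n} → P ⊆ R → Q ⊆ R → P ∪ Q ⊆ R
∪-least P⊆ Q⊆ x∈ = [ P⊆ , Q⊆ ]′ (∪⁻ x∈)

module _ {P A A′ B B′ : Subset n} (A⊆P : A ⊆ P) (A′⊆P : A′ ⊆ P)
  (B∩P : ∀ {x} → x ∈ B → x ∉ P) (B′∩P : ∀ {x} → x ∈ B′ → x ∉ P) (eq : A ∪ B ≡ A′ ∪ B′) where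

  ∪-separateˡ : A ≡ A′
  ∪-separateˡ = ⊆-antisym
    (λ x∈ → [ id , (λ x∈B → ⊥-elim (B′∩P x∈B (A⊆P x∈))) ]′ (∪⁻ (subst (_ ∈_) eq (∪ˡ x∈))))
    (λ x∈ → [ id , (λ x∈B → ⊥-elim (B∩P x∈B (A′⊆P x∈))) ]′ (∪⁻ (subst (_ ∈_) (sym eq) (∪ˡ x∈))))

  ∪-separateʳ : B ≡ B′
  ∪-separateʳ = ⊆-antisym
    (λ x∈ → [ (λ x∈A → ⊥-elim (B∩P x∈ (A′⊆P x∈A))) , id ]′ (∪⁻ (subst (_ ∈_) eq (∪ʳ x∈))))
    (λ x∈ → [ (λ x∈A → ⊥-elim (B′∩P x∈ (A⊆P x∈A))) , id ]′ (∪⁻ (subst (_ ∈_) (sym eq) (∪ʳ x∈))))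

∣p∪q∣≤∣p∣+∣q∣ : (p q : Subset n) → ∣ p ∪ q ∣ ≤ ∣ p ∣ + ∣ q ∣
∣p∪q∣≤∣p∣+∣q∣ []            []            = z≤n
∣p∪q∣≤∣p∣+∣q∣ (outside ∷ p) (outside ∷ q) = ∣p∪q∣≤∣p∣+∣q∣ p q
∣p∪q∣≤∣p∣+∣q∣ (outside ∷ p) (inside  ∷ q)
  rewrite +-suc ∣ p ∣ ∣ q ∣ = s≤s (∣p∪q∣≤∣p∣+∣q∣ p q)
∣p∪q∣≤∣p∣+∣q∣ (inside  ∷ p) (outside ∷ q) = s≤s (∣p∪q∣≤∣p∣+∣q∣ p q)
∣p∪q∣≤∣p∣+∣q∣ (inside  ∷ p) (inside  ∷ q)
  rewrite +-suc ∣ p ∣ ∣ q ∣ = s≤s (m≤n⇒m≤1+n (∣p∪q∣≤∣p∣+∣q∣ p q))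

∣p∣+∣q∣≤∣r∣ : (p q r : Subset n) → p ⊆ r → q ⊆ r → (∀ {x} → x ∈ p → x ∉ q) → ∣ p ∣ + ∣ q ∣ ≤ ∣ r ∣
∣p∣+∣q∣≤∣r∣ []            []            []      _   _   _   = z≤n
∣p∣+∣q∣≤∣r∣ (inside  ∷ p) (inside  ∷ q) _       _   _   p∌q = ⊥-elim (p∌q here here)
∣p∣+∣q∣≤∣r∣ (inside  ∷ p) (outside ∷ q) (s ∷ r) p⊆r q⊆r p∌q with here ← p⊆r here =
  s≤s (∣p∣+∣q∣≤∣r∣ p q r (drop-∷-⊆ p⊆r) (drop-∷-⊆ q⊆r) λ x∈ → p∌q (there x∈) ∘ there)
∣p∣+∣q∣≤∣r∣ (outside ∷ p) (inside  ∷ q) (s ∷ r) p⊆r q⊆r p∌q with here ← q⊆r here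
  rewrite +-suc ∣ p ∣ ∣ q ∣ =
  s≤s (∣p∣+∣q∣≤∣r∣ p q r (drop-∷-⊆ p⊆r) (drop-∷-⊆ q⊆r) λ x∈ → p∌q (there x∈) ∘ there)
∣p∣+∣q∣≤∣r∣ (outside ∷ p) (outside ∷ q) (s ∷ r) p⊆r q⊆r p∌q =
  ≤-trans (∣p∣+∣q∣≤∣r∣ p q r (drop-∷-⊆ p⊆r) (drop-∷-⊆ q⊆r) λ x∈ → p∌q (there x∈) ∘ there)
    (∣p∣≤∣x∷p∣ s r)

∣p─q∣+∣q∣≤∣p∣ : (p q : Subset n) → q ⊆ p → ∣ p ─ q ∣ + ∣ q ∣ ≤ ∣ p ∣
∣p─q∣+∣q∣≤∣p∣ p q q⊆p = ∣p∣+∣q∣≤∣r∣ (p ─ q) q p ─⁻ˡ q⊆p ─⁻ʳ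

∣∣-mono-< : ∀ {x : Fin n} (P Q : Subset n) → P ⊆ Q → x ∈ Q → x ∉ P → ∣ P ∣ < ∣ Q ∣
∣∣-mono-< P Q P⊆Q x∈Q x∉P = p⊂q⇒∣p∣<∣q∣ {p = P} {q = Q} (P⊆Q , _ , x∈Q , x∉P)

∣─∣-< : ∀ {x : Fin n} (P Q : Subset n) → Q ⊆ P → x ∈ Q → ∣ P ─ Q ∣ < ∣ P ∣
∣─∣-< P Q Q⊆P x∈ = p∩q≢∅⇒∣p─q∣<∣p∣ P Q (_ , x∈p∩q⁺ (Q⊆P x∈ , x∈))

comprehension : {S : Pred (Fin n) 0ℓ} → Decidable S → Subset n
comprehension S? = tabulate (does ∘ S?)

module _ {S : Pred (Fin n) 0ℓ} (S? : Decidable S) where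

  ∈-comprehension⁺ : ∀ {x} → S x → x ∈ comprehension S?
  ∈-comprehension⁺ {x} Sx =
    lookup⇒[]= x _ (trans (lookup∘tabulate (does ∘ S?) x) (dec-true (S? x) Sx))

  ∈-comprehension⁻ : ∀ {x} → x ∈ comprehension S? → S x
  ∈-comprehension⁻ {x} x∈ with S? x | trans (sym (lookup∘tabulate (does ∘ S?) x)) ([]=⇒lookup x∈)
  ... | yes Sx | _ = Sx

-- Two deletions cannot hit all of three candidates. The survivor is the witness outside X that
-- `three-connected` asks for.
one-avoiding-two : (a b : Fin n) {x y z : Fin n} → x ≢ y → x ≢ z → y ≢ z →
  ∃[ w ] (w ≡ x ⊎ w ≡ y ⊎ w ≡ z) × w ≢ a × w ≢ b
one-avoiding-two a b {x} {y} {z} x≢y x≢z y≢z with x ≟ a | x ≟ b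
... | no x≢a | no x≢b = x , inj₁ refl , x≢a , x≢b
... | yes refl | _ with y ≟ b
...   | no y≢b   = y , inj₂ (inj₁ refl) , ≢-sym x≢y , y≢b
...   | yes refl = z , inj₂ (inj₂ refl) , ≢-sym x≢z , ≢-sym y≢z
one-avoiding-two a b {x} {y} {z} x≢y x≢z y≢z | no _ | yes refl with y ≟ a
...   | no y≢a   = y , inj₂ (inj₁ refl) , y≢a , ≢-sym x≢y
...   | yes refl = z , inj₂ (inj₂ refl) , ≢-sym y≢z , ≢-sym x≢z

-- Reachability and paths

module Connectivity {n : ℕ} (Adj : Fin n → Fin n → Set)
  (adj? : ∀ u v → Dec (Adj u v)) (adj-sym : ∀ {u v} → Adj u v → Adj v u) where

  private variable
    W X A S : Subset n
    a b d u v x y z : Fin n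

  data Reach (W : Subset n) : Fin n → Fin n → Set where
    here : u ∈ W → Reach W u u
    step : u ∈ W → Adj u v → Reach W v z → Reach W u z

  Conn : Subset n → Set
  Conn W = ∀ {u v} → u ∈ W → v ∈ W → Reach W u v

  reach-source : Reach W u v → u ∈ W
  reach-source (here u∈)     = u∈
  reach-source (step u∈ _ _) = u∈

  reach-mono : W ⊆ X → Reach W u v → Reach X u v
  reach-mono W⊆X (here u∈)      = here (W⊆X u∈)
  reach-mono W⊆X (step u∈ uv r) = step (W⊆X u∈) uv (reach-mono W⊆X r)

  reach-trans : Reach W u v → Reach W v z → Reach W u z
  reach-trans (here _)       s = s
  reach-trans (step u∈ uv r) s = step u∈ uv (reach-trans r s)

  reach-snoc : Reach W u v → Adj v z → z ∈ W → Reach W u z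
  reach-snoc (here u∈)      vz z∈ = step u∈ vz (here z∈)
  reach-snoc (step u∈ uv r) vz z∈ = step u∈ uv (reach-snoc r vz z∈)

  reach-sym : Reach W u v → Reach W v u
  reach-sym (here u∈)      = here u∈
  reach-sym (step u∈ uv r) = reach-snoc (reach-sym r) (adj-sym uv) u∈

  reach-target : Reach W u v → v ∈ W
  reach-target = reach-source ∘ reach-sym

  exit : Reach W u v → u ∈ X → v ∉ X → ∃[ a ] ∃[ b ] a ∈ X × b ∉ X × Adj a b × b ∈ W
  exit (here _) u∈ v∉ = ⊥-elim (v∉ u∈)
  exit {X = X} (step {v = v} _ uv r) u∈ z∉ with v ∈? X
  ... | yes v∈ = exit r v∈ z∉
  ... | no v∉  = _ , v , u∈ , v∉ , uv , reach-source r

  last-before : Reach W u v → u ∉ X → v ∈ X →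
    ∃[ a ] ∃[ b ] Reach (W ─ X) u a × Adj a b × b ∈ X
  last-before (here _) u∉ v∈ = ⊥-elim (u∉ v∈)
  last-before {X = X} (step {v = v} u∈ uv r) u∉ z∈ with v ∈? X
  ... | yes v∈ = _ , v , here (─⁺ u∈ u∉) , uv , v∈
  ... | no v∉ with a , b , r′ , ab , b∈ ← last-before r v∉ z∈ =
    a , b , step (─⁺ u∈ u∉) uv r′ , ab , b∈

  conn-from : (∀ {u} → u ∈ W → Reach W d u) → Conn W
  conn-from r u∈ v∈ = reach-trans (reach-sym (r u∈)) (r v∈)

  conn-resp : W ⊆ X → X ⊆ W → Conn W → Conn X
  conn-resp W⊆X X⊆W conn u∈ v∈ = reach-mono W⊆X (conn (X⊆W u∈) (X⊆W v∈))

  conn-⁅⁆ : ∀ u → Conn ⁅ u ⁆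
  conn-⁅⁆ u = conn-from λ v∈ → subst (Reach _ u) (sym (∈⁅⁆⁻ v∈)) (here (x∈⁅x⁆ u))

  conn-∪ : Conn W → Conn X → u ∈ W → v ∈ X → Adj u v → Conn (W ∪ X)
  conn-∪ {W = W} {X = X} {u = u} {v = v} connW connX u∈ v∈ uv = conn-from from
    where
    from : ∀ {z} → z ∈ W ∪ X → Reach (W ∪ X) u z
    from z∈ with ∪⁻ z∈
    ... | inj₁ z∈W = reach-mono ∪ˡ (connW u∈ z∈W)
    ... | inj₂ z∈X = step (∪ˡ u∈) uv (reach-mono ∪ʳ (connX v∈ z∈X))

  record IsComponent (W X : Subset n) (d : Fin n) : Set where
    field
      centre  : d ∈ X
      inside⊆ : X ⊆ W
      conn    : Conn X
      closed  : ∀ {u v} → u ∈ X → v ∈ W → Adj u v → v ∈ X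

  component : d ∈ W → ∃[ X ] IsComponent W X d
  component {d} {W} d∈W =
    -- Fuel: n bounds the vertices of W not yet in X, and every round adds one of them.
    go n ⁅ d ⁆ (∣p∣≤n (W ─ ⁅ d ⁆)) (x∈⁅x⁆ d) (⁅⁆⊆ d∈W) (conn-⁅⁆ d)
    where
    go : ∀ k X → ∣ W ─ X ∣ ≤ k → d ∈ X → X ⊆ W → Conn X → ∃[ X ] IsComponent W X d
    go k X ≤k d∈ X⊆ conn
      with any? (λ u → any? (λ v → u ∈? X ×-dec v ∈? (W ─ X) ×-dec adj? u v))
    ... | no ¬grow = X , record
      { centre = d∈ ; inside⊆ = X⊆ ; conn = conn
      ; closed = λ {u} {v} u∈ v∈ uv → closed u∈ v∈ uv (v ∈? X) }
      where
      closed : u ∈ X → v ∈ W → Adj u v → Dec (v ∈ X) → v ∈ X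
      closed u∈ v∈ uv (yes v∈X) = v∈X
      closed u∈ v∈ uv (no v∉X)  = ⊥-elim (¬grow (_ , _ , u∈ , ─⁺ v∈ v∉X , uv))
    go zero    X ≤k d∈ X⊆ conn | yes (_ , v , _ , v∈ , _) =
      ⊥-elim (n≮0 (<-≤-trans (x∈p⇒∣p-x∣<∣p∣ {p = W ─ X} v∈) ≤k))
    go (suc k) X ≤k d∈ X⊆ conn | yes (u , v , u∈ , v∈ , uv) =
      go k (X ∪ ⁅ v ⁆) (s≤s⁻¹ (<-≤-trans smaller ≤k)) (∪ˡ d∈)
        (∪-least X⊆ (⁅⁆⊆ (─⁻ˡ v∈))) (conn-∪ conn (conn-⁅⁆ v) u∈ (x∈⁅x⁆ v) uv)
      where
      smaller : ∣ W ─ (X ∪ ⁅ v ⁆) ∣ < ∣ W ─ X ∣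
      smaller = ∣∣-mono-< (W ─ (X ∪ ⁅ v ⁆)) (W ─ X) (λ z∈ → ─⁺ (─⁻ˡ z∈) (─⁻ʳ z∈ ∘ ∪ˡ))
        v∈ (λ v∈′ → ─⁻ʳ v∈′ (∪ʳ (x∈⁅x⁆ v)))

  component-reach : IsComponent W X d → Reach W d v → v ∈ X
  component-reach {X = X} {v = v} C r with v ∈? X
  ... | yes v∈ = v∈
  ... | no v∉ with _ , _ , a∈ , b∉ , ab , b∈W ← exit r (IsComponent.centre C) v∉ =
    ⊥-elim (b∉ (IsComponent.closed C a∈ b∈W ab))

  reach? : ∀ W u v → Dec (Reach W u v)
  reach? W u v with u ∈? W
  ... | no u∉ = no (u∉ ∘ reach-source)
  ... | yes u∈ with X , C ← component u∈ =
    Dec.map′ (λ v∈ → reach-mono (IsComponent.inside⊆ C) (IsComponent.conn C (IsComponent.centre C) v∈))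
      (component-reach C) (v ∈? X)

  -- Cut the walk at its first vertex in S; the initial part misses all others. It is stated for one
  -- deleted `w` at a time because `Critical` speaks of single deletions.
  first-hit : ∀ S → Reach A a b →
    Reach (A ─ S) a b ⊎ ∃[ f ] f ∈ S × (∀ {w} → w ∈ S → w ≢ f → Reach (A ─ ⁅ w ⁆) a f)
  first-hit {a = a} S r with a ∈? S
  ... | yes a∈ = inj₂ (a , a∈ , λ _ w≢a → here (─⁺ (reach-source r) (≢⇒∉⁅⁆ (≢-sym w≢a))))
  first-hit S (here a∈) | no a∉ = inj₁ (here (─⁺ a∈ a∉))
  first-hit S (step a∈ ab r) | no a∉ with first-hit S r
  ... | inj₁ r′            = inj₁ (step (─⁺ a∈ a∉) ab r′)
  ... | inj₂ (f , f∈ , r′) =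
    inj₂ (f , f∈ , λ w∈ w≢f → step (─⁺ a∈ (≢⇒∉⁅⁆ (≢-sym (∈∧∉⇒≢ w∈ a∉)))) ab (r′ w∈ w≢f))

  -- Simple paths, indexed by their vertex set.
  data Path : Subset n → Fin n → Fin n → Set where
    [_]  : ∀ u → Path ⁅ u ⁆ u u
    cons : u ∉ S → Adj u v → Path S v z → Path (⁅ u ⁆ ∪ S) u z

  path-source : Path S u z → u ∈ S
  path-source [ u ]        = x∈⁅x⁆ u
  path-source (cons _ _ _) = ∪ˡ (x∈⁅x⁆ _)

  path-conn : Path S u z → Conn S
  path-conn [ u ]            = conn-⁅⁆ u
  path-conn (cons u∉ uv π) = conn-∪ (conn-⁅⁆ _) (path-conn π) (x∈⁅x⁆ _) (path-source π) uv

  path-target : Path S u z → z ∈ S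
  path-target [ u ]        = x∈⁅x⁆ u
  path-target (cons _ _ π) = ∪ʳ (path-target π)

  path-suffix : a ∈ S → Path S u z → ∃[ S′ ] S′ ⊆ S × Path S′ a z
  path-suffix a∈ [ u ] with refl ← ∈⁅⁆⁻ a∈ = _ , id , [ u ]
  path-suffix a∈ (cons u∉ uv π) with ∪⁻ a∈
  ... | inj₁ a∈u with refl ← ∈⁅⁆⁻ a∈u = _ , id , cons u∉ uv π
  ... | inj₂ a∈S with S′ , S′⊆ , π′ ← path-suffix a∈S π = S′ , ∪ʳ ∘ S′⊆ , π′

  reach⇒path : Reach W u v → ∃[ S ] S ⊆ W × Path S u v
  reach⇒path (here u∈) = _ , ⁅⁆⊆ u∈ , [ _ ]
  reach⇒path {u = u} (step u∈ uv r) with S , S⊆ , π ← reach⇒path r with u ∈? S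
  ... | no u∉   = _ , ∪-least (⁅⁆⊆ u∈) S⊆ , cons u∉ uv π
  ... | yes u∈S with S′ , S′⊆ , π′ ← path-suffix u∈S π = S′ , S⊆ ∘ S′⊆ , π′

  -- Extended by x and y at its ends, the path gives each of its vertices two distinct neighbours; a
  -- one-vertex path needs `x ≢ y` for this. In a cubic graph only one neighbour off the extended
  -- path is then left.
  path-neighbours : Path S u z → x ∉ S → y ∉ S → Adj u x → Adj z y → (u ≡ z → x ≢ y) → a ∈ S →
    let OnPath = λ t → t ∈ S ⊎ (a ≡ u × t ≡ x) ⊎ (a ≡ z × t ≡ y) in
    ∃[ s ] ∃[ t ] s ≢ t × Adj a s × Adj a t × OnPath s × OnPath t
  path-neighbours [ u ] x∉ y∉ ux zy x≢y a∈ with refl ← ∈⁅⁆⁻ a∈ =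
    _ , _ , x≢y refl , ux , zy , inj₂ (inj₁ (refl , refl)) , inj₂ (inj₂ (refl , refl))
  path-neighbours (cons u∉ uv π) x∉ y∉ ux zy x≢y a∈ with ∪⁻ a∈
  ... | inj₁ a∈u with refl ← ∈⁅⁆⁻ a∈u =
    _ , _ , (λ { refl → x∉ (∪ʳ (path-source π)) }) , ux , uv
    , inj₂ (inj₁ (refl , refl)) , inj₁ (∪ʳ (path-source π))
  ... | inj₂ a∈S with s , t , s≢t , as , at , s∈ , t∈ ←
    path-neighbours π u∉ (y∉ ∘ ∪ʳ) (adj-sym uv) zy (λ _ → λ { refl → y∉ (∪ˡ (x∈⁅x⁆ _)) }) a∈S =
    s , t , s≢t , as , at , widen s∈ , widen t∈
    where
    widen : ∀ {S u v a x y z t} → t ∈ S ⊎ (a ≡ v × t ≡ u) ⊎ (a ≡ z × t ≡ y) →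
      t ∈ ⁅ u ⁆ ∪ S ⊎ (a ≡ u × t ≡ x) ⊎ (a ≡ z × t ≡ y)
    widen (inj₁ t∈)                = inj₁ (∪ʳ t∈)
    widen (inj₂ (inj₁ (_ , refl))) = inj₁ (∪ˡ (x∈⁅x⁆ _))
    widen (inj₂ (inj₂ end))        = inj₂ (inj₂ end)

  path-around : Path S u z → a ∈ S → x ≢ a → Reach (S ─ ⁅ x ⁆) u a ⊎ Reach (S ─ ⁅ x ⁆) z a
  path-around [ u ] a∈ x≢a with refl ← ∈⁅⁆⁻ a∈ = inj₁ (here (─⁺ a∈ (≢⇒∉⁅⁆ (≢-sym x≢a))))
  path-around {u = u} {x = x} (cons u∉ uv π) a∈ x≢a with ∪⁻ a∈
  ... | inj₁ a∈u with refl ← ∈⁅⁆⁻ a∈u = inj₁ (here (─⁺ a∈ (≢⇒∉⁅⁆ (≢-sym x≢a))))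
  ... | inj₂ a∈S with x ≟ u
  ...   | yes refl = inj₂ (reach-mono (λ z∈ → ─⁺ (∪ʳ z∈) (≢⇒∉⁅⁆ (∈∧∉⇒≢ z∈ u∉)))
                       (path-conn π (path-target π) a∈S))
  ...   | no x≢u with path-around π a∈S x≢a
  ...     | inj₁ r = inj₁ (step (─⁺ (∪ˡ (x∈⁅x⁆ _)) (≢⇒∉⁅⁆ (≢-sym x≢u))) uv
                       (reach-mono (λ z∈ → ─⁺ (∪ʳ (─⁻ˡ z∈)) (─⁻ʳ z∈)) r))
  ...     | inj₂ r = inj₂ (reach-mono (λ z∈ → ─⁺ (∪ʳ (─⁻ˡ z∈)) (─⁻ʳ z∈)) r)

-- Ears

module Ears {n : ℕ} (Adj : Fin n → Fin n → Set)
  (adj? : ∀ u v → Dec (Adj u v)) (adj-sym : ∀ {u v} → Adj u v → Adj v u) where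

  open Connectivity Adj adj? adj-sym

  private variable
    W X A D : Subset n
    p q : Fin n

  Critical : Subset n → Fin n → Subset n → Fin n → Set
  Critical A p D v = ∀ {q} → q ∈ D → ¬ Reach (A ─ ⁅ v ⁆) p q

  -- Maximal only against adding one neighbour outside F, which is what greedy growth yields. F is
  -- empty for ears; for a second ear it is the route of the first, which M must not enter.
  record Maximal (W M₀ F D : Subset n) (p : Fin n) (M : Subset n) : Set where
    field
      base⊆    : M₀ ⊆ M
      within   : M ⊆ W
      conn     : Conn M
      avoids   : ∀ {v} → v ∈ M → v ∉ F
      target   : ∃[ q ] q ∈ D × Reach (W ─ M) p q
      critical : ∀ {v m} → v ∈ W ─ M → v ∉ F → m ∈ M → Adj v m → Critical (W ─ M) p D v

  maximal : ∀ {W M₀ F D p} → M₀ ⊆ W → Conn M₀ → (∀ {v} → v ∈ M₀ → v ∉ F) →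
    ∃[ q ] q ∈ D × Reach (W ─ M₀) p q → ∃[ M ] Maximal W M₀ F D p M
  maximal {W} {M₀} {F} {D} {p} M₀⊆ conn₀ avoids₀ target₀ =
    go n M₀ (∣p∣≤n (W ─ M₀)) id M₀⊆ conn₀ avoids₀ target₀
    where
    go : ∀ k M → ∣ W ─ M ∣ ≤ k → M₀ ⊆ M → M ⊆ W → Conn M → (∀ {v} → v ∈ M → v ∉ F) →
      ∃[ q ] q ∈ D × Reach (W ─ M) p q → ∃[ M ] Maximal W M₀ F D p M
    go k M ≤k base⊆ within conn avoids target
      with any? (λ v → any? (λ m → v ∈? (W ─ M) ×-dec ¬? (v ∈? F) ×-dec m ∈? M ×-dec adj? v m ×-dec
             any? (λ q → q ∈? D ×-dec reach? ((W ─ M) ─ ⁅ v ⁆) p q)))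
    ... | no ¬grow = M , record
      { base⊆ = base⊆ ; within = within ; conn = conn ; avoids = avoids ; target = target
      ; critical = λ v∈ v∉F m∈ vm q∈ r → ¬grow (_ , _ , v∈ , v∉F , m∈ , vm , _ , q∈ , r) }
    go zero M ≤k _ _ _ _ _ | yes (v , _ , v∈ , _) =
      ⊥-elim (n≮0 (<-≤-trans (x∈p⇒∣p-x∣<∣p∣ {p = W ─ M} v∈) ≤k))
    go (suc k) M ≤k base⊆ within conn avoids _ | yes (v , m , v∈ , v∉F , m∈ , vm , q , q∈ , r) =
      go k (M ∪ ⁅ v ⁆) (s≤s⁻¹ (<-≤-trans smaller ≤k)) (∪ˡ ∘ base⊆) (∪-least within (⁅⁆⊆ (─⁻ˡ v∈)))
        (conn-∪ conn (conn-⁅⁆ v) m∈ (x∈⁅x⁆ v) (adj-sym vm)) avoids′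
        (q , q∈ , reach-mono (λ z∈ → ─⁺ (─⁻ˡ (─⁻ˡ z∈)) ([ ─⁻ʳ (─⁻ˡ z∈) , ─⁻ʳ z∈ ]′ ∘ ∪⁻)) r)
      where
      smaller : ∣ W ─ (M ∪ ⁅ v ⁆) ∣ < ∣ W ─ M ∣
      smaller = ∣∣-mono-< (W ─ (M ∪ ⁅ v ⁆)) (W ─ M) (λ z∈ → ─⁺ (─⁻ˡ z∈) (─⁻ʳ z∈ ∘ ∪ˡ))
        v∈ (λ v∈′ → ─⁻ʳ v∈′ (∪ʳ (x∈⁅x⁆ v)))
      avoids′ : ∀ {u} → u ∈ M ∪ ⁅ v ⁆ → u ∉ F
      avoids′ u∈ with ∪⁻ u∈
      ... | inj₁ u∈M = avoids u∈M
      ... | inj₂ u∈v with refl ← ∈⁅⁆⁻ u∈v = v∉F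

  Meets : Subset n → Subset n → Set
  Meets X D = ∃[ q ] q ∈ X × q ∈ D

  meets? : ∀ X D → Dec (Meets X D)
  meets? X D = any? (λ q → q ∈? X ×-dec q ∈? D)

  Boundary : Subset n → Subset n → Fin n → Set
  Boundary W X w = w ∈ W × w ∉ X × ∃[ x ] x ∈ X × Adj x w

  boundary? : ∀ W X → Decidable (Boundary W X)
  boundary? W X w = w ∈? W ×-dec ¬? (w ∈? X) ×-dec any? (λ x → x ∈? X ×-dec adj? x w)

  -- Here a stands for the first boundary vertex of X on a walk from p and b for
  -- the last one before D; they do not matter if X contains p, resp. meets D.
  Escape : Subset n → Subset n → Fin n → Subset n → Fin n → Fin n → Set
  Escape W D p X a b = ∃[ w ] Boundary W X w × (p ∈ X ⊎ w ≢ a) × (Meets X D ⊎ w ≢ b)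

  -- A walk from p to D first meets the boundary of X in a and last leaves it
  -- in b; detouring through X between them bypasses any further boundary vertex.
  escape⇒¬critical : q ∈ D → Reach A p q → X ⊆ A → Conn X →
    (∀ {w} → Boundary W X w → w ∈ A × Critical A p D w) →
    ¬ (∀ a b → Escape W D p X a b)
  escape⇒¬critical {q = q} {D = D} {A = A} {p = p} {X = X} {W = W} q∈ r X⊆ connX critical escape =
    let a , enter = entry (p ∈? X)
        b , leave = departure (meets? X D)
        w , w∈∂ , w≢a , w≢b = escape a b
        x , x∈ , px = enter w∈∂ w≢a
        y , t , y∈ , t∈ , yt = leave w∈∂ w≢b
    in proj₂ (critical w∈∂) t∈
         (reach-trans px (reach-trans (reach-mono (inA w∈∂) (connX x∈ y∈)) yt))
    where
    ∂ : Subset n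
    ∂ = comprehension (boundary? W X)

    inA : ∀ {w} → Boundary W X w → X ⊆ A ─ ⁅ w ⁆
    inA (_ , w∉ , _) z∈ = ─⁺ (X⊆ z∈) (≢⇒∉⁅⁆ (∈∧∉⇒≢ z∈ w∉))

    missed : ∀ {w} → Boundary W X w → ¬ Reach (A ─ ∂) p q
    missed w∈∂ r = proj₂ (critical w∈∂) q∈
      (reach-mono (λ z∈ → ─⁺ (─⁻ˡ z∈)
        (≢⇒∉⁅⁆ (≢-sym (∈∧∉⇒≢ (∈-comprehension⁺ (boundary? W X) w∈∂) (─⁻ʳ z∈))))) r)

    entry : Dec (p ∈ X) → ∃[ a ] (∀ {w} → Boundary W X w → p ∈ X ⊎ w ≢ a →
      ∃[ x ] x ∈ X × Reach (A ─ ⁅ w ⁆) p x)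
    entry (yes p∈) = p , λ w∈∂ _ → p , p∈ , here (inA w∈∂ p∈)
    entry (no p∉) with first-hit ∂ r
    ... | inj₁ r′ = p , λ w∈∂ _ → ⊥-elim (missed w∈∂ r′)
    ... | inj₂ (f , f∈ , r′) = f , λ
      { w∈∂ (inj₁ p∈)  → ⊥-elim (p∉ p∈)
      ; w∈∂ (inj₂ w≢f) → let _ , _ , x , x∈ , xf = ∈-comprehension⁻ (boundary? W X) f∈ in
          x , x∈ , reach-snoc (r′ (∈-comprehension⁺ (boundary? W X) w∈∂) w≢f) (adj-sym xf) (inA w∈∂ x∈) }

    departure : Dec (Meets X D) → ∃[ b ] (∀ {w} → Boundary W X w → Meets X D ⊎ w ≢ b →
      ∃[ y ] ∃[ t ] y ∈ X × t ∈ D × Reach (A ─ ⁅ w ⁆) y t)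
    departure (yes (t , t∈X , t∈D)) = q , λ w∈∂ _ → t , t , t∈X , t∈D , here (inA w∈∂ t∈X)
    departure (no ¬meets) with first-hit ∂ (reach-sym r)
    ... | inj₁ r′ = q , λ w∈∂ _ → ⊥-elim (missed w∈∂ (reach-sym r′))
    ... | inj₂ (g , g∈ , r′) = g , λ
      { w∈∂ (inj₁ meets) → ⊥-elim (¬meets meets)
      ; w∈∂ (inj₂ w≢g) → let _ , _ , y , y∈ , yg = ∈-comprehension⁻ (boundary? W X) g∈ in
          y , q , y∈ , q∈ , step (inA w∈∂ y∈) yg (reach-sym (r′ (∈-comprehension⁺ (boundary? W X) w∈∂) w≢g)) }

  record Ear (W M₀ D : Subset n) (p : Fin n) : Set where
    field
      {route}  : Subset n
      {end}    : Fin n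
      path     : Path route p end
      route⊆   : route ⊆ W
      base⊆    : M₀ ⊆ W ─ route
      rest     : Conn (W ─ route)
      end∈     : end ∈ D
      only-end : ∀ {u} → u ∈ route → u ∈ D → u ≡ end
      attached : ∀ {u} → u ∈ route → ∃[ m ] m ∈ W ─ route × Adj u m

  abstract
    -- Among the connected M ⊇ M₀ leaving p joined to D, a maximal one has a path
    -- as its complement.
    ear : ∀ {W M₀ D p c} → c ∈ M₀ → M₀ ⊆ W → Conn M₀ → ∃[ q ] q ∈ D × Reach (W ─ M₀) p q →
      (∀ X {x} → x ∈ X → X ⊆ W → (∀ {u} → u ∈ X → u ∉ M₀) → ∀ a b → Escape W D p X a b) →
      Ear W M₀ D p
    ear {W} {M₀} {D} {p} {c} c∈ M₀⊆ conn₀ target₀ escape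
      with M , max ← maximal {W} {M₀} {⊥} {D} {p} M₀⊆ conn₀ (λ _ → ∉⊥) target₀
      with q , q∈ , r ← Maximal.target max
      with S , S⊆ , π ← reach⇒path r = record
        { path = π
        ; route⊆ = ─⁻ˡ ∘ S⊆
        ; base⊆ = M⊆rest ∘ base⊆
        ; rest = λ u∈ v∈ → reach-mono M⊆rest (conn (rest⊆M u∈) (rest⊆M v∈))
        ; end∈ = q∈
        ; only-end = only-end
        ; attached = λ u∈ → let m , m∈ , um = attached (S⊆ u∈) in m , M⊆rest m∈ , um
        }
      where
      open Maximal max

      Rest : Subset n
      Rest = W ─ M

      M-adjacent? : Decidable (λ v → ∃[ m ] m ∈ M × Adj v m)
      M-adjacent? v = any? (λ m → m ∈? M ×-dec adj? v m)

      F : Subset n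
      F = comprehension M-adjacent?

      attached : ∀ {v} → v ∈ Rest → ∃[ m ] m ∈ M × Adj v m
      attached {v} v∈ with M-adjacent? v
      ... | yes h = h
      -- A component of the vertices of `Rest` without neighbour in M. Its boundary vertices do have
      -- one, so by maximality all are critical, against `escape`.
      ... | no ¬h with X , C ← component (─⁺ v∈ (¬h ∘ ∈-comprehension⁻ M-adjacent?)) =
        ⊥-elim (escape⇒¬critical q∈ r (─⁻ˡ ∘ C.inside⊆) C.conn crit
          (escape X C.centre (─⁻ˡ ∘ ─⁻ˡ ∘ C.inside⊆) λ u∈ u∈M₀ → ─⁻ʳ (─⁻ˡ (C.inside⊆ u∈)) (base⊆ u∈M₀)))
        where
        module C = IsComponent C
        crit : ∀ {w} → Boundary W X w → w ∈ Rest × Critical Rest p D w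
        crit {w} (w∈ , w∉ , x , x∈ , xw) with w ∈? M
        ... | yes w∈M =
          ⊥-elim (─⁻ʳ (C.inside⊆ x∈) (∈-comprehension⁺ M-adjacent? (w , w∈M , xw)))
        ... | no w∉M with M-adjacent? w
        ...   | yes (m , m∈ , wm) = ─⁺ w∈ w∉M , critical (─⁺ w∈ w∉M) ∉⊥ m∈ wm
        ...   | no ¬w =
          ⊥-elim (w∉ (C.closed x∈ (─⁺ (─⁺ w∈ w∉M) (¬w ∘ ∈-comprehension⁻ M-adjacent?)) xw))

      crit : ∀ {v} → v ∈ Rest → Critical Rest p D v
      crit v∈ = let m , m∈ , vm = attached v∈ in critical v∈ ∉⊥ m∈ vm

      Rest⊆S : Rest ⊆ S
      Rest⊆S {v} v∈ with v ∈? S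
      ... | yes v∈S = v∈S
      ... | no v∉S = ⊥-elim (crit v∈ q∈ (reach-mono (λ z∈ → ─⁺ (S⊆ z∈) (≢⇒∉⁅⁆ (∈∧∉⇒≢ z∈ v∉S)))
        (path-conn π (path-source π) (path-target π))))

      M⊆rest : M ⊆ W ─ S
      M⊆rest m∈ = ─⁺ (within m∈) (λ m∈S → ─⁻ʳ (S⊆ m∈S) m∈)

      rest⊆M : W ─ S ⊆ M
      rest⊆M {v} v∈ with v ∈? M
      ... | yes v∈M = v∈M
      ... | no v∉M = ⊥-elim (─⁻ʳ v∈ (Rest⊆S (─⁺ (─⁻ˡ v∈) v∉M)))

      only-end : ∀ {u} → u ∈ S → u ∈ D → u ≡ q
      only-end {u} u∈ u∈D with u ≟ q
      ... | yes u≡q = u≡q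
      ... | no u≢q with first-hit (⁅ u ⁆ ∪ ⁅ q ⁆) r
      ...   | inj₁ r′ = ⊥-elim (─⁻ʳ (reach-target r′) (∪ʳ (x∈⁅x⁆ q)))
      ...   | inj₂ (f , f∈ , r′) with ∪⁻ f∈
      ...     | inj₁ f∈u with refl ← ∈⁅⁆⁻ f∈u =
        ⊥-elim (crit (reach-target r) u∈D (r′ (∪ʳ (x∈⁅x⁆ q)) (≢-sym u≢q)))
      ...     | inj₂ f∈q with refl ← ∈⁅⁆⁻ f∈q =
        ⊥-elim (crit (S⊆ u∈) q∈ (r′ (∪ˡ (x∈⁅x⁆ u)) u≢q))

-- Handles and three-edge cuts

module Pieces {n : ℕ} (Adj : Fin n → Fin n → Set)
  (adj? : ∀ u v → Dec (Adj u v)) (adj-sym : ∀ {u v} → Adj u v → Adj v u)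
  (irreflexive : ∀ {v} → ¬ Adj v v)
  (cubic : ∀ {v a b c u} → a ≢ b → a ≢ c → b ≢ c → Adj v a → Adj v b → Adj v c → Adj v u →
    u ≡ a ⊎ u ≡ b ⊎ u ≡ c)
  (third-neighbour : ∀ v a b → ∃[ s ] Adj v s × s ≢ a × s ≢ b)
  (three-connected : ∀ X {x y} a b → x ∈ X → y ∉ X → y ≢ a → y ≢ b →
    ∃[ u ] ∃[ v ] u ∈ X × v ∉ X × Adj u v × v ≢ a × v ≢ b) where

  open Connectivity Adj adj? adj-sym public
  open Ears Adj adj? adj-sym public

  -- The outer neighbours x and y may coincide: in a stage they lie in F, in a cut they are the far
  -- ends of two leaving edges.
  record Handle (U : Subset n) : Set where
    field
      {route}    : Subset n
      {p q x y}  : Fin n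
      path       : Path route p q
      route⊆     : route ⊆ U
      p≢q        : p ≢ q
      x∉         : x ∉ U
      y∉         : y ∉ U
      px         : Adj p x
      qy         : Adj q y
      rest       : Conn (U ─ route)
      attached   : ∀ {u} → u ∈ route → ∃[ m ] m ∈ U ─ route × Adj u m

    OnPath : Fin n → Fin n → Set
    OnPath u v = v ∈ route ⊎ (u ≡ p × v ≡ x) ⊎ (u ≡ q × v ≡ y)

    neighbours : ∀ {u v m} → u ∈ route → m ∈ U ─ route → Adj u m → Adj u v → OnPath u v ⊎ v ≡ m
    neighbours {u} {v} {m} u∈ m∈ um uv =
      let s , t , s≢t , us , ut , s∈ , t∈ =
            path-neighbours path (x∉ ∘ route⊆) (y∉ ∘ route⊆) px qy (⊥-elim ∘ p≢q) u∈
      in [ (λ { refl → inj₁ s∈ }) , Sum.map₁ (λ { refl → t∈ }) ]′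
           (cubic s≢t (apart s∈) (apart t∈) us ut um uv)
      where
      apart : ∀ {s} → OnPath u s → s ≢ m
      apart (inj₁ s∈)                s≡m  = ─⁻ʳ m∈ (subst (_∈ route) s≡m s∈)
      apart (inj₂ (inj₁ (_ , refl))) refl = x∉ (─⁻ˡ m∈)
      apart (inj₂ (inj₂ (_ , refl))) refl = y∉ (─⁻ˡ m∈)

    outward : ∀ {u v} → u ∈ route → v ∉ U → Adj u v → (u ≡ p × v ≡ x) ⊎ (u ≡ q × v ≡ y)
    outward u∈ v∉ uv with m , m∈ , um ← attached u∈ with neighbours u∈ m∈ um uv
    ... | inj₁ (inj₁ v∈)  = ⊥-elim (v∉ (route⊆ v∈))
    ... | inj₁ (inj₂ h)   = h
    ... | inj₂ refl       = ⊥-elim (v∉ (─⁻ˡ m∈))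

    attached-unique : ∀ {u m v} → u ∈ route → m ∈ U ─ route → v ∈ U ─ route →
      Adj u m → Adj u v → v ≡ m
    attached-unique u∈ m∈ v∈ um uv with neighbours u∈ m∈ um uv
    ... | inj₁ (inj₁ v∈r)               = ⊥-elim (─⁻ʳ v∈ v∈r)
    ... | inj₁ (inj₂ (inj₁ (_ , refl))) = ⊥-elim (x∉ (─⁻ˡ v∈))
    ... | inj₁ (inj₂ (inj₂ (_ , refl))) = ⊥-elim (y∉ (─⁻ˡ v∈))
    ... | inj₂ v≡m                      = v≡m

    route-conn : Conn route
    route-conn = path-conn path

    p∈ : p ∈ route
    p∈ = path-source path

    q∈ : q ∈ route
    q∈ = path-target path

  module _ {U : Subset n} (h : Handle U) where
    open Handle h

    -- The way back from x to y. Here U - route grows to a connected set whose complement in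
    -- `∁ route` is a path attached to it everywhere, so that deleting the edges of the closed-up
    -- cycle will not disconnect the graph.
    peripheral-return : Reach (∁ U) x y → Ear (∁ route) (U ─ route) ⁅ y ⁆ x
    peripheral-return xy =
      let m , m∈ , _ = attached p∈ in
      ear m∈ (λ z∈ → x∉p⇒x∈∁p (─⁻ʳ z∈)) rest
        (y , x∈⁅x⁆ y , reach-mono ∁U⊆ xy) escape
      where
      ∁U⊆ : ∁ U ⊆ ∁ route ─ (U ─ route)
      ∁U⊆ z∈ = let z∉ = x∈∁p⇒x∉p z∈ in ─⁺ (x∉p⇒x∈∁p (z∉ ∘ route⊆)) (z∉ ∘ ─⁻ˡ)

      escape : ∀ X {x₀} → x₀ ∈ X → X ⊆ ∁ route → (∀ {u} → u ∈ X → u ∉ U ─ route) →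
        ∀ a b → Escape (∁ route) ⁅ y ⁆ x X a b
      escape X x₀∈ X⊆ X∩ a b = go (x ∈? X) (y ∈? X)
        where
        outside-U : ∀ {u} → u ∈ X → u ∉ U
        outside-U u∈ u∈U = X∩ u∈ (─⁺ u∈U (x∈∁p⇒x∉p (X⊆ u∈)))

        missed : ∀ {m w} → m ∈ U ─ route → w ≡ p ⊎ w ≡ q ⊎ w ≡ m → w ∉ X
        missed m∈ (inj₁ refl)        w∈ = outside-U w∈ (route⊆ p∈)
        missed m∈ (inj₂ (inj₁ refl)) w∈ = outside-U w∈ (route⊆ q∈)
        missed m∈ (inj₂ (inj₂ refl)) w∈ = outside-U w∈ (─⁻ˡ m∈)

        off-route : ∀ {a′ b′ u v} → (x ∈ X → a′ ≡ p) → (y ∈ X → b′ ≡ q) →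
          u ∈ X → Adj u v → v ≢ a′ → v ≢ b′ → v ∉ route
        off-route a′≡ b′≡ u∈ uv v≢a v≢b v∈ with outward v∈ (outside-U u∈) (adj-sym uv)
        ... | inj₁ (refl , refl) = v≢a (sym (a′≡ u∈))
        ... | inj₂ (refl , refl) = v≢b (sym (b′≡ u∈))

        -- If `x ∈ X`, the walk starts in X, and the deletion saved thereby is spent on p; likewise
        -- on q if `y ∈ X`. Only x p and y q lead from X into the route, so the vertex found is in
        -- `∁ route`.
        find : ∀ a′ b′ → (x ∈ X → a′ ≡ p) → (y ∈ X → b′ ≡ q) →
          ∃[ w ] Boundary (∁ route) X w × w ≢ a′ × w ≢ b′
        find a′ b′ a′≡ b′≡ =
          let m , m∈ , _ = attached p∈
              y₀ , which , y₀≢a , y₀≢b = one-avoiding-two a′ b′ p≢q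
                (∈∧∉⇒≢ p∈ (─⁻ʳ m∈)) (∈∧∉⇒≢ q∈ (─⁻ʳ m∈))
              u , v , u∈ , v∉ , uv , v≢a , v≢b =
                three-connected X a′ b′ x₀∈ (missed m∈ which) y₀≢a y₀≢b
          in v , (x∉p⇒x∈∁p (off-route a′≡ b′≡ u∈ uv v≢a v≢b) , v∉ , u , u∈ , uv) , v≢a , v≢b

        go : Dec (x ∈ X) → Dec (y ∈ X) → Escape (∁ route) ⁅ y ⁆ x X a b
        go (yes x∈) (yes y∈) = let w , w∈∂ , _ = find p q (λ _ → refl) (λ _ → refl) in
          w , w∈∂ , inj₁ x∈ , inj₁ (y , y∈ , x∈⁅x⁆ y)
        go (yes x∈) (no y∉)  = let w , w∈∂ , _ , w≢b = find p b (λ _ → refl) (⊥-elim ∘ y∉) in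
          w , w∈∂ , inj₁ x∈ , inj₂ w≢b
        go (no x∉) (yes y∈)  = let w , w∈∂ , w≢a , _ = find a q (⊥-elim ∘ x∉) (λ _ → refl) in
          w , w∈∂ , inj₂ w≢a , inj₁ (y , y∈ , x∈⁅x⁆ y)
        go (no x∉) (no y∉)   = let w , w∈∂ , w≢a , w≢b = find a b (⊥-elim ∘ x∉) (⊥-elim ∘ y∉) in
          w , w∈∂ , inj₂ w≢a , inj₂ w≢b

  Conflict : Subset n → Subset n → Set
  Conflict Q Q′ = Meets Q Q′ × ∃[ v ] v ∈ Q × v ∉ Q′

  -- The vertices p, q, l are distinct, but x, y, w need not be: for L = V - r all three are the
  -- root.
  record ThreeCut (L : Subset n) (p q l x y w : Fin n) : Set where
    field
      p∈    : p ∈ L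
      q∈    : q ∈ L
      l∈    : l ∈ L
      x∉    : x ∉ L
      y∉    : y ∉ L
      w∉    : w ∉ L
      p≢q   : p ≢ q
      p≢l   : p ≢ l
      q≢l   : q ≢ l
      px    : Adj p x
      qy    : Adj q y
      lw    : Adj l w
      exits : ∀ {u v} → u ∈ L → v ∉ L → Adj u v →
              (u ≡ p × v ≡ x) ⊎ (u ≡ q × v ≡ y) ⊎ (u ≡ l × v ≡ w)
      conn  : Conn L
      conn∁ : Conn (∁ L)

  swap-cut : ∀ {L p q l x y w} → ThreeCut L p q l x y w → ThreeCut L p l q x w y
  swap-cut C = record
    { p∈ = p∈ ; q∈ = l∈ ; l∈ = q∈ ; x∉ = x∉ ; y∉ = w∉ ; w∉ = y∉ ; p≢q = p≢l ; p≢l = p≢q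
    ; q≢l = ≢-sym q≢l ; px = px ; qy = lw ; lw = qy
    ; exits = λ u∈ v∉ uv → Sum.map₂ Sum.swap (exits u∈ v∉ uv) ; conn = conn ; conn∁ = conn∁ }
    where open ThreeCut C

  module _ {L p q l x y w} (C : ThreeCut L p q l x y w) where
    open ThreeCut C

    private
      find : ∀ X {x₀} → x₀ ∈ X → X ⊆ L → l ∉ X → ∀ a b → (p ∈ X → a ≡ x) → (q ∈ X → b ≡ y) →
        ∀ {y₀} → y₀ ∉ X → y₀ ≢ a → y₀ ≢ b → ∃[ v ] Boundary L X v × v ≢ a × v ≢ b
      find X x₀∈ X⊆ l∉ a b a≡ b≡ y₀∉ y₀≢a y₀≢b
        with u , v , u∈ , v∉ , uv , v≢a , v≢b ← three-connected X a b x₀∈ y₀∉ y₀≢a y₀≢b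
        with v ∈? L
      ... | yes v∈ = v , (v∈ , v∉ , u , u∈ , uv) , v≢a , v≢b
      ... | no v∉L with exits (X⊆ u∈) v∉L uv
      ...   | inj₁ (refl , refl)        = ⊥-elim (v≢a (sym (a≡ u∈)))
      ...   | inj₂ (inj₁ (refl , refl)) = ⊥-elim (v≢b (sym (b≡ u∈)))
      ...   | inj₂ (inj₂ (refl , refl)) = ⊥-elim (l∉ u∈)

      ∉-≢ : ∀ {u v} → u ∈ L → v ∉ L → u ≢ v
      ∉-≢ = ∈∧∉⇒≢

      escape : ∀ X {x₀} → x₀ ∈ X → X ⊆ L → (∀ {u} → u ∈ X → u ∉ ⁅ l ⁆) →
        ∀ a b → Escape L ⁅ q ⁆ p X a b
      escape X x₀∈ X⊆ X∩ a b = go (p ∈? X) (q ∈? X)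
        where
        l∉ : l ∉ X
        l∉ l∈X = X∩ l∈X (x∈⁅x⁆ l)

        go : Dec (p ∈ X) → Dec (q ∈ X) → Escape L ⁅ q ⁆ p X a b
        go (yes p∈X) (yes q∈X) =
          let v , v∈∂ , _ = find X x₀∈ X⊆ l∉ x y (λ _ → refl) (λ _ → refl) l∉ (∉-≢ l∈ x∉) (∉-≢ l∈ y∉)
          in v , v∈∂ , inj₁ p∈X , inj₁ (q , q∈X , x∈⁅x⁆ q)
        go (yes p∈X) (no q∉) with q ≟ b
        ... | no q≢b =
          let v , v∈∂ , _ , v≢b = find X x₀∈ X⊆ l∉ x b (λ _ → refl) (⊥-elim ∘ q∉) q∉ (∉-≢ q∈ x∉) q≢b
          in v , v∈∂ , inj₁ p∈X , inj₂ v≢b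
        ... | yes refl =
          let v , v∈∂ , _ , v≢b = find X x₀∈ X⊆ l∉ x b (λ _ → refl) (⊥-elim ∘ q∉) l∉ (∉-≢ l∈ x∉) (≢-sym q≢l)
          in v , v∈∂ , inj₁ p∈X , inj₂ v≢b
        go (no p∉) (yes q∈X) with p ≟ a
        ... | no p≢a =
          let v , v∈∂ , v≢a , _ = find X x₀∈ X⊆ l∉ a y (⊥-elim ∘ p∉) (λ _ → refl) p∉ p≢a (∉-≢ p∈ y∉)
          in v , v∈∂ , inj₂ v≢a , inj₁ (q , q∈X , x∈⁅x⁆ q)
        ... | yes refl =
          let v , v∈∂ , v≢a , _ = find X x₀∈ X⊆ l∉ a y (⊥-elim ∘ p∉) (λ _ → refl) l∉ (≢-sym p≢l) (∉-≢ l∈ y∉)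
          in v , v∈∂ , inj₂ v≢a , inj₁ (q , q∈X , x∈⁅x⁆ q)
        go (no p∉) (no q∉) =
          let y₀ , which , y₀≢a , y₀≢b = one-avoiding-two a b p≢q p≢l q≢l
              v , v∈∂ , v≢a , v≢b = find X x₀∈ X⊆ l∉ a b (⊥-elim ∘ p∉) (⊥-elim ∘ q∉) (missed which) y₀≢a y₀≢b
          in v , v∈∂ , inj₂ v≢a , inj₂ v≢b
          where
          missed : ∀ {v} → v ≡ p ⊎ v ≡ q ⊎ v ≡ l → v ∉ X
          missed (inj₁ refl)        = p∉
          missed (inj₂ (inj₁ refl)) = q∉
          missed (inj₂ (inj₂ refl)) = l∉

      -- A component of L - l with p but without q could be left only towards x and l, and two
      -- vertices do not separate it from q.
      joined : Reach (L ─ ⁅ l ⁆) p q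
      joined with X , K ← component {d = p} (─⁺ p∈ (≢⇒∉⁅⁆ p≢l)) with q ∈? X
      ... | yes q∈X = reach-mono (IsComponent.inside⊆ K) (IsComponent.conn K (IsComponent.centre K) q∈X)
      ... | no q∉X
        with v , (v∈ , v∉ , u , u∈ , uv) , _ , v≢l ←
          find X (IsComponent.centre K) (─⁻ˡ ∘ IsComponent.inside⊆ K)
            (λ l∈X → ─⁻ʳ (IsComponent.inside⊆ K l∈X) (x∈⁅x⁆ l)) x l (λ _ → refl) (⊥-elim ∘ q∉X)
            q∉X (∉-≢ q∈ x∉) q≢l =
        ⊥-elim (v∉ (IsComponent.closed K u∈ (─⁺ v∈ (≢⇒∉⁅⁆ v≢l)) uv))

    cut-ear : Ear L ⁅ l ⁆ ⁅ q ⁆ p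
    cut-ear = ear (x∈⁅x⁆ l) (⁅⁆⊆ l∈) (conn-⁅⁆ l) (q , x∈⁅x⁆ q , joined) escape

    -- The equations for the ends and the absence of l are kept for the next stage: with p and q on
    -- the route, the edge at l is the only one still leading out of L.
    cut-handle : ∃[ h ] Handle.p {L} h ≡ p × Handle.q h ≡ q × l ∉ Handle.route h
    cut-handle with record { path = path ; route⊆ = r⊆ ; base⊆ = b⊆ ; rest = rest
                           ; end∈ = e∈ ; attached = att } ← cut-ear
      with refl ← ∈⁅⁆⁻ e∈ = record
        { path = path ; route⊆ = r⊆ ; p≢q = p≢q ; x∉ = x∉ ; y∉ = y∉ ; px = px ; qy = qy
        ; rest = rest ; attached = att }
      , refl , refl , ─⁻ʳ (b⊆ (x∈⁅x⁆ l))

  -- Stages and their minimal pieces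

  -- Neither `l ∈ X` nor adjacency of l and w is demanded, so a set without any exit past F is
  -- included, with l and w arbitrary.
  Exits : Subset n → Subset n → Fin n → Fin n → Set
  Exits F X l w = ∀ u v → u ∈ X → v ∉ X → Adj u v → v ∈ F ⊎ (u ≡ l × v ≡ w)

  exits? : ∀ F X l w → Dec (Exits F X l w)
  exits? F X l w = all? (λ u → all? (λ v →
    u ∈? X →-dec (¬? (v ∈? X) →-dec (adj? u v →-dec (v ∈? F ⊎-dec (u ≟ l ×-dec v ≟ w))))))

  Minimal : Subset n → Subset n → Set
  Minimal F L = ∀ X {x t} → x ∈ X → X ⊆ L → t ∈ L → t ∉ X → ∀ l w → ¬ Exits F X l w

  minimal-piece : ∀ {F U c l w} → c ∈ U → Exits F U l w →
    ∃[ L ] L ⊆ U × Nonempty L × Minimal F L × ∃[ l ] ∃[ w ] Exits F L l w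
  minimal-piece {F} {U} c∈ ex = go n U (∣p∣≤n U) id (_ , c∈) (_ , _ , ex)
    where
    go : ∀ k L → ∣ L ∣ ≤ k → L ⊆ U → Nonempty L → ∃[ l ] ∃[ w ] Exits F L l w →
      ∃[ L ] L ⊆ U × Nonempty L × Minimal F L × ∃[ l ] ∃[ w ] Exits F L l w
    go k L ≤k L⊆ ne ex
      with anySubset? (λ X → any? (λ x → x ∈? X) ×-dec X ⊆? L ×-dec
             any? (λ t → t ∈? L ×-dec ¬? (t ∈? X)) ×-dec any? (λ l → any? (λ w → exits? F X l w)))
    ... | no ¬smaller = L , L⊆ , ne
          , (λ X x∈ X⊆ t∈ t∉ l w ex → ¬smaller (X , (_ , x∈) , X⊆ , (_ , t∈ , t∉) , l , w , ex)) , ex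
    go zero L ≤k L⊆ (x , x∈) ex | yes _ = ⊥-elim (n≮0 (<-≤-trans (x∈p⇒∣p-x∣<∣p∣ {p = L} x∈) ≤k))
    go (suc k) L ≤k L⊆ ne ex | yes (X , X≢∅ , X⊆ , (t , t∈ , t∉) , ex′) =
      go k X (s≤s⁻¹ (<-≤-trans (∣∣-mono-< X L X⊆ t∈ t∉) ≤k)) (L⊆ ∘ X⊆) X≢∅ ex′

  -- F is the part already treated and U the rest; c w₀ is the one edge leaving U
  -- that may not be used.
  record Stage (F U : Subset n) (c w₀ : Fin n) : Set where
    field
      disjoint : ∀ {v} → v ∈ U → v ∉ F
      c∈       : c ∈ U
      cw₀      : Adj c w₀
      w₀∉U     : w₀ ∉ U
      w₀∉F     : w₀ ∉ F
      exits    : Exits F U c w₀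
      connU    : Conn U
      connF    : Conn F
      conn∁    : Conn (∁ U)

  record Piece (F U : Subset n) (c : Fin n) (L : Subset n) (l w : Fin n) : Set where
    field
      L⊆       : L ⊆ U
      disjoint : ∀ {v} → v ∈ L → v ∉ F
      l∈       : l ∈ L
      lw       : Adj l w
      w∉L      : w ∉ L
      w∉F      : w ∉ F
      exits    : Exits F L l w
      minimal  : Minimal F L
      location : (U ⊆ L × l ≡ c) ⊎ (c ∉ L × w ∈ U)

  -- The exit l w is a genuine edge. If c is outside L, connectivity of U gives an edge of U leaving
  -- L, which misses F. If `c ∈ L`, then `c w₀` is such an edge, so no edge of U leaves L and L = U.
  piece : ∀ {F U c w₀} → Stage F U c w₀ → ∃[ L ] ∃[ l ] ∃[ w ] Piece F U c L l w
  piece {F} {U} {c} {w₀} S =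
    let L , L⊆ , (x , x∈) , min , l , w , ex = minimal-piece c∈ exits
        l∈ , lw , w∉L , w∉F , loc = locate L⊆ x∈ ex (c ∈? L)
    in L , l , w , record
      { L⊆ = L⊆ ; disjoint = disjoint ∘ L⊆ ; l∈ = l∈ ; lw = lw ; w∉L = w∉L ; w∉F = w∉F
      ; exits = ex ; minimal = min ; location = loc }
    where
    open Stage S

    locate : ∀ {L l w x} → L ⊆ U → x ∈ L → Exits F L l w → Dec (c ∈ L) →
      l ∈ L × Adj l w × w ∉ L × w ∉ F × ((U ⊆ L × l ≡ c) ⊎ (c ∉ L × w ∈ U))
    locate L⊆ x∈ ex (no c∉) with a , b , a∈ , b∉ , ab , b∈U ← exit (connU (L⊆ x∈) c∈) x∈ c∉
      with ex a b a∈ b∉ ab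
    ... | inj₁ b∈F           = ⊥-elim (disjoint b∈U b∈F)
    ... | inj₂ (refl , refl) = a∈ , ab , b∉ , disjoint b∈U , inj₂ (c∉ , b∈U)
    locate {L} L⊆ x∈ ex (yes c∈L) with ex c w₀ c∈L (w₀∉U ∘ L⊆) cw₀
    ... | inj₁ w₀∈F          = ⊥-elim (w₀∉F w₀∈F)
    ... | inj₂ (refl , refl) = c∈L , cw₀ , w₀∉U ∘ L⊆ , w₀∉F , inj₁ (U⊆L , refl)
      where
      U⊆L : U ⊆ L
      U⊆L {t} t∈ with t ∈? L
      ... | yes t∈L = t∈L
      ... | no t∉L with a , b , a∈ , b∉ , ab , b∈U ← exit (connU c∈ t∈) c∈L t∉L
        with ex a b a∈ b∉ ab
      ...   | inj₁ b∈F        = ⊥-elim (disjoint b∈U b∈F)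
      ...   | inj₂ (_ , refl) = ⊥-elim (w₀∉U b∈U)

  module _ {F U c L l w} (P : Piece F U c L l w) where
    open Piece P

    -- A vertex with two neighbours in F has one edge left, so its singleton would be a smaller set
    -- with at most one exit.
    unique-foot : ∀ {u t a b} → u ∈ L → t ∈ L → t ≢ u → a ∈ F → b ∈ F → Adj u a → Adj u b → a ≡ b
    unique-foot {u} {t} {a} {b} u∈ t∈ t≢u a∈ b∈ ua ub with a ≟ b
    ... | yes a≡b = a≡b
    ... | no a≢b with s , us , s≢a , s≢b ← third-neighbour u a b =
      ⊥-elim (minimal ⁅ u ⁆ (x∈⁅x⁆ u) (⁅⁆⊆ u∈) t∈ (≢⇒∉⁅⁆ t≢u) u s ex)
      where
      ex : Exits F ⁅ u ⁆ u s
      ex u′ v u′∈ _ u′v with refl ← ∈⁅⁆⁻ u′∈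
        with cubic a≢b (≢-sym s≢a) (≢-sym s≢b) ua ub us u′v
      ... | inj₁ refl        = inj₁ a∈
      ... | inj₂ (inj₁ refl) = inj₁ b∈
      ... | inj₂ (inj₂ refl) = inj₂ (refl , refl)

    -- Of the three edges at l, one goes to w. If another went to F, the third would be the only
    -- possible exit of the smaller set L - l.
    exit-not-foot : ∀ {t a} → t ∈ L → t ≢ l → a ∈ F → ¬ Adj l a
    exit-not-foot {t} {a} t∈ t≢l a∈ la with s , ls , s≢a , s≢w ← third-neighbour l a w =
      minimal (L ─ ⁅ l ⁆) (─⁺ t∈ (≢⇒∉⁅⁆ t≢l)) ─⁻ˡ l∈ (λ l∈′ → ─⁻ʳ l∈′ (x∈⁅x⁆ l)) s l ex
      where
      a≢w : a ≢ w
      a≢w = ∈∧∉⇒≢ a∈ w∉F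
      ex : Exits F (L ─ ⁅ l ⁆) s l
      ex u v u∈ v∉ uv with v ≟ l
      ... | yes refl with cubic a≢w (≢-sym s≢a) (≢-sym s≢w) la lw ls (adj-sym uv)
      ...   | inj₁ refl        = ⊥-elim (disjoint (─⁻ˡ u∈) a∈)
      ...   | inj₂ (inj₁ refl) = ⊥-elim (w∉L (─⁻ˡ u∈))
      ...   | inj₂ (inj₂ refl) = inj₂ (refl , refl)
      ex u v u∈ v∉ uv | no v≢l with exits u v (─⁻ˡ u∈) (λ v∈ → v∉ (─⁺ v∈ (≢⇒∉⁅⁆ v≢l))) uv
      ... | inj₁ v∈F        = inj₁ v∈F
      ... | inj₂ (refl , _) = ⊥-elim (─⁻ʳ u∈ (x∈⁅x⁆ l))

    outgoing : ∀ X → X ⊆ L → l ∉ X → ∀ u v → u ∈ X → v ∉ X → Adj u v → v ∈ F ⊎ Boundary L X v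
    outgoing X X⊆ l∉ u v u∈ v∉ uv with v ∈? L
    ... | yes v∈ = inj₂ (v∈ , v∉ , u , u∈ , uv)
    ... | no v∉L with exits u v (X⊆ u∈) v∉L uv
    ...   | inj₁ v∈F        = inj₁ v∈F
    ...   | inj₂ (refl , _) = ⊥-elim (l∉ u∈)

    one-boundary : ∀ X {x} → x ∈ X → X ⊆ L → l ∉ X → ∃[ v ] Boundary L X v
    one-boundary X x∈ X⊆ l∉ with any? (boundary? L X)
    ... | yes h = h
    -- The pair `l l` is a placeholder: every edge leaving X ends in F.
    ... | no ¬h = ⊥-elim (minimal X x∈ X⊆ l∈ l∉ l l λ u v u∈ v∉ uv →
      inj₁ ([ id , (λ ∂v → ⊥-elim (¬h (v , ∂v))) ]′ (outgoing X X⊆ l∉ u v u∈ v∉ uv)))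

    -- If a were the only boundary vertex of X, then one of X and X ∪ {a} would
    -- have at most one exit, since a has three neighbours.
    two-boundary : ∀ X {x t} → x ∈ X → X ⊆ L → l ∉ X → t ∈ L → t ≢ l → t ∉ X →
      ∀ a → ∃[ v ] Boundary L X v × v ≢ a
    two-boundary X {x} {t} x∈ X⊆ l∉ t∈ t≢l t∉ a with any? (λ v → boundary? L X v ×-dec ¬? (v ≟ a))
    ... | yes h = h
    ... | no ¬h with b , b∈L , b∉X , y , y∈ , yb ← one-boundary X x∈ X⊆ l∉
      with s , bs , s≢y , _ ← third-neighbour b y y
      with r , br , r≢y , r≢s ← third-neighbour b y s = ⊥-elim contradiction
      where
      only-a : ∀ {v} → Boundary L X v → v ≡ a
      only-a {v} ∂v with v ≟ a
      ... | yes v≡a = v≡a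
      ... | no v≢a  = ⊥-elim (¬h (v , ∂v , v≢a))

      only-b : ∀ {v} → Boundary L X v → v ≡ b
      only-b ∂v = trans (only-a ∂v) (sym (only-a (b∈L , b∉X , y , y∈ , yb)))

      around-b : ∀ {v} → Adj b v → v ≡ y ⊎ v ≡ s ⊎ v ≡ r
      around-b = cubic (≢-sym s≢y) (≢-sym r≢y) (≢-sym r≢s) (adj-sym yb) bs br

      missed : ∃[ t′ ] t′ ∈ L × t′ ∉ X ∪ ⁅ b ⁆
      missed with b ≟ l
      ... | yes refl = t , t∈ , [ t∉ , (λ t∈b → t≢l (∈⁅⁆⁻ t∈b)) ]′ ∘ ∪⁻
      ... | no b≢l   = l , l∈ , [ l∉ , (λ l∈b → b≢l (sym (∈⁅⁆⁻ l∈b))) ]′ ∘ ∪⁻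

      enlarged : ∀ {s′} → (∀ {v} → Adj b v → v ∉ X → v ≡ s′) → Exits F (X ∪ ⁅ b ⁆) b s′
      enlarged only u v u∈ v∉ uv with ∪⁻ u∈
      ... | inj₂ u∈b with refl ← ∈⁅⁆⁻ u∈b = inj₂ (refl , only uv (v∉ ∘ ∪ˡ))
      ... | inj₁ u∈X with outgoing X X⊆ l∉ u v u∈X (v∉ ∘ ∪ˡ) uv
      ...   | inj₁ v∈F = inj₁ v∈F
      ...   | inj₂ ∂v with refl ← only-b ∂v = ⊥-elim (v∉ (∪ʳ (x∈⁅x⁆ b)))

      not-enlarged : ∀ {s′} → ¬ (∀ {v} → Adj b v → v ∉ X → v ≡ s′)
      not-enlarged only = let t′ , t′∈ , t′∉ = missed in
        minimal (X ∪ ⁅ b ⁆) (∪ˡ x∈) (∪-least X⊆ (⁅⁆⊆ b∈L)) t′∈ t′∉ b _ (enlarged only)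

      contradiction : Empty.⊥
      contradiction with s ∈? X | r ∈? X
      ... | yes s∈ | _ = not-enlarged {r} λ bv v∉ → case (around-b bv) v∉
        where
        case : ∀ {v} → v ≡ y ⊎ v ≡ s ⊎ v ≡ r → v ∉ X → v ≡ r
        case (inj₁ refl) v∉        = ⊥-elim (v∉ y∈)
        case (inj₂ (inj₁ refl)) v∉ = ⊥-elim (v∉ s∈)
        case (inj₂ (inj₂ v≡r)) _   = v≡r
      ... | no _ | yes r∈ = not-enlarged {s} λ bv v∉ → case (around-b bv) v∉
        where
        case : ∀ {v} → v ≡ y ⊎ v ≡ s ⊎ v ≡ r → v ∉ X → v ≡ s
        case (inj₁ refl) v∉        = ⊥-elim (v∉ y∈)
        case (inj₂ (inj₁ v≡s)) _   = v≡s
        case (inj₂ (inj₂ refl)) v∉ = ⊥-elim (v∉ r∈)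
      ... | no s∉ | no r∉ = minimal X x∈ X⊆ l∈ l∉ y b ex
        where
        case : ∀ {v} → v ≡ y ⊎ v ≡ s ⊎ v ≡ r → v ∈ X → v ≡ y
        case (inj₁ v≡y) _          = v≡y
        case (inj₂ (inj₁ refl)) v∈ = ⊥-elim (s∉ v∈)
        case (inj₂ (inj₂ refl)) v∈ = ⊥-elim (r∉ v∈)
        ex : Exits F X y b
        ex u v u∈ v∉ uv with outgoing X X⊆ l∉ u v u∈ v∉ uv
        ... | inj₁ v∈F = inj₁ v∈F
        ... | inj₂ ∂v with refl ← only-b ∂v = inj₂ (case (around-b (adj-sym uv)) u∈ , refl)

    piece-conn : Conn L
    piece-conn = conn-from from
      where
      from : ∀ {d} → d ∈ L → Reach L l d
      from d∈ with X , K ← component d∈ with l ∈? X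
      ... | yes l∈X = reach-mono (IsComponent.inside⊆ K) (IsComponent.conn K l∈X (IsComponent.centre K))
      ... | no l∉X
        with v , v∈ , v∉ , u , u∈ , uv ← one-boundary X (IsComponent.centre K) (IsComponent.inside⊆ K) l∉X =
        ⊥-elim (v∉ (IsComponent.closed K u∈ v∈ uv))

  -- Two conflicting handles

  record StageHandle (F U : Subset n) (c : Fin n) : Set where
    field
      handle : Handle U
    open Handle handle public
    field
      x∈F : x ∈ F
      y∈F : y ∈ F
      c∉  : c ∉ route

  module _ {F U c w₀ L l w} (S : Stage F U c w₀) (P : Piece F U c L l w) where
    open Piece P

    foot? : Decidable (λ v → v ∈ L × ∃[ f ] f ∈ F × Adj v f)
    foot? v = v ∈? L ×-dec any? (λ f → f ∈? F ×-dec adj? v f)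

    feet : Subset n
    feet = comprehension foot?

    feet⊆ : feet ⊆ L
    feet⊆ = proj₁ ∘ ∈-comprehension⁻ foot?

    below : ∀ {v} → v ∈ feet → ∃[ f ] f ∈ F × Adj v f
    below = proj₂ ∘ ∈-comprehension⁻ foot?

    foot≢exit : ∀ {v d} → v ∈ feet → d ∈ feet → d ≢ v → v ≢ l
    foot≢exit v∈ d∈ d≢v refl = let _ , f∈ , lf = below v∈ in exit-not-foot P (feet⊆ d∈) d≢v f∈ lf

    -- If X contains a foot, minimality gives a boundary vertex, and even one off a prescribed
    -- vertex while p or d is outside X. If X contains none, no edge leads from X to F, and
    -- 3-connectivity gives a boundary vertex off both a and b.
    feet-escape : ∀ {M₀ p d} → l ∈ M₀ → p ∈ feet → d ∈ feet → d ≢ p →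
      ∀ X {x} → x ∈ X → X ⊆ L → (∀ {u} → u ∈ X → u ∉ M₀) →
      ∀ a b → Escape L (feet ─ ⁅ p ⁆) p X a b
    feet-escape {M₀} {p} {d} l∈M₀ p∈ d∈ d≢p X {x} x∈ X⊆ X∩ a b = go (p ∈? X) (meets? X D)
      where
      D : Subset n
      D = feet ─ ⁅ p ⁆

      d∈D : d ∈ D
      d∈D = ─⁺ d∈ (≢⇒∉⁅⁆ d≢p)

      l∉ : l ∉ X
      l∉ l∈X = X∩ l∈X l∈M₀

      d≢l : d ≢ l
      d≢l = foot≢exit d∈ p∈ (≢-sym d≢p)

      p≢l : p ≢ l
      p≢l = foot≢exit p∈ d∈ d≢p

      go : Dec (p ∈ X) → Dec (Meets X D) → Escape L D p X a b
      go (yes p∈X) (yes meets) =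
        let v , ∂v = one-boundary P X x∈ X⊆ l∉ in v , ∂v , inj₁ p∈X , inj₁ meets
      go (yes p∈X) (no ¬meets) =
        let v , ∂v , v≢b = two-boundary P X x∈ X⊆ l∉ (feet⊆ d∈) d≢l (λ d∈X → ¬meets (d , d∈X , d∈D)) b
        in v , ∂v , inj₁ p∈X , inj₂ v≢b
      go (no p∉) (yes meets) =
        let v , ∂v , v≢a = two-boundary P X x∈ X⊆ l∉ (feet⊆ p∈) p≢l p∉ a
        in v , ∂v , inj₂ v≢a , inj₁ meets
      go (no p∉) (no ¬meets) =
        let y₀ , which , y₀≢a , y₀≢b = one-avoiding-two a b (≢-sym d≢p) p≢l d≢l
            u , v , u∈ , v∉ , uv , v≢a , v≢b = three-connected X a b x∈ (missed which) y₀≢a y₀≢b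
        in v , boundary u∈ v∉ uv (outgoing P X X⊆ l∉ u v u∈ v∉ uv) , inj₂ v≢a , inj₂ v≢b
        where
        missed : ∀ {v} → v ≡ p ⊎ v ≡ d ⊎ v ≡ l → v ∉ X
        missed (inj₁ refl)        = p∉
        missed (inj₂ (inj₁ refl)) = λ d∈X → ¬meets (d , d∈X , d∈D)
        missed (inj₂ (inj₂ refl)) = l∉

        boundary : ∀ {u v} → u ∈ X → v ∉ X → Adj u v → v ∈ F ⊎ Boundary L X v → Boundary L X v
        boundary u∈ v∉ uv (inj₂ ∂v)  = ∂v
        boundary {u} u∈ v∉ uv (inj₁ v∈F) = ⊥-elim (¬meets (u , u∈ ,
          ─⁺ (∈-comprehension⁺ foot? (X⊆ u∈ , _ , v∈F , uv)) (≢⇒∉⁅⁆ (∈∧∉⇒≢ u∈ p∉))))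

    -- V is U for a handle of the stage; V = L serves to show that an ear vertex has only one
    -- neighbour in the piece off the ear.
    handle-in : ∀ {M₀ p} V → L ⊆ V → (∀ {v} → v ∈ V → v ∉ F) → p ∈ feet →
      (E : Ear L M₀ (feet ─ ⁅ p ⁆) p) → Conn (V ─ Ear.route E) → Handle V
    handle-in V L⊆V V∩F p∈ E conn = record
      { path = E.path ; route⊆ = L⊆V ∘ E.route⊆
      ; p≢q = λ p≡q → ─⁻ʳ E.end∈ (subst (_∈ ⁅ _ ⁆) p≡q (x∈⁅x⁆ _))
      ; x∉ = λ x∈V → V∩F x∈V (proj₁ (proj₂ (below p∈)))
      ; y∉ = λ y∈V → V∩F y∈V (proj₁ (proj₂ (below (─⁻ˡ E.end∈))))
      ; px = proj₂ (proj₂ (below p∈))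
      ; qy = proj₂ (proj₂ (below (─⁻ˡ E.end∈)))
      ; rest = conn
      ; attached = λ u∈ → let m , m∈ , um = E.attached u∈ in m , ─⁺ (L⊆V (─⁻ˡ m∈)) (─⁻ʳ m∈) , um }
      where module E = Ear E

    leave-piece : c ∉ L → w ∈ U → ∀ {u} → u ∈ U ─ L → Reach (U ─ L) u w
    leave-piece c∉ w∈ u∈ with a , b , r , ab , b∈ ←
      last-before (Stage.connU S (─⁻ˡ u∈) (L⊆ l∈)) (─⁻ʳ u∈) l∈
      with exits b a b∈ (─⁻ʳ (reach-target r)) (adj-sym ab)
    ... | inj₁ a∈F           = ⊥-elim (Stage.disjoint S (─⁻ˡ (reach-target r)) a∈F)
    ... | inj₂ (refl , refl) = r

    rest-conn : ∀ {Q} → Q ⊆ L → l ∉ Q → Conn (L ─ Q) → Conn (U ─ Q)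
    rest-conn {Q} Q⊆ l∉ conn with location
    ... | inj₁ (U⊆L , _) = conn-resp (λ z∈ → ─⁺ (L⊆ (─⁻ˡ z∈)) (─⁻ʳ z∈)) (λ z∈ → ─⁺ (U⊆L (─⁻ˡ z∈)) (─⁻ʳ z∈)) conn
    ... | inj₂ (c∉ , w∈) = conn-from from
      where
      from : ∀ {u} → u ∈ U ─ Q → Reach (U ─ Q) l u
      from {u} u∈ with u ∈? L
      ... | yes u∈L = reach-mono (λ z∈ → ─⁺ (L⊆ (─⁻ˡ z∈)) (─⁻ʳ z∈)) (conn (─⁺ l∈ l∉) (─⁺ u∈L (─⁻ʳ u∈)))
      ... | no u∉L  = step (─⁺ (L⊆ l∈) l∉) lw (reach-sym (reach-mono (λ z∈ → ─⁺ (─⁻ˡ z∈) (─⁻ʳ z∈ ∘ Q⊆))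
        (leave-piece c∉ w∈ (─⁺ (─⁻ˡ u∈) u∉L))))

    ear⇒handle : ∀ {M₀ p} → l ∈ M₀ → p ∈ feet → Ear L M₀ (feet ─ ⁅ p ⁆) p → StageHandle F U c
    ear⇒handle l∈M₀ p∈ E = record
      { handle = handle-in U L⊆ (Stage.disjoint S) p∈ E
          (rest-conn (Ear.route⊆ E) (─⁻ʳ (Ear.base⊆ E l∈M₀)) (Ear.rest E))
      ; x∈F = proj₁ (proj₂ (below p∈))
      ; y∈F = proj₁ (proj₂ (below (─⁻ˡ (Ear.end∈ E))))
      ; c∉ = λ c∈ →
          [ (λ { (_ , refl) → ─⁻ʳ (Ear.base⊆ E l∈M₀) c∈ }) , (λ (c∉L , _) → c∉L (Ear.route⊆ E c∈)) ]′ location }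

    -- A component of L - l missing v would have l as its only boundary vertex, which `two-boundary`
    -- excludes.
    around-exit : ∀ {u v} → u ∈ L → u ≢ l → v ∈ L → v ≢ l → Reach (L ─ ⁅ l ⁆) u v
    around-exit {u} {v} u∈ u≢l v∈ v≢l with X , K ← component {d = u} (─⁺ u∈ (≢⇒∉⁅⁆ u≢l)) with v ∈? X
    ... | yes v∈X = reach-mono (IsComponent.inside⊆ K) (IsComponent.conn K (IsComponent.centre K) v∈X)
    ... | no v∉X
      with b , (b∈ , b∉ , a , a∈ , ab) , b≢l ← two-boundary P X (IsComponent.centre K)
        (─⁻ˡ ∘ IsComponent.inside⊆ K) (λ l∈X → ─⁻ʳ (IsComponent.inside⊆ K l∈X) (x∈⁅x⁆ l)) v∈ v≢l v∉X l =
      ⊥-elim (b∉ (IsComponent.closed K a∈ (─⁺ b∈ (≢⇒∉⁅⁆ b≢l)) ab))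

    first-ear : ∀ {p d} → p ∈ feet → d ∈ feet → d ≢ p → Ear L ⁅ l ⁆ (feet ─ ⁅ p ⁆) p
    first-ear {p} {d} p∈ d∈ d≢p = ear (x∈⁅x⁆ l) (⁅⁆⊆ l∈) (conn-⁅⁆ l)
      ( d , ─⁺ d∈ (≢⇒∉⁅⁆ d≢p)
      , around-exit (feet⊆ p∈) (foot≢exit p∈ d∈ d≢p) (feet⊆ d∈) (foot≢exit d∈ p∈ (≢-sym d≢p)) )
      (feet-escape (x∈⁅x⁆ l) p∈ d∈ d≢p)

    -- Grow a connected K ∋ l off the first ear as long as that ear reaches a
    -- further foot outside K.  A maximal K touches the ear, in i say, and one of
    -- the two ends of the ear still reaches the further foot off K ∪ {i}.
    second-ear : ∀ {p z} → p ∈ feet → z ∈ feet → z ≢ p → (E : Ear L ⁅ l ⁆ (feet ─ ⁅ p ⁆) p) → z ≢ Ear.end E →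
      ∃[ s ] ∃[ i ] ∃[ M₀ ] Ear L M₀ (feet ─ ⁅ s ⁆) s × l ∈ M₀ × s ∈ feet ×
        s ∈ Ear.route E × i ∈ Ear.route E × i ∈ M₀
    second-ear {p} {z} p∈ z∈ z≢p E z≢q =
      let K , max = maximal {L} {⁅ l ⁆} {E.route} {D} {p} (⁅⁆⊆ l∈) (conn-⁅⁆ l)
            (λ v∈ v∈E → ─⁻ʳ (E.base⊆ v∈) v∈E)
            (z , z∈D , around-exit (E.route⊆ p∈E) (∈∧∉⇒≢ p∈E l∉E) (feet⊆ z∈) z≢l)
          i , i∈ , k , k∈ , ik = touching K max
          s , s∈ , s∈E , t , t∈ , st = detour K max i∈ k∈ ik
      in s , i , K ∪ ⁅ i ⁆
         , ear (∪ˡ (Maximal.base⊆ max (x∈⁅x⁆ l))) (∪-least (Maximal.within max) (⁅⁆⊆ (E.route⊆ i∈)))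
             (conn-∪ (Maximal.conn max) (conn-⁅⁆ i) k∈ (x∈⁅x⁆ i) (adj-sym ik))
             (t , ─⁺ (─⁻ˡ t∈) (≢⇒∉⁅⁆ (≢-sym (∈∧∉⇒≢ s∈E (─⁻ʳ t∈)))) , st)
             (feet-escape (∪ˡ (Maximal.base⊆ max (x∈⁅x⁆ l))) s∈ (─⁻ˡ t∈) (≢-sym (∈∧∉⇒≢ s∈E (─⁻ʳ t∈))))
         , ∪ˡ (Maximal.base⊆ max (x∈⁅x⁆ l)) , s∈ , s∈E , i∈ , ∪ʳ (x∈⁅x⁆ i)
      where
      module E = Ear E

      D : Subset n
      D = feet ─ E.route

      z∈D : z ∈ D
      z∈D = ─⁺ z∈ λ z∈E → z≢q (E.only-end z∈E (─⁺ z∈ (≢⇒∉⁅⁆ z≢p)))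

      z≢l : z ≢ l
      z≢l = foot≢exit z∈ p∈ (≢-sym z≢p)

      p∈E : p ∈ E.route
      p∈E = path-source E.path

      l∉E : l ∉ E.route
      l∉E = ─⁻ʳ (E.base⊆ (x∈⁅x⁆ l))

      touching : ∀ K → Maximal L ⁅ l ⁆ E.route D p K →
        ∃[ i ] i ∈ E.route × ∃[ k ] k ∈ K × Adj i k
      touching K max with any? (λ i → i ∈? E.route ×-dec any? (λ k → k ∈? K ×-dec adj? i k))
      ... | yes h = h
      ... | no ¬h = ⊥-elim (isolated (component (─⁺ (─⁺ (E.route⊆ p∈E) (λ p∈K → Maximal.avoids max p∈K p∈E))
                      λ p∈N → ¬h (p , p∈E , ∈-comprehension⁻ near? p∈N))))
        where
        near? : Decidable (λ v → ∃[ k ] k ∈ K × Adj v k)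
        near? v = any? (λ k → k ∈? K ×-dec adj? v k)

        isolated : ¬ (∃[ X ] IsComponent ((L ─ K) ─ comprehension near?) X p)
        isolated (X , C) = let q , q∈ , r = Maximal.target max in
          escape⇒¬critical q∈ r (─⁻ˡ ∘ IsComponent.inside⊆ C) (IsComponent.conn C) crit escape
          where
          open IsComponent C

          X⊆ : X ⊆ L
          X⊆ = ─⁻ˡ ∘ ─⁻ˡ ∘ inside⊆

          l∉ : l ∉ X
          l∉ l∈X = ─⁻ʳ (─⁻ˡ (inside⊆ l∈X)) (Maximal.base⊆ max (x∈⁅x⁆ l))

          crit : ∀ {v} → Boundary L X v → v ∈ L ─ K × Critical (L ─ K) p D v
          crit {v} (v∈ , v∉ , x , x∈ , xv) with v ∈? K
          ... | yes v∈K = ⊥-elim (─⁻ʳ (inside⊆ x∈) (∈-comprehension⁺ near? (v , v∈K , xv)))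
          ... | no v∉K with near? v
          ...   | yes (k , k∈ , vk) =
            ─⁺ v∈ v∉K , Maximal.critical max (─⁺ v∈ v∉K) (λ v∈E → ¬h (v , v∈E , k , k∈ , vk)) k∈ vk
          ...   | no ¬v = ⊥-elim (v∉ (closed x∈ (─⁺ (─⁺ v∈ v∉K) (¬v ∘ ∈-comprehension⁻ near?)) xv))

          escape : ∀ a b → Escape L D p X a b
          escape a b with meets? X D
          ... | yes meets = let v , ∂v = one-boundary P X centre X⊆ l∉ in v , ∂v , inj₁ centre , inj₁ meets
          ... | no ¬meets =
            let v , ∂v , v≢b = two-boundary P X centre X⊆ l∉ (feet⊆ z∈) z≢l (λ z∈X → ¬meets (z , z∈X , z∈D)) b
            in v , ∂v , inj₁ centre , inj₂ v≢b

      detour : ∀ K → Maximal L ⁅ l ⁆ E.route D p K → ∀ {i k} → i ∈ E.route → k ∈ K → Adj i k →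
        ∃[ s ] s ∈ feet × s ∈ E.route × ∃[ t ] t ∈ D × Reach (L ─ (K ∪ ⁅ i ⁆)) s t
      detour K max {i} {k} i∈ k∈ ik =
        let t , t∈ , pt = Maximal.target max
            -- Go from t back to p and along the ear to i; j precedes the first visit to i. Off the
            -- ear, i has no neighbour in L but `k ∈ K`, so j is on the ear and, avoiding i, is
            -- joined to one of its ends.
            j , _ , tj , ji , i′∈ = last-before {X = ⁅ i ⁆}
              (reach-trans (reach-sym pt) (reach-mono off-K (path-conn E.path p∈E i∈)))
              (≢⇒∉⁅⁆ (≢-sym (∈∧∉⇒≢ i∈ (─⁻ʳ t∈)))) (x∈⁅x⁆ i)
            j∈ = reach-target tj
            ij = subst (λ v → Adj v j) (∈⁅⁆⁻ i′∈) (adj-sym ji)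
            j∈E = onE (─⁻ˡ j∈) ij
            extend : ∀ {s} → Reach (E.route ─ ⁅ i ⁆) s j → Reach (L ─ (K ∪ ⁅ i ⁆)) s t
            extend r = reach-trans (reach-mono (λ z∈ → avoid (off-K (─⁻ˡ z∈)) (─⁻ʳ z∈)) r)
                         (reach-sym (reach-mono (λ z∈ → avoid (─⁻ˡ z∈) (─⁻ʳ z∈)) tj))
        in [ (λ r → p , p∈ , p∈E , t , t∈ , extend r)
           , (λ r → E.end , ─⁻ˡ E.end∈ , path-target E.path , t , t∈ , extend r) ]′
           (path-around E.path j∈E λ i≡j → ─⁻ʳ j∈ (subst (_∈ ⁅ i ⁆) i≡j (x∈⁅x⁆ i)))
        where
        off-K : E.route ⊆ L ─ K
        off-K v∈ = ─⁺ (E.route⊆ v∈) λ v∈K → Maximal.avoids max v∈K v∈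

        avoid : ∀ {v} → v ∈ L ─ K → v ∉ ⁅ i ⁆ → v ∈ L ─ (K ∪ ⁅ i ⁆)
        avoid v∈ v∉ = ─⁺ (─⁻ˡ v∈) ([ ─⁻ʳ v∈ , v∉ ]′ ∘ ∪⁻)

        onE : ∀ {j} → j ∈ L ─ K → Adj i j → j ∈ E.route
        onE {j} j∈ ij with j ∈? E.route
        ... | yes j∈E = j∈E
        ... | no j∉E = ⊥-elim (─⁻ʳ j∈ (subst (_∈ K) (sym j≡k) k∈))
          where
          j≡k : j ≡ k
          j≡k = Handle.attached-unique (handle-in L id disjoint p∈ E E.rest) i∈
            (─⁺ (Maximal.within max k∈) (Maximal.avoids max k∈)) (─⁺ (─⁻ˡ j∈) j∉E) ik ij

    ConflictingHandles : Set
    ConflictingHandles = ∃[ h₁ ] ∃[ h₂ ]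
      Conflict (StageHandle.route {F} {U} {c} h₁) (StageHandle.route {F} {U} {c} h₂)

    -- The first ear starts at p and ends in at most one of a and b, so the other is a further foot.
    -- The second ear starts on the first one, at s, and misses its vertex i, which lies in M₀.
    conflicting-handles : ∀ {p a b} → p ∈ feet → a ∈ feet → b ∈ feet → a ≢ p → b ≢ p → a ≢ b →
      ConflictingHandles
    conflicting-handles {p} {a} {b} p∈ a∈ b∈ a≢p b≢p a≢b = further (a ≟ Ear.end E)
      where
      E : Ear L ⁅ l ⁆ (feet ─ ⁅ p ⁆) p
      E = first-ear p∈ a∈ a≢p

      conflict : ∀ {z} → z ∈ feet → z ≢ p → z ≢ Ear.end E → ConflictingHandles
      conflict z∈ z≢p z≢q =
        let s , i , M₀ , E′ , l∈ , s∈ , s∈E , i∈E , i∈M₀ = second-ear p∈ z∈ z≢p E z≢q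
        in ear⇒handle (x∈⁅x⁆ l) p∈ E , ear⇒handle l∈ s∈ E′
         , (s , s∈E , path-source (Ear.path E′)) , (i , i∈E , ─⁻ʳ (Ear.base⊆ E′ i∈M₀))

      further : Dec (a ≡ Ear.end E) → ConflictingHandles
      further (no a≢q)    = conflict a∈ a≢p a≢q
      further (yes a≡q) = conflict b∈ b≢p (λ b≡q → a≢b (trans a≡q (sym b≡q)))

  -- Shapes of pieces

  -- Only the edges have to differ: a one-vertex piece has p = q, and distinct p and q may share x =
  -- y.
  record TwoFeet (F L : Subset n) : Set where
    field
      {p q x y} : Fin n
      p∈       : p ∈ L
      q∈       : q ∈ L
      x∈       : x ∈ F
      y∈       : y ∈ F
      px       : Adj p x
      qy       : Adj q y
      distinct : p ≢ q ⊎ x ≢ y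
      only     : ∀ {u v} → u ∈ L → v ∈ F → Adj u v → (u ≡ p × v ≡ x) ⊎ (u ≡ q × v ≡ y)

  data Shape (F U : Subset n) (c : Fin n) (L : Subset n) (l w : Fin n) : Set where
    single : L ⊆ ⁅ l ⁆ → TwoFeet F L → Shape F U c L l w
    cut    : ∀ {p q x y} → ThreeCut L p q l x y w → TwoFeet F L → Shape F U c L l w
    fork   : (h₁ h₂ : StageHandle F U c) →
             Conflict (StageHandle.route h₁) (StageHandle.route h₂) → Shape F U c L l w

  module _ {F U c w₀ L l w} (S : Stage F U c w₀) (P : Piece F U c L l w) where
    open Piece P

    past-exit : ∀ {u v} → u ∈ L ─ ⁅ l ⁆ → v ∉ L ─ ⁅ l ⁆ → Adj u v → v ≢ l → v ∈ F
    past-exit {u} {v} u∈ v∉ uv v≢l with exits u v (─⁻ˡ u∈) (λ v∈ → v∉ (─⁺ v∈ (≢⇒∉⁅⁆ v≢l))) uv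
    ... | inj₁ v∈F        = v∈F
    ... | inj₂ (refl , _) = ⊥-elim (─⁻ʳ u∈ (x∈⁅x⁆ l))

    -- Past l, the set L - l is left only through F, so a first foot p exists. Deleting also its
    -- neighbour x leaves another edge into F; if it started at p, this vertex would have two
    -- neighbours in F.
    second-foot : ∀ {t} → t ∈ L → t ≢ l → ∃[ p ] ∃[ q ] p ∈ feet S P × q ∈ feet S P × p ≢ q
    second-foot t∈ t≢l with any? (foot? S P)
    ... | no ¬foot =
      let w≢l = ≢-sym (∈∧∉⇒≢ l∈ w∉L)
          u , v , u∈ , v∉ , uv , v≢l , _ =
            three-connected (L ─ ⁅ l ⁆) l l (─⁺ t∈ (≢⇒∉⁅⁆ t≢l)) (w∉L ∘ ─⁻ˡ) w≢l w≢l
      in ⊥-elim (¬foot (u , ─⁻ˡ u∈ , v , past-exit u∈ v∉ uv v≢l , uv))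
    ... | yes (p , p∈ , x , x∈ , px) =
      let u , v , u∈ , v∉ , uv , v≢l , v≢x =
            three-connected (L ─ ⁅ l ⁆) l x (─⁺ t∈ (≢⇒∉⁅⁆ t≢l)) (w∉L ∘ ─⁻ˡ)
              (≢-sym (∈∧∉⇒≢ l∈ w∉L)) (≢-sym (∈∧∉⇒≢ x∈ w∉F))
          v∈F = past-exit u∈ v∉ uv v≢l
      in p , u , ∈-comprehension⁺ (foot? S P) (p∈ , x , x∈ , px)
           , ∈-comprehension⁺ (foot? S P) (─⁻ˡ u∈ , v , v∈F , uv)
           , λ p≡u → v≢x (unique-foot P (─⁻ˡ u∈) l∈
               (λ l≡u → ─⁻ʳ u∈ (subst (_∈ ⁅ l ⁆) l≡u (x∈⁅x⁆ l))) v∈F x∈ uv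
               (subst (λ z → Adj z x) p≡u px))

    -- If c is outside L, everything in U - L reaches w within U - L, and the edge `c w₀` ties this
    -- part to the complement of U.
    piece-conn∁ : Conn (∁ L)
    piece-conn∁ with location
    ... | inj₁ (U⊆L , _) = conn-resp (λ z∈ → x∉p⇒x∈∁p (x∈∁p⇒x∉p z∈ ∘ L⊆))
                                     (λ z∈ → x∉p⇒x∈∁p (x∈∁p⇒x∉p z∈ ∘ U⊆L)) (Stage.conn∁ S)
    ... | inj₂ (c∉ , w∈) = conn-resp into onto
      (conn-∪ (conn-from (λ u∈ → reach-sym (leave-piece S P c∉ w∈ u∈))) (Stage.conn∁ S)
        (─⁺ (Stage.c∈ S) c∉) (x∉p⇒x∈∁p (Stage.w₀∉U S)) (Stage.cw₀ S))
      where
      into : (U ─ L) ∪ ∁ U ⊆ ∁ L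
      into z∈ = x∉p⇒x∈∁p ([ ─⁻ʳ , (λ z∈∁ → x∈∁p⇒x∉p z∈∁ ∘ L⊆) ]′ (∪⁻ z∈))
      onto : ∁ L ⊆ (U ─ L) ∪ ∁ U
      onto {z} z∈ with z ∈? U
      ... | yes z∈U = ∪ˡ (─⁺ z∈U (x∈∁p⇒x∉p z∈))
      ... | no z∉U  = ∪ʳ (x∉p⇒x∈∁p z∉U)

    single-feet : L ⊆ ⁅ l ⁆ → TwoFeet F L
    single-feet L⊆l =
      let a , la , a≢w , _ = third-neighbour l w w
          b , lb , b≢w , b≢a = third-neighbour l w a
      in record { p∈ = l∈ ; q∈ = l∈ ; x∈ = inF la a≢w ; y∈ = inF lb b≢w ; px = la ; qy = lb
                ; distinct = inj₂ (≢-sym b≢a) ; only = only la lb a≢w b≢w b≢a }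
      where
      inF : ∀ {a} → Adj l a → a ≢ w → a ∈ F
      inF {a} la a≢w with exits l a l∈ (λ a∈ → irreflexive (subst (Adj l) (∈⁅⁆⁻ (L⊆l a∈)) la)) la
      ... | inj₁ a∈F       = a∈F
      ... | inj₂ (_ , a≡w) = ⊥-elim (a≢w a≡w)

      only : ∀ {a b} → Adj l a → Adj l b → a ≢ w → b ≢ w → b ≢ a →
        ∀ {u v} → u ∈ L → v ∈ F → Adj u v → (u ≡ l × v ≡ a) ⊎ (u ≡ l × v ≡ b)
      only la lb a≢w b≢w b≢a u∈ v∈ uv with refl ← ∈⁅⁆⁻ (L⊆l u∈)
        with cubic (≢-sym b≢a) a≢w b≢w la lb lw uv
      ... | inj₁ v≡a         = inj₁ (refl , v≡a)
      ... | inj₂ (inj₁ v≡b)  = inj₂ (refl , v≡b)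
      ... | inj₂ (inj₂ refl) = ⊥-elim (w∉F v∈)

    two-feet : ∀ {p q} → p ∈ feet S P → q ∈ feet S P → p ≢ q → (∀ {z} → z ∈ feet S P → z ≡ p ⊎ z ≡ q) →
      Shape F U c L l w
    two-feet {p} {q} p∈ q∈ p≢q all
      with x , x∈ , px ← below S P p∈ | y , y∈ , qy ← below S P q∈ = cut
        (record
          { p∈ = p∈L ; q∈ = q∈L ; l∈ = l∈ ; x∉ = λ x∈L → disjoint x∈L x∈ ; y∉ = λ y∈L → disjoint y∈L y∈
          ; w∉ = w∉L ; p≢q = p≢q ; p≢l = foot≢exit S P p∈ q∈ (≢-sym p≢q) ; q≢l = foot≢exit S P q∈ p∈ p≢q
          ; px = px ; qy = qy ; lw = lw ; conn = piece-conn P ; conn∁ = piece-conn∁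
          ; exits = λ {u} {v} u∈ v∉ uv →
              [ (λ v∈F → Sum.map₂ inj₁ (only x∈ px y∈ qy u∈ v∈F uv)) , inj₂ ∘ inj₂ ]′ (exits u v u∈ v∉ uv) })
        (record { p∈ = p∈L ; q∈ = q∈L ; x∈ = x∈ ; y∈ = y∈ ; px = px ; qy = qy ; distinct = inj₁ p≢q
                ; only = only x∈ px y∈ qy })
      where
      p∈L : p ∈ L
      p∈L = feet⊆ S P p∈
      q∈L : q ∈ L
      q∈L = feet⊆ S P q∈
      only : ∀ {x y} → x ∈ F → Adj p x → y ∈ F → Adj q y →
        ∀ {u v} → u ∈ L → v ∈ F → Adj u v → (u ≡ p × v ≡ x) ⊎ (u ≡ q × v ≡ y)
      only x∈ px y∈ qy u∈ v∈ uv with all (∈-comprehension⁺ (foot? S P) (u∈ , _ , v∈ , uv))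
      ... | inj₁ refl = inj₁ (refl , unique-foot P p∈L q∈L (≢-sym p≢q) v∈ x∈ uv px)
      ... | inj₂ refl = inj₂ (refl , unique-foot P q∈L p∈L p≢q v∈ y∈ uv qy)

    shape : Shape F U c L l w
    shape with any? (λ t → t ∈? L ×-dec ¬? (t ≟ l))
    ... | no ¬t = single L⊆l (single-feet L⊆l)
      where
      L⊆l : L ⊆ ⁅ l ⁆
      L⊆l {t} t∈ with t ≟ l
      ... | yes refl = x∈⁅x⁆ l
      ... | no t≢l   = ⊥-elim (¬t (t , t∈ , t≢l))
    ... | yes (t , t∈ , t≢l) with p , q , p∈ , q∈ , p≢q ← second-foot t∈ t≢l
      with any? (λ z → z ∈? feet S P ×-dec ¬? (z ≟ p) ×-dec ¬? (z ≟ q))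
    ...   | yes (z , z∈ , z≢p , z≢q) =
      let h₁ , h₂ , conflict = conflicting-handles S P p∈ q∈ z∈ (≢-sym p≢q) z≢p (≢-sym z≢q)
      in fork h₁ h₂ conflict
    ...   | no ¬z = two-feet p∈ q∈ p≢q all
      where
      all : ∀ {z} → z ∈ feet S P → z ≡ p ⊎ z ≡ q
      all {z} z∈ with z ≟ p | z ≟ q
      ... | yes z≡p | _       = inj₁ z≡p
      ... | no _    | yes z≡q = inj₂ z≡q
      ... | no z≢p  | no z≢q  = ⊥-elim (¬z (z , z∈ , z≢p , z≢q))

    absorb-stage : c ∉ L → w ∈ U → TwoFeet F L → Stage (F ∪ L) (U ─ L) c w₀
    absorb-stage c∉ w∈ feet = record
      { disjoint = λ v∈ v∈FL → [ Stage.disjoint S (─⁻ˡ v∈) , ─⁻ʳ v∈ ]′ (∪⁻ v∈FL)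
      ; c∈ = ─⁺ (Stage.c∈ S) c∉
      ; cw₀ = Stage.cw₀ S
      ; w₀∉U = Stage.w₀∉U S ∘ ─⁻ˡ
      ; w₀∉F = λ w₀∈ → [ Stage.w₀∉F S , (λ w₀∈L → Stage.w₀∉U S (L⊆ w₀∈L)) ]′ (∪⁻ w₀∈)
      ; exits = ex
      ; connU = conn-from (λ u∈ → reach-sym (leave-piece S P c∉ w∈ u∈))
      ; connF = conn-∪ (Stage.connF S) (piece-conn P) x∈ p∈ (adj-sym px)
      ; conn∁ = conn-resp into onto (conn-∪ (Stage.conn∁ S) (piece-conn P)
                  (x∉p⇒x∈∁p (λ x∈U → Stage.disjoint S x∈U x∈)) p∈ (adj-sym px))
      }
      where
      open TwoFeet feet
      ex : Exits (F ∪ L) (U ─ L) c w₀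
      ex u v u∈ v∉ uv with v ∈? L
      ... | yes v∈L = inj₁ (∪ʳ v∈L)
      ... | no v∉L  = Sum.map₁ ∪ˡ (Stage.exits S u v (─⁻ˡ u∈) (λ v∈U → v∉ (─⁺ v∈U v∉L)) uv)
      into : ∁ U ∪ L ⊆ ∁ (U ─ L)
      into z∈ = x∉p⇒x∈∁p λ z∈U─L → [ (λ z∈∁ → x∈∁p⇒x∉p z∈∁ (─⁻ˡ z∈U─L)) , ─⁻ʳ z∈U─L ]′ (∪⁻ z∈)
      onto : ∁ (U ─ L) ⊆ ∁ U ∪ L
      onto {z} z∈ with z ∈? L
      ... | yes z∈L = ∪ʳ z∈L
      ... | no z∉L  = ∪ˡ (x∉p⇒x∈∁p λ z∈U → x∈∁p⇒x∉p z∈ (─⁺ z∈U z∉L))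

  handle-conn∁ : ∀ {U} (h : Handle U) → Conn (∁ U) → Conn (∁ (U ─ Handle.route h))
  handle-conn∁ {U} h conn = conn-resp into onto
    (conn-∪ conn route-conn (x∉p⇒x∈∁p x∉) p∈ (adj-sym px))
    where
    open Handle h
    into : ∁ U ∪ route ⊆ ∁ (U ─ route)
    into z∈ = x∉p⇒x∈∁p λ z∈U─Q → [ (λ z∈∁ → x∈∁p⇒x∉p z∈∁ (─⁻ˡ z∈U─Q)) , ─⁻ʳ z∈U─Q ]′ (∪⁻ z∈)
    onto : ∁ (U ─ route) ⊆ ∁ U ∪ route
    onto {z} z∈ with z ∈? route
    ... | yes z∈Q = ∪ʳ z∈Q
    ... | no z∉Q  = ∪ˡ (x∉p⇒x∈∁p λ z∈U → x∈∁p⇒x∉p z∈ (─⁺ z∈U z∉Q))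

  handle-stage : ∀ {F U c w₀} → Stage F U c w₀ → (h : StageHandle F U c) →
    Stage (F ∪ StageHandle.route h) (U ─ StageHandle.route h) c w₀
  handle-stage {F} {U} {c} {w₀} S h = record
    { disjoint = λ v∈ v∈FQ → [ Stage.disjoint S (─⁻ˡ v∈) , ─⁻ʳ v∈ ]′ (∪⁻ v∈FQ)
    ; c∈ = ─⁺ (Stage.c∈ S) c∉
    ; cw₀ = Stage.cw₀ S
    ; w₀∉U = Stage.w₀∉U S ∘ ─⁻ˡ
    ; w₀∉F = λ w₀∈ → [ Stage.w₀∉F S , (λ w₀∈Q → Stage.w₀∉U S (route⊆ w₀∈Q)) ]′ (∪⁻ w₀∈)
    ; exits = ex
    ; connU = rest
    ; connF = conn-∪ (Stage.connF S) route-conn x∈F p∈ (adj-sym px)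
    ; conn∁ = handle-conn∁ handle (Stage.conn∁ S)
    }
    where
    open StageHandle h
    ex : Exits (F ∪ route) (U ─ route) c w₀
    ex u v u∈ v∉ uv with v ∈? route
    ... | yes v∈Q = inj₁ (∪ʳ v∈Q)
    ... | no v∉Q  = Sum.map₁ ∪ˡ (Stage.exits S u v (─⁻ˡ u∈) (λ v∈U → v∉ (─⁺ v∈U v∉Q)) uv)

  -- The union `⊥ ∪ route` keeps the form `F ∪ route` of the other stages, with nothing treated
  -- before.
  cut-stage : ∀ {L p q l x y w} → ThreeCut L p q l x y w → (h : Handle L) →
    Handle.p h ≡ p → Handle.q h ≡ q → l ∉ Handle.route h →
    Stage (⊥ ∪ Handle.route h) (L ─ Handle.route h) l w
  cut-stage {L} {l = l} {w = w} C h p≡ q≡ l∉ = record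
    { disjoint = λ v∈ v∈Q → [ ∉⊥ , ─⁻ʳ v∈ ]′ (∪⁻ v∈Q)
    ; c∈ = ─⁺ C.l∈ l∉
    ; cw₀ = C.lw
    ; w₀∉U = C.w∉ ∘ ─⁻ˡ
    ; w₀∉F = λ w∈ → [ ∉⊥ , (λ w∈Q → C.w∉ (route⊆ w∈Q)) ]′ (∪⁻ w∈)
    ; exits = ex
    ; connU = rest
    ; connF = conn-resp ∪ʳ (λ z∈ → [ ⊥-elim ∘ ∉⊥ , id ]′ (∪⁻ z∈)) route-conn
    ; conn∁ = handle-conn∁ h C.conn∁
    }
    where
    open Handle h
    module C = ThreeCut C
    ex : Exits (⊥ ∪ route) (L ─ route) l w
    ex u v u∈ v∉ uv with v ∈? route
    ... | yes v∈Q = inj₁ (∪ʳ v∈Q)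
    ... | no v∉Q with C.exits (─⁻ˡ u∈) (λ v∈L → v∉ (─⁺ v∈L v∉Q)) uv
    ...   | inj₁ (u≡p , _)        = ⊥-elim (─⁻ʳ u∈ (subst (_∈ route) (trans p≡ (sym u≡p)) p∈))
    ...   | inj₂ (inj₁ (u≡q , _)) = ⊥-elim (─⁻ʳ u∈ (subst (_∈ route) (trans q≡ (sym u≡q)) q∈))
    ...   | inj₂ (inj₂ lw)        = inj₂ lw

-- Cubic 3-connected graphs

∣p∣≥4 : ∀ {n} (p : Subset n) {a b c d} → a ∈ p → b ∈ p → c ∈ p → d ∈ p →
  a ≢ b → a ≢ c → a ≢ d → b ≢ c → b ≢ d → c ≢ d → 4 ≤ ∣ p ∣
∣p∣≥4 p {a} {b} {c} {d} a∈ b∈ c∈ d∈ a≢b a≢c a≢d b≢c b≢d c≢d =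
  ≤-trans (s≤s (≤-trans (s≤s (≤-trans (s≤s (≤-trans (s≤s z≤n)
    (x∈p⇒∣p-x∣<∣p∣ {p = p ─ ⁅ a ⁆ ─ ⁅ b ⁆ ─ ⁅ c ⁆} d∈′)))
    (x∈p⇒∣p-x∣<∣p∣ {p = p ─ ⁅ a ⁆ ─ ⁅ b ⁆} c∈′)))
    (x∈p⇒∣p-x∣<∣p∣ {p = p ─ ⁅ a ⁆} b∈′)))
    (x∈p⇒∣p-x∣<∣p∣ {p = p} a∈)
  where
  without : ∀ {q : Subset _} {x y} → y ∈ q → x ≢ y → y ∈ q ─ ⁅ x ⁆
  without y∈ x≢y = ─⁺ y∈ (≢⇒∉⁅⁆ (≢-sym x≢y))
  b∈′ : b ∈ p ─ ⁅ a ⁆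
  b∈′ = without b∈ a≢b
  c∈′ : c ∈ p ─ ⁅ a ⁆ ─ ⁅ b ⁆
  c∈′ = without (without c∈ a≢c) b≢c
  d∈′ : d ∈ p ─ ⁅ a ⁆ ─ ⁅ b ⁆ ─ ⁅ c ⁆
  d∈′ = without (without (without d∈ a≢d) b≢d) c≢d

∣⁅x⁆∪p∣≤ : ∀ {n} (x : Fin n) (p : Subset n) → ∣ ⁅ x ⁆ ∪ p ∣ ≤ suc ∣ p ∣
∣⁅x⁆∪p∣≤ x p = ≤-trans (∣p∪q∣≤∣p∣+∣q∣ ⁅ x ⁆ p) (≤-reflexive (cong (_+ ∣ p ∣) (∣⁅x⁆∣≡1 x)))

∣⁅x⁆∪⁅y⁆∣≤2 : ∀ {n} (x y : Fin n) → ∣ ⁅ x ⁆ ∪ ⁅ y ⁆ ∣ ≤ 2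
∣⁅x⁆∪⁅y⁆∣≤2 x y = ≤-trans (∣⁅x⁆∪p∣≤ x ⁅ y ⁆) (s≤s (≤-reflexive (∣⁅x⁆∣≡1 y)))

module Simple (G : Graph) (κ : IsKConnected 3 G) (cubicG : IsCubic G) where
  open Graph G using (ends; Joins; degree)

  Adj : Vertex G → Vertex G → Set
  Adj u v = ∃[ e ] Joins e u v

  abstract
    ends? : ∀ e u v → Dec (ends e ≡ (u , v))
    ends? e u v with ends e
    ... | a , b = Dec.map′ (λ (p , q) → cong₂ _,_ p q) (λ { refl → refl , refl }) (a ≟ u ×-dec b ≟ v)

    adj? : ∀ u v → Dec (Adj u v)
    adj? u v = any? (λ e → ends? e u v ⊎-dec ends? e v u)

    joins-sym : ∀ {e u v} → Joins e u v → Joins e v u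
    joins-sym = Sum.swap

    adj-sym : ∀ {u v} → Adj u v → Adj v u
    adj-sym (e , j) = e , joins-sym j

    joins-functional : ∀ {e v a b} → Joins e v a → Joins e v b → a ≡ b
    joins-functional (inj₁ p) (inj₁ q) with refl ← trans (sym p) q = refl
    joins-functional (inj₁ p) (inj₂ q) with refl ← trans (sym p) q = refl
    joins-functional (inj₂ p) (inj₁ q) with refl ← trans (sym p) q = refl
    joins-functional (inj₂ p) (inj₂ q) with refl ← trans (sym p) q = refl

    edges-differ : ∀ {e f v a b} → Joins e v a → Joins f v b → a ≢ b → e ≢ f
    edges-differ j k a≢b refl = a≢b (joins-functional j k)

    starts? : ∀ v → Decidable (λ e → proj₁ (ends e) ≡ v)
    starts? v e = proj₁ (ends e) ≟ v

    stops? : ∀ v → Decidable (λ e → proj₂ (ends e) ≡ v)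
    stops? v e = proj₂ (ends e) ≟ v

    incident : Vertex G → Subset (size G)
    incident v = comprehension (starts? v) ∪ comprehension (stops? v)

    joins⇒incident : ∀ {e v a} → Joins e v a → e ∈ incident v
    joins⇒incident {v = v} (inj₁ p) = ∪ˡ (∈-comprehension⁺ (starts? v) (cong proj₁ p))
    joins⇒incident {v = v} (inj₂ p) = ∪ʳ (∈-comprehension⁺ (stops? v) (cong proj₂ p))

    -- `degree` adds the counts of first and second ends, so it bounds the set of incident edges
    -- even if loops are present.
    at-most-three-edges : ∀ {v a b c d e f g h} → Joins e v a → Joins f v b → Joins g v c → Joins h v d →
      e ≢ f → e ≢ g → e ≢ h → f ≢ g → f ≢ h → g ≢ h → Empty.⊥
    at-most-three-edges {v} je jf jg jh e≢f e≢g e≢h f≢g f≢h g≢h = <⇒≱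
      (∣p∣≥4 (incident v) (joins⇒incident je) (joins⇒incident jf) (joins⇒incident jg) (joins⇒incident jh)
        e≢f e≢g e≢h f≢g f≢h g≢h)
      (≤-trans (∣p∪q∣≤∣p∣+∣q∣ (comprehension (starts? v)) (comprehension (stops? v))) (≤-reflexive (cubicG v)))

    walk-exit : ∀ {Z X u v} → Walk (deleteVertices G Z) u v → u ∈ X → v ∉ X →
      ∃[ a ] ∃[ b ] a ∈ X × b ∉ X × Adj a b × b ∈ ∁ Z
    walk-exit [] u∈ u∉ = ⊥-elim (u∉ u∈)
    walk-exit {Z} {X} (step {y = y} e e∈ j w) u∈ v∉ with y ∈? X
    ... | yes y∈ = walk-exit w y∈ v∉
    ... | no y∉  = _ , y , u∈ , y∉ , (e , j) , head∈ j
      where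
      head∈ : ∀ {x} → Joins e x y → y ∈ ∁ Z
      head∈ (inj₁ p) = subst (_∈ ∁ Z) (cong proj₂ p) (proj₂ (Subgraph.closed (deleteVertices G Z) e∈))
      head∈ (inj₂ p) = subst (_∈ ∁ Z) (cong proj₁ p) (proj₁ (Subgraph.closed (deleteVertices G Z) e∈))

    -- Only those of a and b that lie outside X are deleted, so x survives. An edge of the remaining
    -- graph that leaves X has its head off a and b.
    three-connected : ∀ X {x y} a b → x ∈ X → y ∉ X → y ≢ a → y ≢ b →
      ∃[ u ] ∃[ v ] u ∈ X × v ∉ X × Adj u v × v ≢ a × v ≢ b
    three-connected X {x} {y} a b x∈ y∉ y≢a y≢b =
      let u , v , u∈ , v∉ , uv , v∈ = walk-exit (proj₂ (proj₂ κ Z (s≤s ∣Z∣≤2)) x∈∁ y∈∁) x∈ y∉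
      in u , v , u∈ , v∉ , uv
         , (λ v≡a → x∈∁p⇒x∉p v∈ (─⁺ (∪ˡ (≡⇒∈⁅⁆ v≡a)) v∉))
         , (λ v≡b → x∈∁p⇒x∉p v∈ (─⁺ (∪ʳ (≡⇒∈⁅⁆ v≡b)) v∉))
      where
      Z : Subset (order G)
      Z = (⁅ a ⁆ ∪ ⁅ b ⁆) ─ X
      ∣Z∣≤2 : ∣ Z ∣ ≤ 2
      ∣Z∣≤2 = ≤-trans (∣p─q∣≤∣p∣ (⁅ a ⁆ ∪ ⁅ b ⁆) X) (∣⁅x⁆∪⁅y⁆∣≤2 a b)
      x∈∁ : x ∈ ∁ Z
      x∈∁ = x∉p⇒x∈∁p λ x∈Z → ─⁻ʳ x∈Z x∈
      y∈∁ : y ∈ ∁ Z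
      y∈∁ = x∉p⇒x∈∁p λ y∈Z → [ y≢a ∘ ∈⁅⁆⁻ , y≢b ∘ ∈⁅⁆⁻ ]′ (∪⁻ (─⁻ˡ y∈Z))

    fourth-vertex : (a b c : Vertex G) → ∃[ y ] y ≢ a × y ≢ b × y ≢ c
    fourth-vertex a b c with any? (λ y → ¬? (y ≟ a) ×-dec ¬? (y ≟ b) ×-dec ¬? (y ≟ c))
    ... | yes h = h
    ... | no ¬h = ⊥-elim (<⇒≱ (proj₁ κ) (≤-trans (≤-reflexive (sym (∣⊤∣≡n (order G))))
            (≤-trans (p⊆q⇒∣p∣≤∣q∣ {p = ⊤ {order G}} all) (≤-trans (∣⁅x⁆∪p∣≤ a _) (s≤s (∣⁅x⁆∪⁅y⁆∣≤2 b c))))))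
      where
      all : ⊤ ⊆ ⁅ a ⁆ ∪ (⁅ b ⁆ ∪ ⁅ c ⁆)
      all {y} _ with y ≟ a | y ≟ b | y ≟ c
      ... | yes refl | _ | _ = ∪ˡ (x∈⁅x⁆ y)
      ... | no _ | yes refl | _ = ∪ʳ (∪ˡ (x∈⁅x⁆ y))
      ... | no _ | no _ | yes refl = ∪ʳ (∪ʳ (x∈⁅x⁆ y))
      ... | no y≢a | no y≢b | no y≢c = ⊥-elim (¬h (y , y≢a , y≢b , y≢c))

    proper-neighbour : ∀ v a b → ∃[ s ] Adj v s × s ≢ v × s ≢ a × s ≢ b
    proper-neighbour v a b =
      let y , y≢v , y≢a , y≢b = fourth-vertex v a b
          u , s , u∈ , s∉ , us , s≢a , s≢b = three-connected ⁅ v ⁆ a b (x∈⁅x⁆ v) (≢⇒∉⁅⁆ y≢v) y≢a y≢b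
      in s , subst (λ z → Adj z s) (∈⁅⁆⁻ u∈) us , s∉ ∘ ≡⇒∈⁅⁆ , s≢a , s≢b

    third-neighbour : ∀ v a b → ∃[ s ] Adj v s × s ≢ a × s ≢ b
    third-neighbour v a b = let s , vs , _ , s≢ = proper-neighbour v a b in s , vs , s≢

    irreflexive : ∀ {v} → ¬ Adj v v
    irreflexive {v} (e , j) =
      let a , (f , jf) , a≢v , _        = proper-neighbour v v v
          b , (g , jg) , b≢v , b≢a , _  = proper-neighbour v a a
          c , (h , jh) , c≢v , c≢a , c≢b = proper-neighbour v a b
      in at-most-three-edges j jf jg jh
           (edges-differ j jf (≢-sym a≢v)) (edges-differ j jg (≢-sym b≢v)) (edges-differ j jh (≢-sym c≢v))
           (edges-differ jf jg (≢-sym b≢a)) (edges-differ jf jh (≢-sym c≢a)) (edges-differ jg jh (≢-sym c≢b))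

    edge-unique : ∀ {e f u v} → Joins e u v → Joins f u v → e ≡ f
    edge-unique {e} {f} {u} {v} je jf with e ≟ f
    ... | yes e≡f = e≡f
    ... | no e≢f =
      let b , (g , jg) , b≢v , _   = third-neighbour u v v
          c , (h , jh) , c≢v , c≢b = third-neighbour u v b
      in ⊥-elim (at-most-three-edges je jf jg jh e≢f
           (edges-differ je jg (≢-sym b≢v)) (edges-differ je jh (≢-sym c≢v))
           (edges-differ jf jg (≢-sym b≢v)) (edges-differ jf jh (≢-sym c≢v))
           (edges-differ jg jh (≢-sym c≢b)))

    cubic : ∀ {v a b c u} → a ≢ b → a ≢ c → b ≢ c → Adj v a → Adj v b → Adj v c → Adj v u →
      u ≡ a ⊎ u ≡ b ⊎ u ≡ c
    cubic {a = a} {b} {c} {u} a≢b a≢c b≢c (e , je) (f , jf) (g , jg) (h , jh) with u ≟ a | u ≟ b | u ≟ c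
    ... | yes u≡a | _ | _ = inj₁ u≡a
    ... | no _ | yes u≡b | _ = inj₂ (inj₁ u≡b)
    ... | no _ | no _ | yes u≡c = inj₂ (inj₂ u≡c)
    ... | no u≢a | no u≢b | no u≢c = ⊥-elim (at-most-three-edges je jf jg jh
      (edges-differ je jf a≢b) (edges-differ je jg a≢c) (edges-differ je jh (≢-sym u≢a))
      (edges-differ jf jg b≢c) (edges-differ jf jh (≢-sym u≢b)) (edges-differ jg jh (≢-sym u≢c)))

  open Pieces Adj adj? adj-sym irreflexive cubic third-neighbour three-connected public

  abstract
    E : Subset (order G) → Subset (size G)
    E W = edges (induced G W)

    E⁺ : ∀ {W e u v} → Joins e u v → u ∈ W → v ∈ W → e ∈ E W
    E⁺ {W} {e} (inj₁ p) u∈ v∈ = lookup⇒[]= e _ (trans (lookup∘tabulate _ e)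
      (cong₂ _∧_ (trans (cong (lookup W ∘ proj₁) p) ([]=⇒lookup u∈))
                 (trans (cong (lookup W ∘ proj₂) p) ([]=⇒lookup v∈))))
    E⁺ {W} {e} (inj₂ p) u∈ v∈ = lookup⇒[]= e _ (trans (lookup∘tabulate _ e)
      (cong₂ _∧_ (trans (cong (lookup W ∘ proj₁) p) ([]=⇒lookup v∈))
                 (trans (cong (lookup W ∘ proj₂) p) ([]=⇒lookup u∈))))

    E⁻ : ∀ {W e u v} → Joins e u v → e ∈ E W → u ∈ W × v ∈ W
    E⁻ {W} (inj₁ p) e∈ = let a , b = Subgraph.closed (induced G W) e∈ in
      subst (_∈ W) (cong proj₁ p) a , subst (_∈ W) (cong proj₂ p) b
    E⁻ {W} (inj₂ p) e∈ = let a , b = Subgraph.closed (induced G W) e∈ in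
      subst (_∈ W) (cong proj₂ p) b , subst (_∈ W) (cong proj₁ p) a

    E≡ : ∀ W → E W ≡ edges (induced G W)
    E≡ W = refl

  E-mono : ∀ {W X} → W ⊆ X → E W ⊆ E X
  E-mono W⊆X {e} e∈ = let a , b = E⁻ (inj₁ refl) e∈ in E⁺ (inj₁ refl) (W⊆X a) (W⊆X b)

  -- Cycles and closures

  path-loop : ∀ {S u v} → Path S u v → u ≡ v → S ⊆ ⁅ u ⁆
  path-loop [ u ]         _    = id
  path-loop (cons u∉ _ π) refl = ⊥-elim (u∉ (path-target π))

  record Trail (H : Subgraph G) (S : Subset (order G)) (u z : Vertex G) : Set where
    field
      walk       : Walk H u z
      before-end : All (λ v → v ∈ S × v ≢ z) (departures walk)
      vertices   : Unique (departures walk)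
      edges∈     : All (_∈ E S) (edgeList walk)
      edges!     : Unique (edgeList walk)
      long       : ∣ S ∣ ≤ suc (length (edgeList walk))

  path⇒trail : ∀ {H S u z} → E S ⊆ edges H → Path S u z → Trail H S u z
  path⇒trail _ [ u ] = record
    { walk = [] ; before-end = [] ; vertices = [] ; edges∈ = [] ; edges! = []
    ; long = ≤-reflexive (∣⁅x⁆∣≡1 u) }
  path⇒trail ES⊆ (cons {u} {S} u∉ (e , j) π) = record
    { walk       = step e (ES⊆ e∈) j walk
    ; before-end = (∪ˡ (x∈⁅x⁆ u) , (λ u≡z → u∉ (subst (_∈ S) (sym u≡z) (path-target π))))
                   ∷ All.map (λ (v∈ , v≢z) → ∪ʳ v∈ , v≢z) before-end
    ; vertices   = All.map (λ (v∈ , _) u≡v → u∉ (subst (_∈ S) (sym u≡v) v∈)) before-end ∷ vertices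
    ; edges∈     = e∈ ∷ All.map (E-mono ∪ʳ) edges∈
    ; edges!     = All.map (λ f∈ e≡f → u∉ (proj₁ (E⁻ j (subst (_∈ E S) (sym e≡f) f∈)))) edges∈ ∷ edges!
    ; long       = ≤-trans (∣⁅x⁆∪p∣≤ u S) (s≤s long)
    }
    where
    open Trail (path⇒trail (ES⊆ ∘ E-mono ∪ʳ) π)
    e∈ : e ∈ E (⁅ u ⁆ ∪ S)
    e∈ = E⁺ j (∪ˡ (x∈⁅x⁆ u)) (∪ʳ (path-source π))

  -- The third vertex m prevents the path from being the closing edge itself, run in the other
  -- direction.
  closing-edge-new : ∀ {H S u z e m} (ES⊆ : E S ⊆ edges H) (π : Path S u z) → Joins e z u →
    m ∈ S → m ≢ u → m ≢ z → All (e ≢_) (edgeList (Trail.walk (path⇒trail {H} ES⊆ π)))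
  closing-edge-new ES⊆ [ u ] j m∈ m≢u m≢z = []
  closing-edge-new {e = e} ES⊆ (cons {u} {S} u∉ (f , k) π) j m∈ m≢u m≢z =
    e≢f ∷ All.map (λ g∈ e≡g → u∉ (proj₂ (E⁻ j (subst (_∈ E S) (sym e≡g) g∈))))
            (Trail.edges∈ (path⇒trail (ES⊆ ∘ E-mono ∪ʳ) π))
    where
    e≢f : e ≢ f
    e≢f refl with refl ← joins-functional (joins-sym j) k =
      [ m≢u ∘ ∈⁅⁆⁻ , (λ m∈S → m≢z (∈⁅⁆⁻ (path-loop π refl m∈S))) ]′ (∪⁻ m∈)

  ⋃⁻ : ∀ {n} {P : Pred (Fin n) 0ℓ} {es} → All P es → ∀ {x} → x ∈ ⋃ (map ⁅_⁆ es) → P x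
  ⋃⁻ []       x∈ = ⊥-elim (∉⊥ x∈)
  ⋃⁻ {P = P} (p ∷ ps) x∈ = [ (λ x∈e → subst P (sym (∈⁅⁆⁻ x∈e)) p) , ⋃⁻ ps ]′ (∪⁻ x∈)

  path⇒cycle : ∀ {H S u z e m} → E S ⊆ edges H → Path S u z → Joins e z u →
    m ∈ S → m ≢ u → m ≢ z →
    ∃[ C ] e ∈ cycleEdges {G} {H} C × cycleEdges C ⊆ E S × ∣ S ∣ ≤ cycleLength C
  path⇒cycle {H} {S} {u} {z} {e} ES⊆ π j m∈ m≢u m≢z = record
      { walk = step e (ES⊆ e∈) j walk
      ; nontrivial = s≤s z≤n
      ; distinct-vertices = All.map (λ (_ , v≢z) → ≢-sym v≢z) before-end ∷ vertices
      ; distinct-edges = closing-edge-new ES⊆ π j m∈ m≢u m≢z ∷ edges!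
      }
    , ∪ˡ (x∈⁅x⁆ e)
    , ⋃⁻ (e∈ ∷ edges∈)
    , long
    where
    open Trail (path⇒trail {H} ES⊆ π)
    e∈ : e ∈ E S
    e∈ = E⁺ j (path-target π) (path-source π)

  reach⇒walk : ∀ {H W u v} → E W ⊆ edges H → Reach W u v → Walk H u v
  reach⇒walk _   (here _)             = []
  reach⇒walk EW⊆ (step u∈ (e , j) r) = step e (EW⊆ (E⁺ j u∈ (reach-source r))) j (reach⇒walk EW⊆ r)

  _++ʷ_ : ∀ {H u v z} → Walk {G} H u v → Walk H v z → Walk H u z
  []            ++ʷ w′ = w′
  step e e∈ j w ++ʷ w′ = step e e∈ j (w ++ʷ w′)

  path-++ : ∀ {S T u v y z} → Path S u v → (∀ {x} → x ∈ S → x ∉ T) → Adj v y → Path T y z →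
    Path (S ∪ T) u z
  path-++ [ u ] S∩T vy π = cons (S∩T (x∈⁅x⁆ u)) vy π
  path-++ {T = T} (cons {u} {S} u∉ uv π′) S∩T vy π =
    subst (λ R → Path R u _) (sym (∪-assoc ⁅ u ⁆ S T))
      (cons (λ u∈ → [ u∉ , S∩T (∪ˡ (x∈⁅x⁆ u)) ]′ (∪⁻ u∈)) uv (path-++ π′ (S∩T ∘ ∪ʳ) vy π))

  path-reverse : ∀ {S u z} → Path S u z → Path S z u
  path-reverse [ u ] = [ u ]
  path-reverse (cons {u} {S} u∉ uv π) = subst (λ R → Path R _ u) (∪-comm S ⁅ u ⁆)
    (path-++ (path-reverse π) (λ x∈S x∈u → u∉ (subst (_∈ S) (∈⁅⁆⁻ x∈u) x∈S)) (adj-sym uv) [ u ])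

  Peripheral≤ : ℕ → Set
  Peripheral≤ q = (C : Cycle (whole G)) → IsPeripheral G (cycleEdges C) → cycleLength C ≤ q

  -- The cycle formed by the route and its return path is peripheral: each of its vertices has a
  -- neighbour in the connected rest M, by an edge that is kept. The additional 1 accounts for x on
  -- the return path.
  handle-short : ∀ {q U} → Peripheral≤ q → (h : Handle U) → Conn (∁ U) → suc ∣ Handle.route h ∣ ≤ q
  handle-short {q} {U} per h conn∁ =
    let e , j = px
        C , _ , C⊆ , long = path⇒cycle {whole G} (λ _ → ∈⊤)
          (path-++ path off-route (subst (Adj _) (sym end≡y) qy) (path-reverse N.path))
          (joins-sym j) (∪ˡ q∈) (≢-sym p≢q) (∈∧∉⇒≢ (route⊆ q∈) x∉)
    in ≤-trans (∣∣-mono-< route (route ∪ N.route) ∪ˡ (∪ʳ (path-source N.path)) (x∉ ∘ route⊆))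
         (≤-trans long (per C ((p , ∈⊤) , λ {u} {v} _ _ → linked C⊆ u v)))
    where
    open Handle h
    module N = Ear (peripheral-return h (conn∁ (x∉p⇒x∈∁p x∉) (x∉p⇒x∈∁p y∉)))

    end≡y : N.end ≡ y
    end≡y = ∈⁅⁆⁻ N.end∈

    off-route : ∀ {v} → v ∈ route → v ∉ N.route
    off-route v∈ v∈N = x∈∁p⇒x∉p (N.route⊆ v∈N) v∈

    M : Subset (order G)
    M = ∁ route ─ N.route

    off-M : ∀ {v} → v ∈ M → v ∉ route ∪ N.route
    off-M v∈M v∈ = [ x∈∁p⇒x∉p (─⁻ˡ v∈M) , ─⁻ʳ v∈M ]′ (∪⁻ v∈)

    anchor : ∀ v → v ∈ M ⊎ ∃[ m ] m ∈ M × Adj v m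
    anchor v with v ∈? route | v ∈? N.route
    ... | yes v∈ | _      = let m , m∈ , vm = attached v∈ in inj₂ (m , N.base⊆ m∈ , vm)
    ... | no _   | yes v∈ = inj₂ (N.attached v∈)
    ... | no v∉  | no v∉N = inj₁ (─⁺ (x∉p⇒x∈∁p v∉) v∉N)

    module _ {B : Subset (size G)} (B⊆ : B ⊆ E (route ∪ N.route)) where
      kept : ∀ {e v m} → Joins e v m → m ∈ M → e ∈ ∁ B
      kept j m∈ = x∉p⇒x∈∁p (λ e∈B → off-M m∈ (proj₂ (E⁻ j (B⊆ e∈B))))

      to-M : ∀ v → ∃[ m ] m ∈ M × Walk (deleteEdges G B) v m × Walk (deleteEdges G B) m v
      to-M v with anchor v
      ... | inj₁ v∈ = v , v∈ , [] , []
      ... | inj₂ (m , m∈ , e , j) =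
        m , m∈ , step e (kept j m∈) j [] , step e (kept j m∈) (joins-sym j) []

      linked : ∀ u v → Walk (deleteEdges G B) u v
      linked u v =
        let a , a∈ , ua , _ = to-M u
            b , b∈ , _ , bv = to-M v
        in ua ++ʷ (reach⇒walk (λ e∈ → kept (inj₁ refl) (proj₂ (E⁻ (inj₁ refl) e∈))) (N.rest a∈ b∈) ++ʷ bv)

  -- The cycle condition of `Admissible` for k = 2.
  Closed : Subgraph G → Subset (size G) → Set
  Closed H R = (C : Cycle H) → Nonempty (cycleEdges C ─ R) → 3 ≤ ∣ cycleEdges C ─ R ∣

  closing-edge∈ : ∀ {H R S u z e m f g} → Closed H R → E S ⊆ edges H → Path S u z → Joins e z u →
    m ∈ S → m ≢ u → m ≢ z → (∀ {d} → d ∈ E S → d ∈ R ⊎ d ≡ f ⊎ d ≡ g) → e ∈ R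
  closing-edge∈ {H} {R} {e = e} {f = f} {g} closed ES⊆ π j m∈ m≢u m≢z only with e ∈? R
  ... | yes e∈ = e∈
  ... | no e∉ with C , e∈C , C⊆ , _ ← path⇒cycle {H} ES⊆ π j m∈ m≢u m≢z =
    ⊥-elim (<⇒≱ (closed C (e , ─⁺ e∈C e∉))
      (≤-trans (p⊆q⇒∣p∣≤∣q∣ {p = cycleEdges C ─ R} {q = ⁅ f ⁆ ∪ ⁅ g ⁆} two) (∣⁅x⁆∪⁅y⁆∣≤2 f g)))
    where
    two : ∀ {d} → d ∈ cycleEdges C ─ R → d ∈ ⁅ f ⁆ ∪ ⁅ g ⁆
    two d∈ with only (C⊆ (─⁻ˡ d∈))
    ... | inj₁ d∈R        = ⊥-elim (─⁻ʳ d∈ d∈R)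
    ... | inj₂ (inj₁ d≡f) = ∪ˡ (≡⇒∈⁅⁆ d≡f)
    ... | inj₂ (inj₂ d≡g) = ∪ʳ (≡⇒∈⁅⁆ d≡g)

  swap-feet : ∀ {F L} → TwoFeet F L → TwoFeet F L
  swap-feet f = record
    { p∈ = q∈ ; q∈ = p∈ ; x∈ = y∈ ; y∈ = x∈ ; px = qy ; qy = px
    ; distinct = Sum.map ≢-sym ≢-sym distinct ; only = λ u∈ v∈ uv → Sum.swap (only u∈ v∈ uv) }
    where open TwoFeet f

  module _ {H R F L} (closed : Closed H R) (⊆H : E (F ∪ L) ⊆ edges H) (connF : Conn F) (connL : Conn L)
    (L∩F : ∀ {v} → v ∈ L → v ∉ F) (EF⊆ : E F ⊆ R) (EL⊆ : E L ⊆ R) where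

    foot-edge : (t : TwoFeet F L) → let open TwoFeet t in
      ∀ {d u v} → u ∈ L → v ∈ F → Joins d u v → d ≡ proj₁ px ⊎ d ≡ proj₁ qy
    foot-edge t u∈ v∈ j with TwoFeet.only t u∈ v∈ (_ , j)
    ... | inj₁ (refl , refl) = inj₁ (edge-unique j (proj₂ (TwoFeet.px t)))
    ... | inj₂ (refl , refl) = inj₂ (edge-unique j (proj₂ (TwoFeet.qy t)))

    sort-edge : (t : TwoFeet F L) → let open TwoFeet t in
      ∀ {d} → d ∈ E (F ∪ L) → d ∈ R ⊎ d ≡ proj₁ px ⊎ d ≡ proj₁ qy
    sort-edge t d∈ with E⁻ (inj₁ refl) d∈
    ... | a∈ , b∈ with ∪⁻ a∈ | ∪⁻ b∈
    ...   | inj₁ a∈F | inj₁ b∈F = inj₁ (EF⊆ (E⁺ (inj₁ refl) a∈F b∈F))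
    ...   | inj₂ a∈L | inj₂ b∈L = inj₁ (EL⊆ (E⁺ (inj₁ refl) a∈L b∈L))
    ...   | inj₁ a∈F | inj₂ b∈L = inj₂ (foot-edge t b∈L a∈F (inj₂ refl))
    ...   | inj₂ a∈L | inj₁ b∈F = inj₂ (foot-edge t a∈L b∈F (inj₁ refl))

    -- A path from p to q in L and one from y to x in F close up with the two linking edges. All
    -- other edges are in R, so at most two are missing, while `Closed` asks for three.
    foot-edge∈ : (t : TwoFeet F L) → proj₁ (TwoFeet.px t) ∈ R
    foot-edge∈ t =
      let S₁ , S₁⊆ , π₁ = reach⇒path (connL p∈ q∈)
          S₂ , S₂⊆ , π₂ = reach⇒path (connF y∈ x∈)
          inside = ∪-least (∪ʳ ∘ S₁⊆) (∪ˡ ∘ S₂⊆)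
          m , m∈ , m≢p , m≢x = middle π₁ π₂ distinct
      in closing-edge∈ closed (⊆H ∘ E-mono inside)
           (path-++ π₁ (λ v∈ v∈′ → L∩F (S₁⊆ v∈) (S₂⊆ v∈′)) qy π₂) (joins-sym (proj₂ px))
           m∈ m≢p m≢x (sort-edge t ∘ E-mono inside)
      where
      open TwoFeet t
      middle : ∀ {S₁ S₂} → Path S₁ p q → Path S₂ y x → p ≢ q ⊎ x ≢ y →
        ∃[ m ] m ∈ S₁ ∪ S₂ × m ≢ p × m ≢ x
      middle π₁ π₂ (inj₁ p≢q) = q , ∪ˡ (path-target π₁) , ≢-sym p≢q , ≢-sym (λ { refl → L∩F q∈ x∈ })
      middle π₁ π₂ (inj₂ x≢y) = y , ∪ʳ (path-source π₂) , (λ { refl → L∩F p∈ y∈ }) , ≢-sym x≢y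

    joined∈ : TwoFeet F L → E (F ∪ L) ⊆ R
    joined∈ t d∈ with sort-edge t d∈
    ... | inj₁ d∈R         = d∈R
    ... | inj₂ (inj₁ refl) = foot-edge∈ t
    ... | inj₂ (inj₂ refl) = foot-edge∈ (swap-feet t)

  handle⇒feet : ∀ {F U c} → (∀ {v} → v ∈ U → v ∉ F) → (h : StageHandle F U c) → TwoFeet F (StageHandle.route h)
  handle⇒feet U∩F h = record
    { p∈ = p∈ ; q∈ = q∈ ; x∈ = x∈F ; y∈ = y∈F ; px = px ; qy = qy ; distinct = inj₁ p≢q
    ; only = λ u∈ v∈F → outward u∈ (λ v∈U → U∩F v∈U v∈F) }
    where open StageHandle h

  remove-one-exit : ∀ {U v x} → Adj v x → x ∉ U → ∣ E U ∣ ≤ suc (suc ∣ E (U ─ ⁅ v ⁆) ∣)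
  remove-one-exit {U} {v} {x} vx x∉ =
    let b , (f , jf) , b≢x , _   = third-neighbour v x x
        c , (g , jg) , c≢x , c≢b = third-neighbour v x b
    in ≤-trans (p⊆q⇒∣p∣≤∣q∣ {p = E U} {q = ⁅ f ⁆ ∪ (⁅ g ⁆ ∪ E (U ─ ⁅ v ⁆))}
                 (split (≢-sym b≢x) (≢-sym c≢x) (≢-sym c≢b) jf jg))
         (≤-trans (∣⁅x⁆∪p∣≤ f _) (s≤s (∣⁅x⁆∪p∣≤ g _)))
    where
    at-v : ∀ {b c f g d a} → x ≢ b → x ≢ c → b ≢ c → Joins f v b → Joins g v c →
      Joins d v a → a ∈ U → d ≡ f ⊎ d ≡ g
    at-v x≢b x≢c b≢c jf jg j a∈ with cubic x≢b x≢c b≢c vx (_ , jf) (_ , jg) (_ , j)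
    ... | inj₁ refl        = ⊥-elim (x∉ a∈)
    ... | inj₂ (inj₁ refl) = inj₁ (edge-unique j jf)
    ... | inj₂ (inj₂ refl) = inj₂ (edge-unique j jg)

    split : ∀ {b c f g} → x ≢ b → x ≢ c → b ≢ c → Joins f v b → Joins g v c →
      E U ⊆ ⁅ f ⁆ ∪ (⁅ g ⁆ ∪ E (U ─ ⁅ v ⁆))
    split x≢b x≢c b≢c jf jg {d} d∈ with E⁻ (inj₁ refl) d∈
    ... | a∈ , a′∈ with proj₁ (ends d) ≟ v | proj₂ (ends d) ≟ v
    ...   | no a≢v | no a′≢v =
      ∪ʳ (∪ʳ (E⁺ (inj₁ refl) (─⁺ a∈ (≢⇒∉⁅⁆ a≢v)) (─⁺ a′∈ (≢⇒∉⁅⁆ a′≢v))))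
    ...   | yes a≡v | _ = [ ∪ˡ ∘ ≡⇒∈⁅⁆ , ∪ʳ ∘ ∪ˡ ∘ ≡⇒∈⁅⁆ ]′
      (at-v x≢b x≢c b≢c jf jg (inj₁ (cong (_, proj₂ (ends d)) a≡v)) a′∈)
    ...   | no _ | yes a′≡v = [ ∪ˡ ∘ ≡⇒∈⁅⁆ , ∪ʳ ∘ ∪ˡ ∘ ≡⇒∈⁅⁆ ]′
      (at-v x≢b x≢c b≢c jf jg (inj₂ (cong (proj₁ (ends d) ,_) a′≡v)) a∈)

  -- Counting edges and growing trees

  remove-two-exits : ∀ {U v x y} → x ≢ y → Adj v x → x ∉ U → Adj v y → y ∉ U →
    ∣ E U ∣ ≤ suc ∣ E (U ─ ⁅ v ⁆) ∣
  remove-two-exits {U} {v} {x} {y} x≢y vx x∉ vy y∉ =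
    let c , (g , jg) , c≢x , c≢y = third-neighbour v x y
    in ≤-trans (p⊆q⇒∣p∣≤∣q∣ {p = E U} {q = ⁅ g ⁆ ∪ E (U ─ ⁅ v ⁆)} (split c≢x c≢y jg))
         (∣⁅x⁆∪p∣≤ g _)
    where
    at-v : ∀ {c g d a} → c ≢ x → c ≢ y → Joins g v c → Joins d v a → a ∈ U → d ≡ g
    at-v c≢x c≢y jg j a∈ with cubic x≢y (≢-sym c≢x) (≢-sym c≢y) vx vy (_ , jg) (_ , j)
    ... | inj₁ refl        = ⊥-elim (x∉ a∈)
    ... | inj₂ (inj₁ refl) = ⊥-elim (y∉ a∈)
    ... | inj₂ (inj₂ refl) = edge-unique j jg

    split : ∀ {c g} → c ≢ x → c ≢ y → Joins g v c → E U ⊆ ⁅ g ⁆ ∪ E (U ─ ⁅ v ⁆)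
    split c≢x c≢y jg {d} d∈ with E⁻ (inj₁ refl) d∈
    ... | a∈ , a′∈ with proj₁ (ends d) ≟ v | proj₂ (ends d) ≟ v
    ...   | no a≢v | no a′≢v = ∪ʳ (E⁺ (inj₁ refl) (─⁺ a∈ (≢⇒∉⁅⁆ a≢v)) (─⁺ a′∈ (≢⇒∉⁅⁆ a′≢v)))
    ...   | yes a≡v | _ = ∪ˡ (≡⇒∈⁅⁆ (at-v c≢x c≢y jg (inj₁ (cong (_, proj₂ (ends d)) a≡v)) a′∈))
    ...   | no _ | yes a′≡v = ∪ˡ (≡⇒∈⁅⁆ (at-v c≢x c≢y jg (inj₂ (cong (proj₁ (ends d) ,_) a′≡v)) a∈))

  -- Deleting the vertices of the path one by one, each has a neighbour that is
  -- already gone, and the last one has two.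
  path-removal : ∀ {S U u z x y} → Path S u z → S ⊆ U → Adj u x → x ∉ U → Adj z y → y ∉ U →
    (u ≡ z → x ≢ y) → suc ∣ E U ∣ ≤ ∣ E (U ─ S) ∣ + (∣ S ∣ + ∣ S ∣)
  path-removal {U = U} [ u ] S⊆ ux x∉ zy y∉ x≢y =
    subst (λ k → suc ∣ E U ∣ ≤ ∣ E (U ─ ⁅ u ⁆) ∣ + (k + k)) (sym (∣⁅x⁆∣≡1 u))
      (≤-trans (s≤s (remove-two-exits (x≢y refl) ux x∉ zy y∉)) (≤-reflexive (+-comm 2 _)))
  path-removal {U = U} {x = x} (cons {u} {S} u∉ uv π) S⊆ ux x∉ zy y∉ _ = begin
    suc ∣ E U ∣
      ≤⟨ s≤s (remove-one-exit ux x∉) ⟩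
    3 + ∣ E (U ─ ⁅ u ⁆) ∣
      ≤⟨ s≤s (s≤s (path-removal π (λ v∈ → ─⁺ (S⊆ (∪ʳ v∈)) (≢⇒∉⁅⁆ (∈∧∉⇒≢ v∈ u∉)))
           (adj-sym uv) (λ u∈ → ─⁻ʳ u∈ (x∈⁅x⁆ u)) zy (y∉ ∘ ─⁻ˡ)
           (λ _ u≡y → y∉ (subst (_∈ U) u≡y (S⊆ (∪ˡ (x∈⁅x⁆ u))))))) ⟩
    2 + (∣ E (U ─ ⁅ u ⁆ ─ S) ∣ + (s + s))
      ≡⟨ cong (λ X → 2 + (∣ E X ∣ + (s + s))) (p─q─r≡p─q∪r U ⁅ u ⁆ S) ⟩
    2 + (t + (s + s))
      ≡⟨ solve 2 (λ t s → con 2 :+ (t :+ (s :+ s)) := t :+ ((con 1 :+ s) :+ (con 1 :+ s))) refl t s ⟩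
    t + (suc s + suc s)
      ≤⟨ +-monoʳ-≤ t (+-mono-≤ grow grow) ⟩
    t + (∣ ⁅ u ⁆ ∪ S ∣ + ∣ ⁅ u ⁆ ∪ S ∣) ∎
    where
    open ≤-Reasoning
    open +-*-Solver
    s t : ℕ
    s = ∣ S ∣
    t = ∣ E (U ─ (⁅ u ⁆ ∪ S)) ∣
    grow : s < ∣ ⁅ u ⁆ ∪ S ∣
    grow = ∣∣-mono-< S (⁅ u ⁆ ∪ S) ∪ʳ (∪ˡ (x∈⁅x⁆ u)) u∉

  spanning : Subset (size G) → Subgraph G
  spanning T = record { verts = ⊤ ; edges = T ; closed = λ _ → ∈⊤ , ∈⊤ }

  walk-mono : ∀ {H K : Subgraph G} {u v} → edges H ⊆ edges K → Walk H u v → Walk K u v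
  walk-mono H⊆K []              = []
  walk-mono H⊆K (step e e∈ j w) = step e (H⊆K e∈) j (walk-mono H⊆K w)

  edgeList-mono : ∀ {H K : Subgraph G} {u v} (H⊆K : edges H ⊆ edges K) (w : Walk H u v) →
    edgeList (walk-mono {H} {K} H⊆K w) ≡ edgeList w
  edgeList-mono H⊆K []              = refl
  edgeList-mono H⊆K (step e _ _ w) = cong (e ∷_) (edgeList-mono H⊆K w)

  -- Acyclicity is stated for closed walks that may repeat vertices but not edges. These can be
  -- analysed at a bridge by looking at edges alone, and every `Cycle` is one of them.
  record IsTree (W : Subset (order G)) (T : Subset (size G)) : Set where
    field
      T⊆      : T ⊆ E W
      spans   : ∀ {u v} → u ∈ W → v ∈ W → Walk (spanning T) u v
      acyclic : ∀ {u} (w : Walk (spanning T) u u) → Unique (edgeList w) → edgeList w ≡ []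

  tree-⁅⁆ : ∀ u → IsTree ⁅ u ⁆ ⊥
  tree-⁅⁆ u = record
    { T⊆ = ⊥-elim ∘ ∉⊥
    ; spans = λ a∈ b∈ → subst (Walk _ _) (trans (∈⁅⁆⁻ a∈) (sym (∈⁅⁆⁻ b∈))) []
    ; acyclic = λ { [] _ → refl ; (step _ e∈ _ _) _ → ⊥-elim (∉⊥ e∈) } }

  record Bridge (W W₁ W₂ : Subset (order G)) (T T₁ T₂ : Subset (size G)) (e : Edge G) : Set where
    field
      {a b} : Vertex G
      a∈    : a ∈ W₁
      b∈    : b ∈ W₂
      joins : Joins e a b
      split : ∀ {v} → v ∈ W → v ∈ W₁ ⊎ v ∈ W₂
      W₁⊆   : W₁ ⊆ W
      W₂⊆   : W₂ ⊆ W
      apart : ∀ {v} → v ∈ W₁ → v ∉ W₂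
      sort  : ∀ {f} → f ∈ T → f ∈ T₁ ⊎ f ∈ T₂ ⊎ f ≡ e
      e∈    : e ∈ T
      T₁⊆   : T₁ ⊆ T
      T₂⊆   : T₂ ⊆ T

  flip-bridge : ∀ {W W₁ W₂ T T₁ T₂ e} → Bridge W W₁ W₂ T T₁ T₂ e → Bridge W W₂ W₁ T T₂ T₁ e
  flip-bridge B = record
    { a∈ = b∈ ; b∈ = a∈ ; joins = joins-sym joins ; split = Sum.swap ∘ split ; W₁⊆ = W₂⊆ ; W₂⊆ = W₁⊆
    ; apart = λ v∈₂ v∈₁ → apart v∈₁ v∈₂
    ; sort = λ f∈ → [ inj₂ ∘ inj₁ , [ inj₁ , inj₂ ∘ inj₂ ]′ ]′ (sort f∈)
    ; e∈ = e∈ ; T₁⊆ = T₂⊆ ; T₂⊆ = T₁⊆ }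
    where open Bridge B

  module _ {W W₁ W₂ T T₁ T₂ e} (t₁ : IsTree W₁ T₁) (t₂ : IsTree W₂ T₂) (B : Bridge W W₁ W₂ T T₁ T₂ e) where
    open Bridge B

    stays-right : ∀ {u z} → u ∈ W₂ → (w : Walk (spanning T) u z) → All (e ≢_) (edgeList w) → z ∈ W₂
    stays-right u∈ []              _            = u∈
    stays-right u∈ (step f f∈ j w) (e≢f ∷ e∉w) with sort f∈
    ... | inj₁ f∈₁         = ⊥-elim (apart (proj₁ (E⁻ j (IsTree.T⊆ t₁ f∈₁))) u∈)
    ... | inj₂ (inj₁ f∈₂)  = stays-right (proj₂ (E⁻ j (IsTree.T⊆ t₂ f∈₂))) w e∉w
    ... | inj₂ (inj₂ refl) = ⊥-elim (e≢f refl)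

    -- Crossing e leads into W₂, from where only e leads back; as e may not be repeated, the walk
    -- stays in T₁.
    trapped : ∀ {u z} → u ∈ W₁ → z ∈ W₁ → (w : Walk (spanning T) u z) → Unique (edgeList w) →
      ∃[ w′ ] edgeList {H = spanning T₁} {x = u} {y = z} w′ ≡ edgeList w
    trapped u∈ z∈ []              _         = [] , refl
    trapped u∈ z∈ (step f f∈ j w) (f∉ ∷ w!) with sort f∈
    ... | inj₁ f∈₁         = let w′ , eq = trapped (proj₂ (E⁻ j (IsTree.T⊆ t₁ f∈₁))) z∈ w w! in
      step f f∈₁ j w′ , cong (f ∷_) eq
    ... | inj₂ (inj₁ f∈₂)  = ⊥-elim (apart u∈ (proj₁ (E⁻ j (IsTree.T⊆ t₂ f∈₂))))
    ... | inj₂ (inj₂ refl) = ⊥-elim (apart z∈ (stays-right crossed w f∉))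
      where
      crossed : _ ∈ W₂
      crossed = [ (λ { (refl , refl) → b∈ }) , (λ { (refl , refl) → ⊥-elim (apart u∈ b∈) }) ]′ (same-ends joins j)
        where
        same-ends : ∀ {d a b x y} → Joins d a b → Joins d x y → (x ≡ a × y ≡ b) ⊎ (x ≡ b × y ≡ a)
        same-ends (inj₁ p) (inj₁ q) with refl ← trans (sym p) q = inj₁ (refl , refl)
        same-ends (inj₁ p) (inj₂ q) with refl ← trans (sym p) q = inj₂ (refl , refl)
        same-ends (inj₂ p) (inj₁ q) with refl ← trans (sym p) q = inj₂ (refl , refl)
        same-ends (inj₂ p) (inj₂ q) with refl ← trans (sym p) q = inj₁ (refl , refl)

    closed-left : ∀ {u} → u ∈ W₁ → (w : Walk (spanning T) u u) → Unique (edgeList w) → edgeList w ≡ []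
    closed-left u∈ w w! = let w′ , eq = trapped u∈ u∈ w w! in
      trans (sym eq) (IsTree.acyclic t₁ w′ (subst Unique (sym eq) w!))

  bridge-tree : ∀ {W W₁ W₂ T T₁ T₂ e} → IsTree W₁ T₁ → IsTree W₂ T₂ → Bridge W W₁ W₂ T T₁ T₂ e → IsTree W T
  bridge-tree {W} {W₁} {W₂} {T} {T₁} {T₂} {e} t₁ t₂ B = record { T⊆ = T⊆ ; spans = spans ; acyclic = acyclic }
    where
    open Bridge B

    T⊆ : T ⊆ E W
    T⊆ f∈ with sort f∈
    ... | inj₁ f∈₁         = E-mono W₁⊆ (IsTree.T⊆ t₁ f∈₁)
    ... | inj₂ (inj₁ f∈₂)  = E-mono W₂⊆ (IsTree.T⊆ t₂ f∈₂)
    ... | inj₂ (inj₂ refl) = E⁺ joins (W₁⊆ a∈) (W₂⊆ b∈)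

    left : ∀ {u v} → u ∈ W₁ → v ∈ W₁ → Walk (spanning T) u v
    left u∈ v∈ = walk-mono T₁⊆ (IsTree.spans t₁ u∈ v∈)

    right : ∀ {u v} → u ∈ W₂ → v ∈ W₂ → Walk (spanning T) u v
    right u∈ v∈ = walk-mono T₂⊆ (IsTree.spans t₂ u∈ v∈)

    spans : ∀ {u v} → u ∈ W → v ∈ W → Walk (spanning T) u v
    spans u∈ v∈ with split u∈ | split v∈
    ... | inj₁ u∈₁ | inj₁ v∈₁ = left u∈₁ v∈₁
    ... | inj₁ u∈₁ | inj₂ v∈₂ = left u∈₁ a∈ ++ʷ step e e∈ joins (right b∈ v∈₂)
    ... | inj₂ u∈₂ | inj₁ v∈₁ = right u∈₂ b∈ ++ʷ step e e∈ (joins-sym joins) (left a∈ v∈₁)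
    ... | inj₂ u∈₂ | inj₂ v∈₂ = right u∈₂ v∈₂

    acyclic : ∀ {u} (w : Walk (spanning T) u u) → Unique (edgeList w) → edgeList w ≡ []
    acyclic []                   _  = refl
    acyclic w@(step _ f∈ j _) w! with split (proj₁ (E⁻ j (T⊆ f∈)))
    ... | inj₁ u∈₁ = closed-left t₁ t₂ B u∈₁ w w!
    ... | inj₂ u∈₂ = closed-left t₂ t₁ (flip-bridge B) u∈₂ w w!

  -- The vertices of S are added one by one along the path, each as a leaf: T has no edge inside S,
  -- and exactly one from the new vertex to X.
  hang-path : ∀ {X T S u z} → Path S u z → (∀ {v} → v ∈ S → v ∉ X) →
    (∀ {v} → v ∈ S → ∃[ m ] m ∈ X × ∃[ e ] Joins e v m × e ∈ T) →
    (∀ {v m m′} → v ∈ S → m ∈ X → m′ ∈ X → Adj v m → Adj v m′ → m ≡ m′) →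
    (∀ {e} → e ∈ T → e ∉ E S) →
    IsTree X (T ∩ E X) → IsTree (S ∪ X) (T ∩ E (S ∪ X))
  hang-path {X} {T} {z = z} π = go π
    where
    extend : ∀ {S u} → u ∉ S → u ∉ X →
      ∃[ m ] m ∈ X × ∃[ e ] Joins e u m × e ∈ T →
      (∀ {m m′} → m ∈ X → m′ ∈ X → Adj u m → Adj u m′ → m ≡ m′) →
      (∀ {e} → e ∈ T → e ∉ E (⁅ u ⁆ ∪ S)) →
      IsTree (S ∪ X) (T ∩ E (S ∪ X)) → IsTree ((⁅ u ⁆ ∪ S) ∪ X) (T ∩ E ((⁅ u ⁆ ∪ S) ∪ X))
    extend {S} {u} u∉ u∉X (m , m∈ , e , j , e∈T) unique off t = bridge-tree (tree-⁅⁆ u) t record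
      { a∈ = x∈⁅x⁆ u ; b∈ = ∪ʳ m∈ ; joins = j
      ; split = λ v∈ → [ Sum.map₂ ∪ˡ ∘ ∪⁻ , inj₂ ∘ ∪ʳ ]′ (∪⁻ v∈)
      ; W₁⊆ = ∪ˡ ∘ ∪ˡ
      ; W₂⊆ = SX⊆
      ; apart = λ v∈u v∈ → [ (λ v∈S → u∉ (subst (_∈ S) (∈⁅⁆⁻ v∈u) v∈S))
                           , (λ v∈X → u∉X (subst (_∈ X) (∈⁅⁆⁻ v∈u) v∈X)) ]′ (∪⁻ v∈)
      ; sort = λ f∈ → let f∈T , f∈E = x∈p∩q⁻ T _ f∈ ; a , b = E⁻ (inj₁ refl) f∈E in
          inj₂ (sort f∈T (inj₁ refl) (place a) (place b))
      ; e∈ = x∈p∩q⁺ (e∈T , E⁺ j (∪ˡ (∪ˡ (x∈⁅x⁆ u))) (∪ʳ m∈))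
      ; T₁⊆ = ⊥-elim ∘ ∉⊥
      ; T₂⊆ = λ f∈ → let f∈T , f∈E = x∈p∩q⁻ T _ f∈ in x∈p∩q⁺ (f∈T , E-mono SX⊆ f∈E)
      }
      where
      SX⊆ : S ∪ X ⊆ (⁅ u ⁆ ∪ S) ∪ X
      SX⊆ = ∪-least (∪ˡ ∘ ∪ʳ) ∪ʳ

      place : ∀ {v} → v ∈ (⁅ u ⁆ ∪ S) ∪ X → v ≡ u ⊎ v ∈ S ⊎ v ∈ X
      place v∈ = [ Sum.map ∈⁅⁆⁻ inj₁ ∘ ∪⁻ , inj₂ ∘ inj₂ ]′ (∪⁻ v∈)

      at-u : ∀ {f b} → f ∈ T → Joins f u b → b ≡ u ⊎ b ∈ S ⊎ b ∈ X → f ≡ e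
      at-u f∈T k (inj₁ refl)       = ⊥-elim (irreflexive (_ , k))
      at-u f∈T k (inj₂ (inj₁ b∈S)) = ⊥-elim (off f∈T (E⁺ k (∪ˡ (x∈⁅x⁆ u)) (∪ʳ b∈S)))
      at-u f∈T k (inj₂ (inj₂ b∈X)) with refl ← unique b∈X m∈ (_ , k) (e , j) = edge-unique k j

      sort : ∀ {f a b} → f ∈ T → Joins f a b → a ≡ u ⊎ a ∈ S ⊎ a ∈ X → b ≡ u ⊎ b ∈ S ⊎ b ∈ X →
        f ∈ T ∩ E (S ∪ X) ⊎ f ≡ e
      sort f∈T k (inj₁ refl) b∈        = inj₂ (at-u f∈T k b∈)
      sort f∈T k (inj₂ a∈) (inj₁ refl) = inj₂ (at-u f∈T (joins-sym k) (inj₂ a∈))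
      sort f∈T k (inj₂ a∈) (inj₂ b∈)   =
        inj₁ (x∈p∩q⁺ (f∈T , E⁺ k (x∈p∪q⁺ a∈) (x∈p∪q⁺ b∈)))

    go : ∀ {S u} → Path S u z → (∀ {v} → v ∈ S → v ∉ X) →
      (∀ {v} → v ∈ S → ∃[ m ] m ∈ X × ∃[ e ] Joins e v m × e ∈ T) →
      (∀ {v m m′} → v ∈ S → m ∈ X → m′ ∈ X → Adj v m → Adj v m′ → m ≡ m′) →
      (∀ {e} → e ∈ T → e ∉ E S) →
      IsTree X (T ∩ E X) → IsTree (S ∪ X) (T ∩ E (S ∪ X))
    go [ u ] S∩X hook unique off t =
      subst (λ Y → IsTree (Y ∪ X) (T ∩ E (Y ∪ X))) (∪-identityʳ ⁅ u ⁆)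
        (extend ∉⊥ (S∩X (x∈⁅x⁆ u)) (hook (x∈⁅x⁆ u)) (unique (x∈⁅x⁆ u))
          (λ e∈ → off e∈ ∘ E-mono (∪-least id (⊥-elim ∘ ∉⊥)))
          (subst (λ Y → IsTree Y (T ∩ E Y)) (sym (∪-identityˡ X)) t))
    go (cons {u} {S} u∉ uv π) S∩X hook unique off t =
      extend u∉ (S∩X (∪ˡ (x∈⁅x⁆ u))) (hook (∪ˡ (x∈⁅x⁆ u))) (unique (∪ˡ (x∈⁅x⁆ u))) off
        (go π (S∩X ∘ ∪ʳ) (hook ∘ ∪ʳ) (unique ∘ ∪ʳ) (λ e∈ → off e∈ ∘ E-mono ∪ʳ) t)

  -- Decompositions relative to a treated part

  E-⊥ : ∀ {R} → E ⊥ ⊆ R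
  E-⊥ e∈ = ⊥-elim (∉⊥ (proj₁ (E⁻ (inj₁ refl) e∈)))

  no-edge : ∀ {L l e} → L ⊆ ⁅ l ⁆ → e ∉ E L
  no-edge {e = e} L⊆ e∈ = let a , b = E⁻ (inj₁ refl) e∈ in
    irreflexive (e , inj₁ (cong₂ _,_ (∈⁅⁆⁻ (L⊆ a)) (∈⁅⁆⁻ (L⊆ b))))

  tree-resp : ∀ {W X S T} → W ≡ X → S ⊆ T → T ⊆ S → IsTree W S → IsTree X T
  tree-resp refl S⊆T T⊆S = subst (IsTree _) (⊆-antisym S⊆T T⊆S)

  path-edge : ∀ {S A u v} → Path S u v → Meets S A → ∃[ w ] w ∈ S × w ∉ A →
    ∃[ a ] ∃[ b ] a ∈ S × a ∈ A × b ∈ S × b ∉ A × Adj a b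
  path-edge {S} {A} π (t , t∈S , t∈A) (w , w∈S , w∉A) =
    let a , b , a∈ , b∉ , ab , b∈S = exit {X = S ∩ A} (path-conn π t∈S w∈S) (x∈p∩q⁺ (t∈S , t∈A))
                                       (w∉A ∘ proj₂ ∘ x∈p∩q⁻ S A)
        a∈S , a∈A = x∈p∩q⁻ S A a∈
    in a , b , a∈S , a∈A , b∈S , (λ b∈A → b∉ (x∈p∩q⁺ (b∈S , b∈A))) , ab

  module Decompositions (r : Vertex G) where

    H : Subgraph G
    H = deleteVertex G r

    ⊆H : ∀ {W} → r ∉ W → E W ⊆ edges H
    ⊆H r∉ e∈ = subst (_ ∈_) (E≡ (∁ ⁅ r ⁆)) (E-mono (λ v∈ → x∉p⇒x∈∁p (≢⇒∉⁅⁆ (∈∧∉⇒≢ v∈ r∉))) e∈)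

    -- The decompositions of U relative to the treated part F; for F = ⊥ they are
    -- those of the graph induced by U.
    record Solution (F U : Subset (order G)) (B : Subset (size G)) : Set where
      field
        B⊆        : B ⊆ E U
        tree      : IsTree U (E U ─ B)
        generates : ∀ {R} → Closed H R → B ⊆ R → E F ⊆ R → E (F ∪ U) ⊆ R

    -- First `close` generates `E (F ∪ route)`; then B does its work with that as the treated part.
    -- No edge of B touches the route, so T retains all edges between the route and U - route.
    handle-solution : ∀ {F U B} (h : Handle U) → let open Handle h in
      (∀ {R} → Closed H R → E route ⊆ R → E F ⊆ R → E (F ∪ route) ⊆ R) →
      Solution (F ∪ route) (U ─ route) B → Solution F U (E route ∪ B)
    handle-solution {F} {U} {B} h close sol = record
      { B⊆ = ∪-least (E-mono route⊆) (E-mono ─⁻ˡ ∘ S.B⊆)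
      ; tree = tree-resp Q∪X≡U (proj₁ ∘ x∈p∩q⁻ T _) (λ e∈ → x∈p∩q⁺ (e∈ , E-mono ⊆Q∪X (─⁻ˡ e∈)))
          (hang-path path (λ v∈ v∈X → ─⁻ʳ v∈X v∈) hook
            (λ v∈ m∈ m′∈ vm vm′ → attached-unique v∈ m′∈ m∈ vm′ vm)
            (λ e∈ e∈Q → ─⁻ʳ e∈ (∪ˡ e∈Q))
            (tree-resp refl into onto S.tree))
      ; generates = λ closed B⊆R EF⊆R → S.generates closed (B⊆R ∘ ∪ʳ) (close closed (B⊆R ∘ ∪ˡ) EF⊆R)
          ∘ E-mono regroup
      }
      where
      open Handle h
      module S = Solution sol
      X : Subset (order G)
      X = U ─ route
      T : Subset (size G)
      T = E U ─ (E route ∪ B)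

      ⊆Q∪X : U ⊆ route ∪ X
      ⊆Q∪X {v} v∈ with v ∈? route
      ... | yes v∈Q = ∪ˡ v∈Q
      ... | no v∉Q  = ∪ʳ (─⁺ v∈ v∉Q)

      Q∪X≡U : route ∪ X ≡ U
      Q∪X≡U = ⊆-antisym (∪-least route⊆ ─⁻ˡ) ⊆Q∪X

      regroup : F ∪ U ⊆ (F ∪ route) ∪ X
      regroup v∈ = [ ∪ˡ ∘ ∪ˡ , (λ v∈U → [ ∪ˡ ∘ ∪ʳ , ∪ʳ ]′ (∪⁻ (⊆Q∪X v∈U))) ]′ (∪⁻ v∈)

      hook : ∀ {v} → v ∈ route → ∃[ m ] m ∈ X × ∃[ e ] Joins e v m × e ∈ T
      hook v∈ = let m , m∈ , e , j = attached v∈ in m , m∈ , e , j ,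
        ─⁺ (E⁺ j (route⊆ v∈) (─⁻ˡ m∈)) (λ e∈ →
          [ (λ e∈Q → ─⁻ʳ m∈ (proj₂ (E⁻ j e∈Q)))
          , (λ e∈B → ─⁻ʳ (proj₁ (E⁻ j (S.B⊆ e∈B))) v∈) ]′ (∪⁻ e∈))

      into : E X ─ B ⊆ T ∩ E X
      into e∈ = x∈p∩q⁺ (─⁺ (E-mono ─⁻ˡ (─⁻ˡ e∈)) (λ e∈′ →
        [ (λ e∈Q → ─⁻ʳ (proj₁ (E⁻ (inj₁ refl) (─⁻ˡ e∈))) (proj₁ (E⁻ (inj₁ refl) e∈Q)))
        , ─⁻ʳ e∈ ]′ (∪⁻ e∈′)) , ─⁻ˡ e∈)

      onto : T ∩ E X ⊆ E X ─ B
      onto e∈ = let e∈T , e∈X = x∈p∩q⁻ T (E X) e∈ in ─⁺ e∈X (─⁻ʳ e∈T ∘ ∪ʳ)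

    vertex-solution : ∀ {L l} → l ∈ L → L ⊆ ⁅ l ⁆ → Solution ⊥ L ⊥
    vertex-solution {L} {l} l∈ L⊆ = record
      { B⊆ = ⊥-elim ∘ ∉⊥
      ; tree = tree-resp (⊆-antisym (⁅⁆⊆ l∈) L⊆) (⊥-elim ∘ ∉⊥) (⊥-elim ∘ no-edge L⊆ ∘ ─⁻ˡ) (tree-⁅⁆ l)
      ; generates = λ _ _ _ e∈ → ⊥-elim (no-edge L⊆ (E-mono (∪-least (⊥-elim ∘ ∉⊥) id) e∈)) }

    module _ {F U c w₀ L l w} (S : Stage F U c w₀) (P : Piece F U c L l w) (t : TwoFeet F L)
      (r∉F : r ∉ F) (r∉U : r ∉ U) where
      open Piece P

      -- Solved with nothing treated, L has all of `E L` generated by B alone; the cycle through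
      -- both feet then ties it to `E F`.
      absorb : ∀ {B R} → Solution ⊥ L B → Closed H R → B ⊆ R → E F ⊆ R → E (F ∪ L) ⊆ R
      absorb sol closed B⊆R EF⊆R = joined∈ closed
        (⊆H (λ r∈ → [ r∉F , r∉U ∘ L⊆ ]′ (∪⁻ r∈))) (Stage.connF S) (piece-conn P) disjoint EF⊆R
        (Solution.generates sol closed B⊆R E-⊥ ∘ E-mono ∪ʳ) t

      whole-solution : ∀ {B} → U ⊆ L → Solution ⊥ L B → Solution F U B
      whole-solution U⊆L sol with refl ← ⊆-antisym L⊆ U⊆L = record
        { B⊆ = Solution.B⊆ sol ; tree = Solution.tree sol ; generates = absorb sol }

      crossing : ∀ {u v e} → w ∈ U → u ∈ L → v ∈ U ─ L → Joins e u v → e ≡ proj₁ lw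
      crossing w∈ u∈ v∈ j with exits _ _ u∈ (─⁻ʳ v∈) (_ , j)
      ... | inj₁ v∈F           = ⊥-elim (Stage.disjoint S (─⁻ˡ v∈) v∈F)
      ... | inj₂ (refl , refl) = edge-unique j (proj₂ lw)

      in-or-out : ∀ {v} → v ∈ U → v ∈ L ⊎ v ∈ U ─ L
      in-or-out {v} v∈ with v ∈? L
      ... | yes v∈L = inj₁ v∈L
      ... | no v∉L  = inj₂ (─⁺ v∈ v∉L)

      sort-edges : ∀ {e} → w ∈ U → e ∈ E U → e ∈ E L ⊎ e ∈ E (U ─ L) ⊎ e ≡ proj₁ lw
      sort-edges {e} w∈ e∈ = let a , b = E⁻ (inj₁ refl) e∈ in go (inj₁ refl) (in-or-out a) (in-or-out b)
        where
        go : ∀ {u v} → Joins e u v → u ∈ L ⊎ u ∈ U ─ L → v ∈ L ⊎ v ∈ U ─ L →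
          e ∈ E L ⊎ e ∈ E (U ─ L) ⊎ e ≡ proj₁ lw
        go j (inj₁ u∈) (inj₁ v∈) = inj₁ (E⁺ j u∈ v∈)
        go j (inj₁ u∈) (inj₂ v∈) = inj₂ (inj₂ (crossing w∈ u∈ v∈ j))
        go j (inj₂ u∈) (inj₁ v∈) = inj₂ (inj₂ (crossing w∈ v∈ u∈ (joins-sym j)))
        go j (inj₂ u∈) (inj₂ v∈) = inj₂ (inj₁ (E⁺ j u∈ v∈))

      parts-apart : ∀ {e} → e ∈ E L → e ∉ E (U ─ L)
      parts-apart e∈L e∈X = ─⁻ʳ (proj₁ (E⁻ (inj₁ refl) e∈X)) (proj₁ (E⁻ (inj₁ refl) e∈L))

      -- The exit l w is the only edge between L and U - L, so it goes into T and bridges the two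
      -- trees.
      product-solution : ∀ {B₁ B₂} → w ∈ U → Solution ⊥ L B₁ → Solution (F ∪ L) (U ─ L) B₂ →
        Solution F U (B₁ ∪ B₂)
      product-solution {B₁} {B₂} w∈ sol₁ sol₂ = record
        { B⊆ = ∪-least (E-mono L⊆ ∘ S₁.B⊆) (E-mono ─⁻ˡ ∘ S₂.B⊆)
        ; tree = bridge-tree S₁.tree S₂.tree record
            { a∈ = l∈ ; b∈ = w∈X ; joins = proj₂ lw ; split = in-or-out ; W₁⊆ = L⊆ ; W₂⊆ = ─⁻ˡ
            ; apart = λ v∈L v∈X → ─⁻ʳ v∈X v∈L
            ; sort = λ e∈ → Sum.map (λ e∈L → ─⁺ e∈L (─⁻ʳ e∈ ∘ ∪ˡ))
                (Sum.map₁ (λ e∈X → ─⁺ e∈X (─⁻ʳ e∈ ∘ ∪ʳ))) (sort-edges w∈ (─⁻ˡ e∈))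
            ; e∈ = ─⁺ (E⁺ (proj₂ lw) (L⊆ l∈) w∈) λ e∈ →
                [ (λ e∈₁ → w∉L (proj₂ (E⁻ (proj₂ lw) (S₁.B⊆ e∈₁))))
                , (λ e∈₂ → ─⁻ʳ (proj₁ (E⁻ (proj₂ lw) (S₂.B⊆ e∈₂))) l∈) ]′ (∪⁻ e∈)
            ; T₁⊆ = λ e∈ → ─⁺ (E-mono L⊆ (─⁻ˡ e∈)) λ e∈B →
                [ ─⁻ʳ e∈ , parts-apart (─⁻ˡ e∈) ∘ S₂.B⊆ ]′ (∪⁻ e∈B)
            ; T₂⊆ = λ e∈ → ─⁺ (E-mono ─⁻ˡ (─⁻ˡ e∈)) λ e∈B →
                [ (λ e∈₁ → parts-apart (S₁.B⊆ e∈₁) (─⁻ˡ e∈)) , ─⁻ʳ e∈ ]′ (∪⁻ e∈B)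
            }
        ; generates = λ closed B⊆R EF⊆R →
            S₂.generates closed (B⊆R ∘ ∪ʳ) (absorb sol₁ closed (B⊆R ∘ ∪ˡ) EF⊆R) ∘ E-mono regroup
        }
        where
        module S₁ = Solution sol₁
        module S₂ = Solution sol₂
        w∈X : w ∈ U ─ L
        w∈X = ─⁺ w∈ w∉L
        regroup : F ∪ U ⊆ (F ∪ L) ∪ (U ─ L)
        regroup v∈ = [ ∪ˡ ∘ ∪ˡ , (λ v∈U → [ ∪ˡ ∘ ∪ʳ , ∪ʳ ]′ (in-or-out v∈U)) ]′ (∪⁻ v∈)

      product-count : w ∈ U → ∣ E U ∣ ≤ suc (∣ E L ∣ + ∣ E (U ─ L) ∣)
      product-count w∈ = ≤-trans
        (p⊆q⇒∣p∣≤∣q∣ {p = E U} {q = ⁅ proj₁ lw ⁆ ∪ (E L ∪ E (U ─ L))} λ e∈ →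
          [ ∪ʳ ∘ ∪ˡ , [ ∪ʳ ∘ ∪ʳ , ∪ˡ ∘ ≡⇒∈⁅⁆ ]′ ]′ (sort-edges w∈ e∈))
        (≤-trans (∣⁅x⁆∪p∣≤ (proj₁ lw) (E L ∪ E (U ─ L))) (s≤s (∣p∪q∣≤∣p∣+∣q∣ (E L) (E (U ─ L)))))

    -- Families of decompositions

    record Family (k : ℕ) (F U : Subset (order G)) : Set where
      field
        solve     : Vec Bool k → Subset (size G)
        sound     : ∀ v → Solution F U (solve v)
        injective : ∀ {v w} → solve v ≡ solve w → v ≡ w

    padRight-injective : ∀ {j k} (j≤k : j ≤ k) {v w : Vec Bool j} →
      padRight j≤k false v ≡ padRight j≤k false w → v ≡ w
    padRight-injective z≤n       {[]}    {[]}    _  = refl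
    padRight-injective (s≤s j≤k) {_ ∷ _} {_ ∷ _} eq = let p , q = ∷-injective eq in
      cong₂ _∷_ p (padRight-injective j≤k q)

    shrink : ∀ {j k F U} → j ≤ k → Family k F U → Family j F U
    shrink j≤k f = record
      { solve = solve ∘ padRight j≤k false
      ; sound = λ v → sound (padRight j≤k false v)
      ; injective = padRight-injective j≤k ∘ injective }
      where open Family f

    map-family : ∀ {k F U F′ U′} → (∀ {B} → Solution F U B → Solution F′ U′ B) → Family k F U → Family k F′ U′
    map-family f fam = record
      { solve = Family.solve fam ; sound = f ∘ Family.sound fam ; injective = Family.injective fam }

    -- For a handle of a stage this comes from one cycle through F and the route; for the first
    -- handle of a cut F is empty and it is immediate.
    Completes : ∀ {U} → Subset (order G) → Handle U → Set
    Completes F h = ∀ {R} → Closed H R → E (Handle.route h) ⊆ R → E F ⊆ R → E (F ∪ Handle.route h) ⊆ R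

    module _ {k : ℕ} {F U : Subset (order G)} (h₁ h₂ : Handle U) (c₁ : Completes F h₁) (c₂ : Completes F h₂) where
      private
        module h₁ = Handle h₁
        module h₂ = Handle h₂

      fork-family : Conflict h₁.route h₂.route →
        Family k (F ∪ h₁.route) (U ─ h₁.route) → Family k (F ∪ h₂.route) (U ─ h₂.route) →
        Family (suc k) F U
      fork-family (meets , apart) f₁ f₂ = record { solve = solve ; sound = sound ; injective = injective }
        where
        module f₁ = Family f₁
        module f₂ = Family f₂

        solve : Vec Bool (suc k) → Subset (size G)
        solve (true  ∷ v) = E h₁.route ∪ f₁.solve v
        solve (false ∷ v) = E h₂.route ∪ f₂.solve v

        sound : ∀ v → Solution F U (solve v)
        sound (true  ∷ v) = handle-solution h₁ c₁ (f₁.sound v)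
        sound (false ∷ v) = handle-solution h₂ c₂ (f₂.sound v)

        off : ∀ {F′ Q B} → Solution F′ (U ─ Q) B → ∀ {e} → e ∈ B → e ∉ E Q
        off sol e∈B e∈Q = ─⁻ʳ (proj₁ (E⁻ (inj₁ refl) (Solution.B⊆ sol e∈B))) (proj₁ (E⁻ (inj₁ refl) e∈Q))

        -- An edge of the first route leaving the second one is chosen on the
        -- left and belongs to the tree on the right.
        differ : ∀ {v w} → E h₁.route ∪ f₁.solve v ≢ E h₂.route ∪ f₂.solve w
        differ {v} {w} eq =
          let a , b , a∈₁ , a∈₂ , b∈₁ , b∉₂ , e , j = path-edge h₁.path meets apart
          in [ (λ e∈ → b∉₂ (proj₂ (E⁻ j e∈)))
             , (λ e∈ → ─⁻ʳ (proj₁ (E⁻ j (Solution.B⊆ (f₂.sound w) e∈))) a∈₂) ]′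
             (∪⁻ (subst (e ∈_) eq (∪ˡ (E⁺ j a∈₁ b∈₁))))

        injective : ∀ {v w} → solve v ≡ solve w → v ≡ w
        injective {true  ∷ v} {true  ∷ w} eq = cong (true ∷_) (f₁.injective
          (∪-separateʳ {P = E h₁.route} id id (off (f₁.sound v)) (off (f₁.sound w)) eq))
        injective {false ∷ v} {false ∷ w} eq = cong (false ∷_) (f₂.injective
          (∪-separateʳ {P = E h₂.route} id id (off (f₂.sound v)) (off (f₂.sound w)) eq))
        injective {true  ∷ v} {false ∷ w} eq = ⊥-elim (differ eq)
        injective {false ∷ v} {true  ∷ w} eq = ⊥-elim (differ (sym eq))

    module _ {F U c w₀ L l w} (S : Stage F U c w₀) (P : Piece F U c L l w) (t : TwoFeet F L)
      (r∉F : r ∉ F) (r∉U : r ∉ U) (w∈ : w ∈ U) where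

      product-family : ∀ {j k} → Family j ⊥ L → Family k (F ∪ L) (U ─ L) → Family (j + k) F U
      product-family {j} {k} f₁ f₂ = record
        { solve = λ v → f₁.solve (take j v) ∪ f₂.solve (drop j v)
        ; sound = λ v → product-solution S P t r∉F r∉U w∈ (f₁.sound (take j v)) (f₂.sound (drop j v))
        ; injective = λ {v} {v′} eq →
            let left  = f₁.injective (∪-separateˡ (B₁⊆ (take j v)) (B₁⊆ (take j v′)) (B₂∩ (drop j v)) (B₂∩ (drop j v′)) eq)
                right = f₂.injective (∪-separateʳ (B₁⊆ (take j v)) (B₁⊆ (take j v′)) (B₂∩ (drop j v)) (B₂∩ (drop j v′)) eq)
            in trans (sym (take++drop≡id j v)) (trans (cong₂ Vec._++_ left right) (take++drop≡id j v′)) }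
        where
        module f₁ = Family f₁
        module f₂ = Family f₂
        B₁⊆ : ∀ v → f₁.solve v ⊆ E L
        B₁⊆ v = Solution.B⊆ (f₁.sound v)
        B₂∩ : ∀ v {e} → e ∈ f₂.solve v → e ∉ E L
        B₂∩ v e∈ e∈L = parts-apart S P t r∉F r∉U e∈L (Solution.B⊆ (f₂.sound v) e∈)

    -- The number of doublings

    module Counting {q : ℕ} (short : Peripheral≤ q) where

      s : ℕ
      s = q ∸ 2

      -- The number suc ∣ E U ∣ - ∣ U ∣ is the cyclomatic number of U, which is also
      -- the size of B.
      record Many (F U : Subset (order G)) : Set where
        field
          {k}    : ℕ
          family : Family k F U
          count  : suc ∣ E U ∣ ≤ ∣ U ∣ + k * s

      route-length : ∀ {U} (h : Handle U) → Conn (∁ U) → ∣ Handle.route h ∣ ≤ suc s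
      route-length h conn∁ = s≤s⁻¹ (≤-trans (handle-short short h conn∁) (m≤n+m∸n q 2))

      -- Deleting a route of m vertices costs at most 2m - 1 edges, so the cyclomatic number drops
      -- by at most m - 1, which is at most s.
      handle-count : ∀ {U} (h : Handle U) → Conn (∁ U) → ∀ {k} →
        let X = U ─ Handle.route h in suc ∣ E X ∣ ≤ ∣ X ∣ + k * s → suc ∣ E U ∣ ≤ ∣ U ∣ + suc k * s
      handle-count {U} h conn∁ {k} count = s≤s⁻¹ (begin
        2 + ∣ E U ∣
          ≤⟨ s≤s (path-removal path route⊆ px x∉ qy y∉ (⊥-elim ∘ p≢q)) ⟩
        suc ∣ E X ∣ + (m + m)
          ≤⟨ +-monoˡ-≤ (m + m) count ⟩
        ∣ X ∣ + k * s + (m + m)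
          ≡⟨ solve 3 (λ x a m → x :+ a :+ (m :+ m) := (x :+ m) :+ (m :+ a)) refl ∣ X ∣ (k * s) m ⟩
        (∣ X ∣ + m) + (m + k * s)
          ≤⟨ +-mono-≤ (∣p─q∣+∣q∣≤∣p∣ U route route⊆) (+-monoˡ-≤ (k * s) (route-length h conn∁)) ⟩
        ∣ U ∣ + suc (s + k * s)
          ≡⟨ +-suc ∣ U ∣ (s + k * s) ⟩
        suc (∣ U ∣ + suc k * s) ∎)
        where
        open ≤-Reasoning
        open +-*-Solver
        open Handle h
        X : Subset (order G)
        X = U ─ route
        m : ℕ
        m = ∣ route ∣

      -- The branches may allow different numbers of doublings. Both are reduced to the smaller one,
      -- and the count comes from the branch that attains it.
      fork-many : ∀ {F U} (h₁ h₂ : Handle U) → Completes F h₁ → Completes F h₂ → Conn (∁ U) →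
        Conflict (Handle.route h₁) (Handle.route h₂) →
        Many (F ∪ Handle.route h₁) (U ─ Handle.route h₁) →
        Many (F ∪ Handle.route h₂) (U ─ Handle.route h₂) → Many F U
      fork-many {U = U} h₁ h₂ c₁ c₂ conn∁ conflict m₁ m₂ with ≤-total (Many.k m₁) (Many.k m₂)
      ... | inj₁ k₁≤k₂ = record
        { family = fork-family h₁ h₂ c₁ c₂ conflict (Many.family m₁) (shrink k₁≤k₂ (Many.family m₂))
        ; count = handle-count h₁ conn∁ {Many.k m₁} (Many.count m₁) }
      ... | inj₂ k₂≤k₁ = record
        { family = fork-family h₁ h₂ c₁ c₂ conflict (shrink k₂≤k₁ (Many.family m₁)) (Many.family m₂)
        ; count = handle-count h₂ conn∁ {Many.k m₂} (Many.count m₂) }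

      product : ∀ {F U c w₀ L l w} → Stage F U c w₀ → Piece F U c L l w → TwoFeet F L →
        r ∉ F → r ∉ U → w ∈ U → Many ⊥ L → Many (F ∪ L) (U ─ L) → Many F U
      product {U = U} {L = L} S P t r∉F r∉U w∈ m₁ m₂ = record
        { family = product-family S P t r∉F r∉U w∈ (Many.family m₁) (Many.family m₂)
        ; count = begin
            suc ∣ E U ∣
              ≤⟨ s≤s (product-count S P t r∉F r∉U w∈) ⟩
            2 + (∣ E L ∣ + ∣ E (U ─ L) ∣)
              ≡⟨ solve 2 (λ a b → con 2 :+ (a :+ b) := (con 1 :+ a) :+ (con 1 :+ b)) refl ∣ E L ∣ ∣ E (U ─ L) ∣ ⟩
            suc ∣ E L ∣ + suc ∣ E (U ─ L) ∣
              ≤⟨ +-mono-≤ (Many.count m₁) (Many.count m₂) ⟩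
            (∣ L ∣ + k₁ * s) + (∣ U ─ L ∣ + k₂ * s)
              ≡⟨ solve 5 (λ l x a b s → (l :+ a :* s) :+ (x :+ b :* s) := (x :+ l) :+ (a :+ b) :* s) refl
                   ∣ L ∣ ∣ U ─ L ∣ k₁ k₂ s ⟩
            (∣ U ─ L ∣ + ∣ L ∣) + (k₁ + k₂) * s
              ≤⟨ +-monoˡ-≤ _ (∣p─q∣+∣q∣≤∣p∣ U L (Piece.L⊆ P)) ⟩
            ∣ U ∣ + (k₁ + k₂) * s ∎ }
        where
        open ≤-Reasoning
        open +-*-Solver
        k₁ k₂ : ℕ
        k₁ = Many.k m₁
        k₂ = Many.k m₂

      vertex : ∀ {L l} → l ∈ L → L ⊆ ⁅ l ⁆ → Many ⊥ L
      vertex {L} {l} l∈ L⊆ = record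
        { k = 0
        ; family = record
            { solve = λ _ → ⊥ ; sound = λ _ → vertex-solution l∈ L⊆ ; injective = λ { {[]} {[]} _ → refl } }
        ; count = ≤-trans (s≤s (≤-reflexive no-edges)) (≤-trans (≤-reflexive (sym ∣L∣≡1)) (m≤m+n ∣ L ∣ 0)) }
        where
        ∣L∣≡1 : ∣ L ∣ ≡ 1
        ∣L∣≡1 = trans (cong ∣_∣ (⊆-antisym L⊆ (⁅⁆⊆ l∈))) (∣⁅x⁆∣≡1 l)
        no-edges : ∣ E L ∣ ≡ 0
        no-edges = trans (cong ∣_∣ (⊆-antisym {i = E L} {j = ⊥}
          (⊥-elim ∘ no-edge L⊆) (⊥-elim ∘ ∉⊥))) (∣⊥∣≡0 (size G))

      shrinks : ∀ {n U} {x : Vertex G} (Q : Subset (order G)) → ∣ U ∣ ≤ suc n → Q ⊆ U → x ∈ Q → ∣ U ─ Q ∣ ≤ n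
      shrinks {U = U} Q ≤n Q⊆ x∈ = s≤s⁻¹ (<-≤-trans (∣─∣-< U Q Q⊆ x∈) ≤n)

      -- A stage calls `cuts` at the same n, since its piece may be all of U. The descent happens in
      -- `cuts`, which removes a handle before it calls `stages`.
      cuts   : ∀ n {L p q l x y w} → ∣ L ∣ ≤ n → r ∉ L → ThreeCut L p q l x y w → Many ⊥ L
      stages : ∀ n {F U c w₀} → ∣ U ∣ ≤ n → r ∉ F → r ∉ U → Stage F U c w₀ → Many F U

      cuts zero {L} ≤n _ C = ⊥-elim (n≮0 (<-≤-trans (x∈p⇒∣p-x∣<∣p∣ {p = L} (ThreeCut.p∈ C)) ≤n))
      cuts (suc n) {L} ≤n r∉ C =
        -- Both handles start at p; the first ends at q, and the second ends at l and misses q.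
        -- Hence they conflict.
        let h₁ , p₁≡ , q₁≡ , l∉ = cut-handle C
            h₂ , p₂≡ , q₂≡ , q∉ = cut-handle (swap-cut C)
        in fork-many h₁ h₂ (initial h₁) (initial h₂) (ThreeCut.conn∁ C) (conflict h₁ h₂ p₁≡ p₂≡ q₁≡ q∉)
             (treat h₁ (cut-stage C h₁ p₁≡ q₁≡ l∉)) (treat h₂ (cut-stage (swap-cut C) h₂ p₂≡ q₂≡ q∉))
        where
        initial : (h : Handle L) → Completes ⊥ h
        initial h _ EQ⊆ _ = EQ⊆ ∘ E-mono (∪-least (⊥-elim ∘ ∉⊥) id)

        treat : ∀ {c w₀} (h : Handle L) → Stage (⊥ ∪ Handle.route h) (L ─ Handle.route h) c w₀ →
          Many (⊥ ∪ Handle.route h) (L ─ Handle.route h)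
        treat h = stages n (shrinks route ≤n route⊆ p∈)
          (λ r∈ → [ ∉⊥ , r∉ ∘ route⊆ ]′ (∪⁻ r∈)) (r∉ ∘ ─⁻ˡ)
          where open Handle h

        conflict : ∀ {p q} (h₁ h₂ : Handle L) → Handle.p h₁ ≡ p → Handle.p h₂ ≡ p → Handle.q h₁ ≡ q →
          q ∉ Handle.route h₂ → Conflict (Handle.route h₁) (Handle.route h₂)
        conflict h₁ h₂ refl p₂≡ refl q∉ =
            (_ , Handle.p∈ h₁ , subst (_∈ Handle.route h₂) p₂≡ (Handle.p∈ h₂))
          , (_ , Handle.q∈ h₁ , q∉)

      stages zero {U = U} ≤n _ _ S = ⊥-elim (n≮0 (<-≤-trans (x∈p⇒∣p-x∣<∣p∣ {p = U} (Stage.c∈ S)) ≤n))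
      stages (suc n) {F} {U} {c} {w₀} ≤n r∉F r∉U S = let L , l , w , P = piece S in by-shape (cuts (suc n)) P (shape S P)
        where
        grown : ∀ {L} → L ⊆ U → r ∉ F ∪ L
        grown L⊆ r∈ = [ r∉F , r∉U ∘ L⊆ ]′ (∪⁻ r∈)

        absorb-piece : ∀ {L l w} → Piece F U c L l w → TwoFeet F L → Many ⊥ L → Many F U
        absorb-piece {L} P t m with Piece.location P
        ... | inj₂ (c∉ , w∈) = product S P t r∉F r∉U w∈ m
          (stages n (shrinks L ≤n (Piece.L⊆ P) (Piece.l∈ P)) (grown (Piece.L⊆ P)) (r∉U ∘ ─⁻ˡ)
            (absorb-stage S P c∉ w∈ t))
        ... | inj₁ (U⊆L , _) = record
          { family = map-family (whole-solution S P t r∉F r∉U U⊆L) (Many.family m)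
          ; count = subst (λ W → suc ∣ E W ∣ ≤ ∣ W ∣ + Many.k m * s) (⊆-antisym (Piece.L⊆ P) U⊆L) (Many.count m) }

        treat : (h : StageHandle F U c) →
          Many (F ∪ StageHandle.route h) (U ─ StageHandle.route h)
        treat h = stages n (shrinks route ≤n route⊆ p∈) (grown route⊆) (r∉U ∘ ─⁻ˡ) (handle-stage S h)
          where open StageHandle h

        completes : (h : StageHandle F U c) → Completes F (StageHandle.handle h)
        completes h closed EQ⊆ EF⊆ = joined∈ closed (⊆H (grown route⊆)) (Stage.connF S) route-conn
          (Stage.disjoint S ∘ route⊆) EF⊆ EQ⊆ (handle⇒feet (Stage.disjoint S) h)
          where open StageHandle h

        by-shape : (∀ {L p q l x y w} → ∣ L ∣ ≤ suc n → r ∉ L → ThreeCut L p q l x y w → Many ⊥ L) →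
          ∀ {L l w} → Piece F U c L l w → Shape F U c L l w → Many F U
        by-shape _ P (single L⊆ t) = absorb-piece P t (vertex (Piece.l∈ P) L⊆)
        by-shape cuts {L} P (cut C t) = absorb-piece P t
          (cuts (≤-trans (p⊆q⇒∣p∣≤∣q∣ {p = L} (Piece.L⊆ P)) ≤n) (r∉U ∘ Piece.L⊆ P) C)
        by-shape _ P (fork h₁ h₂ conflict) = fork-many (StageHandle.handle h₁) (StageHandle.handle h₂)
          (completes h₁) (completes h₂) (Stage.conn∁ S) conflict (treat h₁) (treat h₂)

-- Counting

module ℕ-Sum = Algebra.Properties.CommutativeMonoid.Sum +-0-commutativeMonoid
open ℕ-Sum using (sum; sum-cong-≗; ∑-distrib-+; sum-replicate-zero)

indicator : Bool → ℕ
indicator b = if b then 1 else 0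

∣∷∣ : ∀ {n} b (p : Subset n) → ∣ b ∷ p ∣ ≡ indicator b + ∣ p ∣
∣∷∣ true  p = refl
∣∷∣ false p = refl

sum-indicator : ∀ {n} (a : Fin n) → sum (λ v → indicator (does (a ≟ v))) ≡ 1
sum-indicator {suc n} zero    = cong suc (sum-replicate-zero n)
sum-indicator {suc n} (suc a) = sum-indicator a

-- Double counting: each e contributes 1 to the fibre over `f e` and to no other.
sum-fibres : ∀ {m n} (f : Fin m → Fin n) → sum (λ v → ∣ tabulate (λ e → does (f e ≟ v)) ∣) ≡ m
sum-fibres {zero}  {n} f = sum-replicate-zero n
sum-fibres {suc m} {n} f = trans
  (sum-cong-≗ (λ v → ∣∷∣ (does (f zero ≟ v)) (tabulate (λ e → does (f (suc e) ≟ v)))))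
  (trans (∑-distrib-+ {n} (λ v → indicator (does (f zero ≟ v))) _)
    (cong₂ _+_ (sum-indicator (f zero)) (sum-fibres (f ∘ suc))))

sum-const : ∀ n c → sum {n} (λ _ → c) ≡ n * c
sum-const zero    c = refl
sum-const (suc n) c = cong (c +_) (sum-const n c)

handshake : ∀ G → IsCubic G → order G * 3 ≡ size G + size G
handshake G cubicG = trans (sym (sum-const (order G) 3))
  (trans (sum-cong-≗ (sym ∘ cubicG))
    (trans (∑-distrib-+ {order G} _ (λ v → ∣ tabulate (λ e → does (proj₂ (Graph.ends G e) ≟ v)) ∣))
      (cong₂ _+_ (sum-fibres (proj₁ ∘ Graph.ends G)) (sum-fibres (proj₂ ∘ Graph.ends G)))))

boolVectors : ∀ k → List (Vec Bool k)
boolVectors zero    = [] ∷ []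
boolVectors (suc k) = map (true ∷_) (boolVectors k) ++ map (false ∷_) (boolVectors k)

length-boolVectors : ∀ k → length (boolVectors k) ≡ 2 ^ k
length-boolVectors zero    = refl
length-boolVectors (suc k) = trans (length-++ (map (true ∷_) (boolVectors k)))
  (cong₂ _+_ (half true) (trans (half false) (sym (+-identityʳ _))))
  where
  half : ∀ b → length (map {B = Vec Bool (suc k)} (b ∷_) (boolVectors k)) ≡ 2 ^ k
  half b = trans (length-map (b ∷_) (boolVectors k)) (length-boolVectors k)

boolVectors-unique : ∀ k → Unique (boolVectors k)
boolVectors-unique zero    = [] ∷ []
boolVectors-unique (suc k) = Unique.++⁺
  (Unique.map⁺ (proj₂ ∘ ∷-injective) (boolVectors-unique k))
  (Unique.map⁺ (proj₂ ∘ ∷-injective) (boolVectors-unique k))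
  (λ (v∈ , w∈) → let _ , _ , v≡ = ∈-map⁻ (true ∷_) v∈ ; _ , _ , w≡ = ∈-map⁻ (false ∷_) w∈ in
    true≢false (proj₁ (∷-injective (trans (sym v≡) w≡))))
  where
  true≢false : true ≢ false
  true≢false ()

-- The root and the final bound

module _ (G : Graph) (r : Vertex G) (q : ℕ) (κ : IsKConnected 3 G) (cubicG : IsCubic G) where
  open Graph G using (ends; Joins)
  open Simple G κ cubicG
  open Decompositions r

  W : Subset (order G)
  W = ∁ ⁅ r ⁆

  r∉W : r ∉ W
  r∉W r∈ = x∈∁p⇒x∉p r∈ (x∈⁅x⁆ r)

  walk⇒reach : ∀ {u v} → u ∈ W → Walk H u v → Reach W u v
  walk⇒reach u∈ []              = here u∈
  walk⇒reach u∈ (step e e∈ j w) = step u∈ (e , j)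
    (walk⇒reach (proj₂ (E⁻ j (subst (e ∈_) (sym (E≡ W)) e∈))) w)

  outside-W : ∀ {v} → v ∉ W → v ≡ r
  outside-W v∉ = ∈⁅⁆⁻ (x∉∁p⇒x∈p v∉)

  neighbour∈W : ∀ {v} → Adj r v → v ∈ W
  neighbour∈W rv = x∉p⇒x∈∁p λ v∈ → irreflexive (subst (Adj r) (∈⁅⁆⁻ v∈) rv)

  root-cut : ∀ {a b c} → Adj r a → Adj r b → Adj r c → a ≢ b → a ≢ c → b ≢ c → ThreeCut W a b c r r r
  root-cut ra rb rc a≢b a≢c b≢c = record
    { p∈ = neighbour∈W ra ; q∈ = neighbour∈W rb ; l∈ = neighbour∈W rc ; x∉ = r∉W ; y∉ = r∉W ; w∉ = r∉W
    ; p≢q = a≢b ; p≢l = a≢c ; q≢l = b≢c ; px = adj-sym ra ; qy = adj-sym rb ; lw = adj-sym rc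
    ; exits = λ {u} {v} _ v∉ uv → let v≡r = outside-W v∉ in
        Sum.map (_, v≡r) (Sum.map (_, v≡r) (_, v≡r))
          (cubic a≢b a≢c b≢c ra rb rc (adj-sym (subst (Adj u) v≡r uv)))
    ; conn = λ u∈ v∈ → walk⇒reach u∈ (proj₂ (proj₂ κ ⁅ r ⁆ (s≤s (≤-trans (≤-reflexive (∣⁅x⁆∣≡1 r)) (s≤s z≤n)))) u∈ v∈)
    ; conn∁ = conn-resp (λ z∈ → x∉p⇒x∈∁p (λ z∈W → x∈∁p⇒x∉p z∈W z∈)) (λ z∈ → x∉∁p⇒x∈p (x∈∁p⇒x∉p z∈)) (conn-⁅⁆ r)
    }

  size≤ : ∀ {a b c} → Adj r a → Adj r b → Adj r c → a ≢ b → a ≢ c → b ≢ c → size G ≤ 3 + ∣ E W ∣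
  size≤ (e , je) (f , jf) (g , jg) a≢b a≢c b≢c = ≤-trans (≤-reflexive (sym (∣⊤∣≡n (size G))))
    (≤-trans (p⊆q⇒∣p∣≤∣q∣ {p = ⊤ {size G}} {q = ⁅ e ⁆ ∪ (⁅ f ⁆ ∪ (⁅ g ⁆ ∪ E W))} all)
      (≤-trans (∣⁅x⁆∪p∣≤ e _) (s≤s (≤-trans (∣⁅x⁆∪p∣≤ f _) (s≤s (∣⁅x⁆∪p∣≤ g _))))))
    where
    at-r : ∀ {d v} → Joins d r v → d ∈ ⁅ e ⁆ ∪ (⁅ f ⁆ ∪ (⁅ g ⁆ ∪ E W))
    at-r j with cubic a≢b a≢c b≢c (e , je) (f , jf) (g , jg) (_ , j)
    ... | inj₁ refl        = ∪ˡ (≡⇒∈⁅⁆ (edge-unique j je))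
    ... | inj₂ (inj₁ refl) = ∪ʳ (∪ˡ (≡⇒∈⁅⁆ (edge-unique j jf)))
    ... | inj₂ (inj₂ refl) = ∪ʳ (∪ʳ (∪ˡ (≡⇒∈⁅⁆ (edge-unique j jg))))

    all : ⊤ ⊆ ⁅ e ⁆ ∪ (⁅ f ⁆ ∪ (⁅ g ⁆ ∪ E W))
    all {d} _ with proj₁ (ends d) ∈? W | proj₂ (ends d) ∈? W
    ... | yes a∈ | yes b∈ = ∪ʳ (∪ʳ (∪ʳ (E⁺ (inj₁ refl) a∈ b∈)))
    ... | no a∉  | _      = at-r (inj₁ (cong (_, proj₂ (ends d)) (outside-W a∉)))
    ... | yes _  | no b∉  = at-r (inj₂ (cong (proj₁ (ends d) ,_) (outside-W b∉)))

  walk-edges : ∀ {K : Subgraph G} {u v} (w : Walk K u v) → All (_∈ edges K) (edgeList w)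
  walk-edges []             = []
  walk-edges (step e e∈ _ w) = e∈ ∷ walk-edges w

  cycleEdges⊆ : ∀ {K : Subgraph G} (C : Cycle K) → cycleEdges C ⊆ edges K
  cycleEdges⊆ C = ⋃⁻ (walk-edges (Cycle.walk C))

  EW≡ : E W ≡ edges H
  EW≡ = E≡ W

  solution⇒decomposition : ∀ {B} → Solution ⊥ W B → IsDecomposition H (edges H ─ B) B
  solution⇒decomposition {B} sol = record
    { cover = ⊆-antisym (∪-least ─⁻ˡ B⊆H) cover
    ; disjoint = ⊆-antisym (λ e∈ → let e∈T , e∈B = x∈p∩q⁻ (edges H ─ B) B e∈ in ⊥-elim (─⁻ʳ e∈T e∈B))
                           (⊥-elim ∘ ∉⊥)
    ; tree = record
      { T⊆E = ─⁻ˡ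
      ; connected = (let a , ra , _ = third-neighbour r r r in a , neighbour∈W ra)
                  , λ u∈ v∈ → walk-mono into (IsTree.spans t u∈ v∈)
      ; acyclic = no-cycle refl
      }
    ; 2-base = record
      { admissible = record
        { S⊆R = B⊆H ; R⊆E = id
        ; cycles = λ C (e , e∈) → ⊥-elim (─⁻ʳ e∈ (cycleEdges⊆ C (─⁻ˡ e∈))) }
      -- With F empty, `generates` makes every admissible R contain all edges of `G - r`.
      ; least = λ R adm e∈ → Solution.generates sol (Admissible.cycles adm) (Admissible.S⊆R adm) E-⊥
          (E-mono ∪ʳ (subst (_ ∈_) (sym EW≡) e∈))
      }
    }
    where
    t : IsTree W (E W ─ B)
    t = Solution.tree sol

    B⊆H : B ⊆ edges H
    B⊆H = subst (_ ∈_) EW≡ ∘ Solution.B⊆ sol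

    into : E W ─ B ⊆ edges H ─ B
    into e∈ = ─⁺ (subst (_ ∈_) EW≡ (─⁻ˡ e∈)) (─⁻ʳ e∈)

    onto : edges H ─ B ⊆ E W ─ B
    onto e∈ = ─⁺ (subst (_ ∈_) (sym EW≡) (─⁻ˡ e∈)) (─⁻ʳ e∈)

    cover : edges H ⊆ (edges H ─ B) ∪ B
    cover {e} e∈ with e ∈? B
    ... | yes e∈B = ∪ʳ e∈B
    ... | no e∉B  = ∪ˡ (─⁺ e∈ e∉B)

    no-cycle : ∀ {K : Subgraph G} → edges K ≡ edges H ─ B → ¬ Cycle K
    no-cycle {K} K≡ C = <⇒≢ nontrivial (sym (cong length
      (trans (sym (edgeList-mono K⊆ walk)) (IsTree.acyclic t (walk-mono K⊆ walk)
        (subst Unique (sym (edgeList-mono K⊆ walk)) distinct-edges)))))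
      where
      open Cycle C
      K⊆ : edges K ⊆ E W ─ B
      K⊆ = onto ∘ subst (_ ∈_) K≡

  module _ (short : Peripheral≤ q) where
    open Counting short

    many : Many ⊥ W
    many = let a , ra , _         = third-neighbour r r r
               b , rb , b≢a , _   = third-neighbour r a a
               c , rc , c≢a , c≢b = third-neighbour r a b
           in cuts (order G) (∣p∣≤n W) r∉W (root-cut ra rb rc (≢-sym b≢a) (≢-sym c≢a) (≢-sym c≢b))

    -- With e edges and n - 1 vertices in G - r, the count gives e - n + 2 ≤ k s,
    -- where 2 (e + 3) = 3 n.
    order≤ : order G ≤ 2 + 2 * (Many.k many * s)
    order≤ = +-cancelˡ-≤ (N + N) N _ (begin
      N + N + N
        ≡⟨ solve 1 (λ n → n :+ n :+ n := n :* con 3) refl N ⟩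
      N * 3
        ≡⟨ handshake G cubicG ⟩
      size G + size G
        ≤⟨ +-mono-≤ edges≤ edges≤ ⟩
      (3 + ∣ E W ∣) + (3 + ∣ E W ∣)
        ≡⟨ solve 1 (λ e → (con 3 :+ e) :+ (con 3 :+ e) := con 4 :+ ((con 1 :+ e) :+ (con 1 :+ e))) refl ∣ E W ∣ ⟩
      4 + (suc ∣ E W ∣ + suc ∣ E W ∣)
        ≤⟨ +-monoʳ-≤ 4 (+-mono-≤ (Many.count many) (Many.count many)) ⟩
      4 + ((∣ W ∣ + ks) + (∣ W ∣ + ks))
        ≡⟨ solve 2 (λ w a → con 4 :+ ((w :+ a) :+ (w :+ a)) :=
             ((con 1 :+ w) :+ (con 1 :+ w)) :+ (con 2 :+ con 2 :* a)) refl ∣ W ∣ ks ⟩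
      (suc ∣ W ∣ + suc ∣ W ∣) + (2 + 2 * ks)
        ≡⟨ cong (λ m → m + m + (2 + 2 * ks)) vertices ⟩
      N + N + (2 + 2 * ks) ∎)
      where
      open ≤-Reasoning
      open +-*-Solver
      N ks : ℕ
      N = order G
      ks = Many.k many * s

      edges≤ : size G ≤ 3 + ∣ E W ∣
      edges≤ = let a , ra , _         = third-neighbour r r r
                   b , rb , b≢a , _   = third-neighbour r a a
                   c , rc , c≢a , c≢b = third-neighbour r a b
               in size≤ ra rb rc (≢-sym b≢a) (≢-sym c≢a) (≢-sym c≢b)

      vertices : suc ∣ W ∣ ≡ N
      vertices = trans (cong suc (trans (∣∁p∣≡n∸∣p∣ ⁅ r ⁆) (cong (N ∸_) (∣⁅x⁆∣≡1 r))))
        (m+[n∸m]≡n {1} {N} (≤-trans (s≤s z≤n) (proj₁ κ)))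

    -- With k = 0 or q < 2 the bound would read n ≤ 2, against n > 3. Otherwise 2kq exceeds it by 4k
    -- - 2, which is `2 + 4 * j` for k = j + 1.
    exponent : ∀ q k → 3 < order G → order G ≤ 2 + 2 * (k * (q ∸ 2)) → order G ≤ k * (2 * q)
    exponent zero             k 3<n n≤ = ⊥-elim (<⇒≱ 3<n (≤-trans n≤ (≤-trans (≤-reflexive (cong (λ z → 2 + 2 * z) (*-zeroʳ k))) (s≤s (s≤s z≤n)))))
    exponent (suc zero)       k 3<n n≤ = ⊥-elim (<⇒≱ 3<n (≤-trans n≤ (≤-trans (≤-reflexive (cong (λ z → 2 + 2 * z) (*-zeroʳ k))) (s≤s (s≤s z≤n)))))
    exponent (suc (suc s))    zero    3<n n≤ = ⊥-elim (<⇒≱ 3<n (≤-trans n≤ (s≤s (s≤s z≤n))))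
    exponent (suc (suc s)) k@(suc j) 3<n n≤ = begin
      order G                ≤⟨ n≤ ⟩
      2 + 2 * (k * s)        ≤⟨ m≤n+m _ (2 + 4 * j) ⟩
      (2 + 4 * j) + (2 + 2 * (k * s))
        ≡⟨ solve 2 (λ j s → (con 2 :+ con 4 :* j) :+ (con 2 :+ con 2 :* ((con 1 :+ j) :* s)) :=
             (con 1 :+ j) :* (con 2 :* (con 2 :+ s))) refl j s ⟩
      k * (2 * (2 + s)) ∎
      where
      open ≤-Reasoning
      open +-*-Solver

    decompositions : AtLeast2^ (order G) (2 * q) (DecompositionPair H)
    decompositions = map pair (boolVectors k)
      , Unique.map⁺ (injective ∘ cong proj₂) (boolVectors-unique k)
      , All.map⁺ (All.universal (solution⇒decomposition ∘ sound) (boolVectors k))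
      , ≤-trans (^-monoʳ-≤ 2 (exponent q k (proj₁ κ) order≤)) (≤-reflexive (trans (sym (^-*-assoc 2 k (2 * q)))
          (cong (_^ (2 * q)) (trans (sym (length-boolVectors k)) (sym (length-map pair (boolVectors k)))))))
      where
      open Many many
      open Family family
      pair : Vec Bool k → Subset (size G) × Subset (size G)
      pair v = edges H ─ solve v , solve v

lemma7p3 : (G : Graph) (r : Vertex G) (q : ℕ) .{{_ : NonZero q}} →
    IsKConnected 3 G →
    IsCubic G →
    ((C : Cycle (whole G)) → IsPeripheral G (cycleEdges C) → cycleLength C ≤ q) →
    AtLeast2^ (order G) (2 * q) (DecompositionPair (deleteVertex G r))
lemma7p3 G r q κ cubicG short = decompositions G r q κ cubicG short
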